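{- $\mathsf{WKL}_0^-$ is $\Pi^1_1$ conservative over $\mathsf{RCA}_0^-$; that is, every $\Pi^1_1$ sentence of $L_2$ provable in $\mathsf{WKL}_0^-$ is provable in $\mathsf{RCA}_0^-$.
   Context: **Language $L_1$ and BASIC.** $L_1$ is the first-order language with constant $0$, unary function symbols $S,H,T$, binary function symbols $+,\cdot$, a binary pairing function symbol $(\cdot,\cdot)$, and a binary relation $<$. Write $1=S(0)$, $2=S(S(0))$, and $x\le y$ for $x<y\lor x=y$. Pairing associates to the right. BASIC consists of the universal closures of: $S(x)\neq 0$; $S(x)=S(y)\to x=y$; $x+0=x$; $x+S(y)=S(x+y)$; $x\cdot 0=0$; $x\cdot S(y)=x\cdot y+x$; $\lnot x<0$; $x<S(y)\leftrightarrow x<y\lor x=y$; $x<y\lor x=y\lor y<x$; $0<x\to\exists y<x\,S(y)=x$; $(x,y)=z\leftrightarrow 2\cdot z=(x+y)\cdot(x+y+1)+2\cdot x+2$; $(x,y)=(x',y')\to x=x'\land y=y'$; $z>0\to\exists x,y<z\,(x,y)=z$; $H((x,y))=x$; $H(0)=0$; $T((x,y))=y$; $T(0)=0$. **Language $L_2$.** $L_2$ is the two-sorted language extending $L_1$ with set variables and atomic formulas $t\in X$. $\Delta^0_0$ formulas are the $L_2$-formulas all of whose quantifiers are bounded number quantifiers (free set variables allowed). A $\Pi^1_1$ sentence has the form $\forall X\,\varphi(X)$ with $\varphi$ without set quantifiers. **$\mathsf{RCA}_0^-$.** $\mathrm{C}\Delta^0_0$ consists of BASIC, the induction axiom $\mathrm{IND}$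 (universal closure of $0\in X\land\forall x(x\in X\to S(x)\in X)\to x\in X$), and $\mathrm{C}[\Delta^0_0]$, the universal closures of $\exists X\forall x(x\in X\leftrightarrow\varphi(x))$ for $\varphi\in\Delta^0_0$ ($X$ not free in $\varphi$; other parameters allowed). For a set $f$, $f\in\mathcal F$ abbreviates $\forall x\exists y\,(x,y)\in f\land\forall x,y,y'((x,y)\in f\land(x,y')\in f\to y=y')\land 0\notin f$; $f(x)=y$ abbreviates $(x,y)\in f$. The axiom $\circ$ is $\forall g,h\in\mathcal F\;\exists f\in\mathcal F\;\forall x,y,z\,(h(x)=z\land g(z)=y\to f(x)=y)$. $\mathsf{RCA}_0^-:=\mathrm{C}\Delta^0_0+\circ$. **Trees and WKL.** $2^x\doteq y$ denotes a $\Delta_0$ formula defining the graph of exponentiation (with the usual recurrences provable by bounded induction). A finite $0$–$1$ sequence $\langle x_0,\dots,x_{n-1}\rangle$ is coded by the number with binary representation $1x_0\ldots x_{n-1}$, so every nonzero number codes a sequence and $1$ codes the empty one. For $\sigma,\tau>0$, $\sigma\preceq\tau$ ($\sigma$ is an initial segment of $\tau$) means $\exists p,y\le\tau\,\exists x<p\,(2^y\doteq p\land\tau=\sigma\cdot p+x)$; $\sigma\prec\tau$ means $\sigma\preceq\tau$ and $\sigma<\tau$. A set $T$ is a (binary) tree if $0\notin T$ and $\forall\tau\in T\,\forall\sigma\prec\tau\,(\sigma\in T)$. A tree is infinite if it is unbounded (no $b$ satisfies $\forall x\in T\,x<b$). A branch is a tree linearly ordered by $\preceq$. $\mathsf{WKL}$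 is the sentence: for every infinite tree $T$ there is an infinite tree $P$ such that $P$ is a branch and $P\subseteq T$. $\mathsf{WKL}_0^-:=\mathsf{RCA}_0^-+\mathsf{WKL}$. -}

module Defs where

open import Data.Nat.Base using (ℕ; zero; suc)
open import Data.Fin.Base using (Fin; zero; suc; lift)
open import Data.Fin.Patterns
open import Data.List.Base as List using (List)
open import Data.List.Membership.Propositional renaming (_∈_ to _∈ˡ_) using ()
open import Data.Vec.Functional using ([]; _∷_)
open import Function.Base using (id; _∘_)
open import Level using (0ℓ)
open import Relation.Binary.PropositionalEquality using (_≡_)
open import Relation.Unary using (Pred; _∪_; ｛_｝)

private
  variable
    n n′ m m′ : ℕ

------------------------------------------------------------------------
-- The languages L₁ and L₂

infixl 7 _·_
infixl 6 _+_
infix  5 _≈_ _<_ _∈_ _≤_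
infixr 4 _∧_
infixr 3 _∨_
infixr 2 _⇒_
infix  1 _⇔_

-- Well-scoped de Bruijn syntax: n counts the number variables in scope and m
-- the set variables; the innermost binder of each sort is index 0.

data Term (n : ℕ) : Set where
  var   : Fin n → Term n
  𝟎     : Term n
  S H T : Term n → Term n
  _+_   : Term n → Term n → Term n
  _·_   : Term n → Term n → Term n
  ⟨_,_⟩ : Term n → Term n → Term n

data Formula : ℕ → ℕ → Set where
  _≈_ : Term n → Term n → Formula n m
  _<_ : Term n → Term n → Formula n m
  _∈_ : Term n → Fin m → Formula n m
  ⊥′  : Formula n m
  _∧_ : Formula n m → Formula n m → Formula n m
  _∨_ : Formula n m → Formula n m → Formula n m
  _⇒_ : Formula n m → Formula n m → Formula n m
  ∀ⁿ  : Formula (suc n) m → Formula n m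
  ∃ⁿ  : Formula (suc n) m → Formula n m
  ∀ˢ  : Formula n (suc m) → Formula n m
  ∃ˢ  : Formula n (suc m) → Formula n m

Sentence : Set
Sentence = Formula 0 0

Theory : Set₁
Theory = Pred Sentence 0ℓ

pattern #0 = var 0F
pattern #1 = var 1F
pattern #2 = var 2F
pattern #3 = var 3F

------------------------------------------------------------------------
-- Simultaneous substitution of terms for number variables and of set
-- variables for set variables

subᵗ : (Fin n → Term n′) → Term n → Term n′
subᵗ σ (var i)   = σ i
subᵗ σ 𝟎         = 𝟎
subᵗ σ (S t)     = S (subᵗ σ t)
subᵗ σ (H t)     = H (subᵗ σ t)
subᵗ σ (T t)     = T (subᵗ σ t)
subᵗ σ (s + t)   = subᵗ σ s + subᵗ σ t
subᵗ σ (s · t)   = subᵗ σ s · subᵗ σ t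
subᵗ σ ⟨ s , t ⟩ = ⟨ subᵗ σ s , subᵗ σ t ⟩

wkᵗ : Term n → Term (suc n)
wkᵗ = subᵗ (var ∘ suc)

liftᵗ : (Fin n → Term n′) → Fin (suc n) → Term (suc n′)
liftᵗ σ = #0 ∷ (wkᵗ ∘ σ)

sub : (Fin n → Term n′) → (Fin m → Fin m′) → Formula n m → Formula n′ m′
sub σ ρ (s ≈ t) = subᵗ σ s ≈ subᵗ σ t
sub σ ρ (s < t) = subᵗ σ s < subᵗ σ t
sub σ ρ (t ∈ X) = subᵗ σ t ∈ ρ X
sub σ ρ ⊥′      = ⊥′
sub σ ρ (φ ∧ ψ) = sub σ ρ φ ∧ sub σ ρ ψ
sub σ ρ (φ ∨ ψ) = sub σ ρ φ ∨ sub σ ρ ψ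
sub σ ρ (φ ⇒ ψ) = sub σ ρ φ ⇒ sub σ ρ ψ
sub σ ρ (∀ⁿ φ)  = ∀ⁿ (sub (liftᵗ σ) ρ φ)
sub σ ρ (∃ⁿ φ)  = ∃ⁿ (sub (liftᵗ σ) ρ φ)
sub σ ρ (∀ˢ φ)  = ∀ˢ (sub σ (lift 1 ρ) φ)
sub σ ρ (∃ˢ φ)  = ∃ˢ (sub σ (lift 1 ρ) φ)

wkⁿ : Formula n m → Formula (suc n) m
wkⁿ = sub (var ∘ suc) id

wkˢ : Formula n m → Formula n (suc m)
wkˢ = sub var suc

_[_]ⁿ : Formula (suc n) m → Term n → Formula n m
φ [ t ]ⁿ = sub (t ∷ var) id φ

_[_]ˢ : Formula n (suc m) → Fin m → Formula n m
φ [ X ]ˢ = sub var (X ∷ id) φ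

fromSentence : Sentence → Formula n m
fromSentence = sub [] []

closure : ∀ n m → Formula n m → Sentence
closure zero    zero    φ = φ
closure zero    (suc m) φ = closure zero m (∀ˢ φ)
closure (suc n) m       φ = closure n m (∀ⁿ φ)

------------------------------------------------------------------------
-- Abbreviations

¬′_ : Formula n m → Formula n m
¬′ φ = φ ⇒ ⊥′

_⇔_ : Formula n m → Formula n m → Formula n m
φ ⇔ ψ = (φ ⇒ ψ) ∧ (ψ ⇒ φ)

_≤_ : Term n → Term n → Formula n m
s ≤ t = s < t ∨ s ≈ t

-- The bound lives outside the scope of the quantified variable.

∀< ∃< ∃≤ : Term n → Formula (suc n) m → Formula n m
∀< t φ = ∀ⁿ (#0 < wkᵗ t ⇒ φ)
∃< t φ = ∃ⁿ (#0 < wkᵗ t ∧ φ)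
∃≤ t φ = ∃ⁿ (#0 ≤ wkᵗ t ∧ φ)

𝟏 𝟐 : Term n
𝟏 = S 𝟎
𝟐 = S (S 𝟎)

------------------------------------------------------------------------
-- Syntactic classes

data Δ₀⁰ : Formula n m → Set where
  eq   : (s t : Term n) → Δ₀⁰ {n} {m} (s ≈ t)
  less : (s t : Term n) → Δ₀⁰ {n} {m} (s < t)
  mem  : (t : Term n) (X : Fin m) → Δ₀⁰ (t ∈ X)
  bot  : Δ₀⁰ {n} {m} ⊥′
  and  : {φ ψ : Formula n m} → Δ₀⁰ φ → Δ₀⁰ ψ → Δ₀⁰ (φ ∧ ψ)
  or   : {φ ψ : Formula n m} → Δ₀⁰ φ → Δ₀⁰ ψ → Δ₀⁰ (φ ∨ ψ)
  imp  : {φ ψ : Formula n m} → Δ₀⁰ φ → Δ₀⁰ ψ → Δ₀⁰ (φ ⇒ ψ)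
  all< : (t : Term n) {φ : Formula (suc n) m} → Δ₀⁰ φ → Δ₀⁰ (∀< t φ)
  ex<  : (t : Term n) {φ : Formula (suc n) m} → Δ₀⁰ φ → Δ₀⁰ (∃< t φ)

data NoSetQuantifier : Formula n m → Set where
  eq   : (s t : Term n) → NoSetQuantifier {n} {m} (s ≈ t)
  less : (s t : Term n) → NoSetQuantifier {n} {m} (s < t)
  mem  : (t : Term n) (X : Fin m) → NoSetQuantifier (t ∈ X)
  bot  : NoSetQuantifier {n} {m} ⊥′
  and  : {φ ψ : Formula n m} →
         NoSetQuantifier φ → NoSetQuantifier ψ → NoSetQuantifier (φ ∧ ψ)
  or   : {φ ψ : Formula n m} →
         NoSetQuantifier φ → NoSetQuantifier ψ → NoSetQuantifier (φ ∨ ψ)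
  imp  : {φ ψ : Formula n m} →
         NoSetQuantifier φ → NoSetQuantifier ψ → NoSetQuantifier (φ ⇒ ψ)
  all  : {φ : Formula (suc n) m} → NoSetQuantifier φ → NoSetQuantifier (∀ⁿ φ)
  ex   : {φ : Formula (suc n) m} → NoSetQuantifier φ → NoSetQuantifier (∃ⁿ φ)

data Π¹₁ : Sentence → Set where
  π¹₁ : {φ : Formula 0 1} → NoSetQuantifier φ → Π¹₁ (∀ˢ φ)

------------------------------------------------------------------------
-- Provability: classical two-sorted natural deduction with equality on
-- numbers

-- A derivation may use whatever variables are in scope, so the rules do not
-- by themselves say that the set sort is inhabited.  Every theory below
-- proves ∃ˢ of something by comprehension, so this makes no difference.

infix 0 _∣_⊢_ _⊢_

data _∣_⊢_ (Th : Theory) : List (Formula n m) → Formula n m → Set where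
  axm  : ∀ {Γ : List (Formula n m)} {φ} → Th φ → Th ∣ Γ ⊢ fromSentence φ
  hyp  : ∀ {Γ : List (Formula n m)} {φ} → φ ∈ˡ Γ → Th ∣ Γ ⊢ φ
  raa  : ∀ {Γ : List (Formula n m)} {φ} →
         Th ∣ (¬′ φ) List.∷ Γ ⊢ ⊥′ → Th ∣ Γ ⊢ φ
  ∧I   : ∀ {Γ : List (Formula n m)} {φ ψ} →
         Th ∣ Γ ⊢ φ → Th ∣ Γ ⊢ ψ → Th ∣ Γ ⊢ φ ∧ ψ
  ∧E₁  : ∀ {Γ : List (Formula n m)} {φ ψ} → Th ∣ Γ ⊢ φ ∧ ψ → Th ∣ Γ ⊢ φ
  ∧E₂  : ∀ {Γ : List (Formula n m)} {φ ψ} → Th ∣ Γ ⊢ φ ∧ ψ → Th ∣ Γ ⊢ ψ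
  ∨I₁  : ∀ {Γ : List (Formula n m)} {φ ψ} → Th ∣ Γ ⊢ φ → Th ∣ Γ ⊢ φ ∨ ψ
  ∨I₂  : ∀ {Γ : List (Formula n m)} {φ ψ} → Th ∣ Γ ⊢ ψ → Th ∣ Γ ⊢ φ ∨ ψ
  ∨E   : ∀ {Γ : List (Formula n m)} {φ ψ χ} → Th ∣ Γ ⊢ φ ∨ ψ →
         Th ∣ φ List.∷ Γ ⊢ χ → Th ∣ ψ List.∷ Γ ⊢ χ → Th ∣ Γ ⊢ χ
  ⇒I   : ∀ {Γ : List (Formula n m)} {φ ψ} →
         Th ∣ φ List.∷ Γ ⊢ ψ → Th ∣ Γ ⊢ φ ⇒ ψ
  ⇒E   : ∀ {Γ : List (Formula n m)} {φ ψ} →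
         Th ∣ Γ ⊢ φ ⇒ ψ → Th ∣ Γ ⊢ φ → Th ∣ Γ ⊢ ψ
  ∀ⁿI  : ∀ {Γ : List (Formula n m)} {φ} →
         Th ∣ List.map wkⁿ Γ ⊢ φ → Th ∣ Γ ⊢ ∀ⁿ φ
  ∀ⁿE  : ∀ {Γ : List (Formula n m)} {φ} →
         Th ∣ Γ ⊢ ∀ⁿ φ → (t : Term n) → Th ∣ Γ ⊢ φ [ t ]ⁿ
  ∃ⁿI  : ∀ {Γ : List (Formula n m)} {φ} (t : Term n) →
         Th ∣ Γ ⊢ φ [ t ]ⁿ → Th ∣ Γ ⊢ ∃ⁿ φ
  ∃ⁿE  : ∀ {Γ : List (Formula n m)} {φ ψ} → Th ∣ Γ ⊢ ∃ⁿ φ →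
         Th ∣ φ List.∷ List.map wkⁿ Γ ⊢ wkⁿ ψ → Th ∣ Γ ⊢ ψ
  ∀ˢI  : ∀ {Γ : List (Formula n m)} {φ} →
         Th ∣ List.map wkˢ Γ ⊢ φ → Th ∣ Γ ⊢ ∀ˢ φ
  ∀ˢE  : ∀ {Γ : List (Formula n m)} {φ} →
         Th ∣ Γ ⊢ ∀ˢ φ → (X : Fin m) → Th ∣ Γ ⊢ φ [ X ]ˢ
  ∃ˢI  : ∀ {Γ : List (Formula n m)} {φ} (X : Fin m) →
         Th ∣ Γ ⊢ φ [ X ]ˢ → Th ∣ Γ ⊢ ∃ˢ φ
  ∃ˢE  : ∀ {Γ : List (Formula n m)} {φ ψ} → Th ∣ Γ ⊢ ∃ˢ φ →
         Th ∣ φ List.∷ List.map wkˢ Γ ⊢ wkˢ ψ → Th ∣ Γ ⊢ ψ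
  ≈I   : ∀ {Γ : List (Formula n m)} (t : Term n) → Th ∣ Γ ⊢ t ≈ t
  ≈E   : ∀ {Γ : List (Formula n m)} (φ : Formula (suc n) m) {s t} →
         Th ∣ Γ ⊢ s ≈ t → Th ∣ Γ ⊢ φ [ s ]ⁿ → Th ∣ Γ ⊢ φ [ t ]ⁿ

_⊢_ : Theory → Sentence → Set
Th ⊢ φ = Th ∣ List.[] ⊢ φ

ConservativeOver : Pred Sentence 0ℓ → Theory → Theory → Set
ConservativeOver C Th₁ Th₀ = ∀ φ → C φ → Th₁ ⊢ φ → Th₀ ⊢ φ

------------------------------------------------------------------------
-- CΔ₀⁰ and RCA₀⁻

-- Free variables x, y, z, x′, y′ are numbered #0, #1, … in this order,
-- shifted under the bounded quantifiers.

data BASIC : Theory where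
  S≢0     : BASIC (closure 1 0 (¬′ (S #0 ≈ 𝟎)))
  S-inj   : BASIC (closure 2 0 (S #0 ≈ S #1 ⇒ #0 ≈ #1))
  +-zero  : BASIC (closure 1 0 (#0 + 𝟎 ≈ #0))
  +-suc   : BASIC (closure 2 0 (#0 + S #1 ≈ S (#0 + #1)))
  ·-zero  : BASIC (closure 1 0 (#0 · 𝟎 ≈ 𝟎))
  ·-suc   : BASIC (closure 2 0 (#0 · S #1 ≈ #0 · #1 + #0))
  ≮0      : BASIC (closure 1 0 (¬′ (#0 < 𝟎)))
  <-suc   : BASIC (closure 2 0 (#0 < S #1 ⇔ #0 < #1 ∨ #0 ≈ #1))
  <-tri   : BASIC (closure 2 0 (#0 < #1 ∨ #0 ≈ #1 ∨ #1 < #0))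
  pred    : BASIC (closure 1 0 (𝟎 < #0 ⇒ ∃< #0 (S #0 ≈ #1)))
  pair    : BASIC (closure 3 0
              (⟨ #0 , #1 ⟩ ≈ #2 ⇔
                𝟐 · #2 ≈ (#0 + #1) · (#0 + #1 + 𝟏) + 𝟐 · #0 + 𝟐))
  pairInj : BASIC (closure 4 0
              (⟨ #0 , #1 ⟩ ≈ ⟨ #2 , #3 ⟩ ⇒ #0 ≈ #2 ∧ #1 ≈ #3))
  pairSur : BASIC (closure 1 0 (𝟎 < #0 ⇒ ∃< #0 (∃< #1 (⟨ #1 , #0 ⟩ ≈ #2))))
  H-pair  : BASIC (closure 2 0 (H ⟨ #0 , #1 ⟩ ≈ #0))
  H-zero  : BASIC (H 𝟎 ≈ 𝟎)
  T-pair  : BASIC (closure 2 0 (T ⟨ #0 , #1 ⟩ ≈ #1))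
  T-zero  : BASIC (T 𝟎 ≈ 𝟎)

IND : Sentence
IND = closure 1 1 (𝟎 ∈ 0F ∧ ∀ⁿ (#0 ∈ 0F ⇒ S #0 ∈ 0F) ⇒ #0 ∈ 0F)

data Comprehension (C : ∀ {n m} → Formula n m → Set) : Theory where
  comp : {φ : Formula (suc n) m} → C φ →
         Comprehension C (closure n m (∃ˢ (∀ⁿ (#0 ∈ 0F ⇔ wkˢ φ))))

CΔ₀⁰ : Theory
CΔ₀⁰ = BASIC ∪ ｛ IND ｝ ∪ Comprehension Δ₀⁰

_∈𝓕 : Fin m → Formula n m
f ∈𝓕 = ∀ⁿ (∃ⁿ (⟨ #1 , #0 ⟩ ∈ f))
     ∧ ∀ⁿ (∀ⁿ (∀ⁿ (⟨ #2 , #1 ⟩ ∈ f ∧ ⟨ #2 , #0 ⟩ ∈ f ⇒ #1 ≈ #0)))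
     ∧ ¬′ (𝟎 ∈ f)

-- Set variables g, h, f are 2F, 1F, 0F in the innermost scope; x, y, z are
-- #2, #1, #0.

∘-axiom : Sentence
∘-axiom =
  ∀ˢ (∀ˢ (1F ∈𝓕 ∧ 0F ∈𝓕 ⇒
    ∃ˢ (0F ∈𝓕 ∧
      ∀ⁿ (∀ⁿ (∀ⁿ
        (⟨ #2 , #0 ⟩ ∈ 1F ∧ ⟨ #0 , #1 ⟩ ∈ 2F ⇒ ⟨ #2 , #1 ⟩ ∈ 0F))))))

RCA₀⁻ : Theory
RCA₀⁻ = CΔ₀⁰ ∪ ｛ ∘-axiom ｝

------------------------------------------------------------------------
-- Exponentiation, trees and WKL

-- A Δ₀ formula 2^x ≐ y in the free variables x = #0 and y = #1, for which
-- Δ₀ induction proves the recurrence equations of exponentiation.  They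
-- determine the formula up to provable equivalence, and (by induction on k)
-- make it hold of exactly the pairs (k , 2ᵏ) in the standard model.

record Exponentiation : Set where
  field
    graph     : Formula 2 0
    graph-Δ₀  : Δ₀⁰ graph

  exp : Term n → Term n → Formula n m
  exp s t = sub (s ∷ t ∷ []) [] graph

  field
    exp-zero : CΔ₀⁰ ⊢ closure 1 0 (exp 𝟎 #0 ⇔ #0 ≈ 𝟏)
    exp-suc  : CΔ₀⁰ ⊢ closure 2 0
                 (exp (S #0) #1 ⇔ ∃ⁿ (exp #1 #0 ∧ #2 ≈ 𝟐 · #0))

module Trees (E : Exponentiation) where
  open Exponentiation E using (exp)

  infix 5 _≼_ _≺_

  -- ∃ p, y ≤ t ∃ x < p, with p, y, x being #2, #1, #0 in the matrix.  The
  -- formula is refutable when s or t is 0, so positivity need not be imposed.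

  _≼_ : Term n → Term n → Formula n m
  s ≼ t =
    ∃≤ t (∃≤ (wkᵗ t) (∃< #1
      (exp #1 #2 ∧ wkᵗ (wkᵗ (wkᵗ t)) ≈ wkᵗ (wkᵗ (wkᵗ s)) · #2 + #0)))

  _≺_ : Term n → Term n → Formula n m
  s ≺ t = s ≼ t ∧ s < t

  Tree : Fin m → Formula n m
  Tree X = ¬′ (𝟎 ∈ X) ∧ ∀ⁿ (#0 ∈ X ⇒ ∀ⁿ (#0 ≺ #1 ⇒ #0 ∈ X))

  Unbounded : Fin m → Formula n m
  Unbounded X = ¬′ (∃ⁿ (∀ⁿ (#0 ∈ X ⇒ #0 < #1)))

  InfiniteTree : Fin m → Formula n m
  InfiniteTree X = Tree X ∧ Unbounded X

  -- ≼ is provably a partial order on positive numbers, so linearity amounts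
  -- to comparability.

  Branch : Fin m → Formula n m
  Branch X = Tree X ∧ ∀ⁿ (∀ⁿ (#1 ∈ X ∧ #0 ∈ X ⇒ #1 ≼ #0 ∨ #0 ≼ #1))

  _⊆_ : Fin m → Fin m → Formula n m
  X ⊆ Y = ∀ⁿ (#0 ∈ X ⇒ #0 ∈ Y)

  WKL : Sentence
  WKL = ∀ˢ (InfiniteTree 0F ⇒ ∃ˢ (InfiniteTree 0F ∧ Branch 0F ∧ 0F ⊆ 1F))

WKL₀⁻ : Exponentiation → Theory
WKL₀⁻ E = RCA₀⁻ ∪ ｛ Trees.WKL E ｝

-- Falsity is interpreted by an arbitrary proposition P, and truth values are
-- the propositions stable under double negation relative to P.  With P the
-- derivability of ⊥ from Γ, Henkin's construction yields constructively a
-- model of Γ whose arithmetical truths are the formulas that are eventually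
-- derivable.  A set-existence axiom ∃X ψ(X) with ψ arithmetical holds in it as
-- soon as adjoining ψ(X) with X fresh to arithmetical hypotheses over RCA₀⁻
-- creates no new refutations.  So only one step is needed: given a model of
-- RCA₀⁻ and an infinite tree T in it, adjoining a branch must not refute
-- anything.
--
-- This is done by forcing with the infinite subtrees of T.  The generic filter
-- determines a branch, and sets of the extension are read off from its long
-- initial segments.  Composition of functions makes { (x , x′) : f x ≤ f x′ }
-- a set, so a function on a bounded interval has a maximum by induction; that
-- is collection for Δ⁰₀ formulas.  Collection is the compactness needed of the
-- conditions (a bounded union of bounded trees is bounded) and shows that Δ⁰₀
-- definitions and composition do not lead out of the extension.
module Submission where

open import Defs

open import Data.Empty using (⊥-elim)
open import Data.Bool.Base using () renaming (T to IsTrue)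
open import Data.Fin.Base using (Fin; zero; suc; lift; _↑ʳ_; toℕ)
open import Data.Fin.Patterns
open import Data.List.Base as List using (List)
open import Data.List.Membership.Propositional using () renaming (_∈_ to _∈ˡ_)
open import Data.List.Membership.Propositional.Properties using (∈-map⁺; ∈-map⁻; ∈-++⁺ˡ; ∈-++⁺ʳ)
open import Data.List.Relation.Unary.All as All using (All)
open import Data.List.Relation.Unary.All.Properties using (++⁺)
open import Data.List.Relation.Unary.Any using (here; there)
open import Data.Maybe as Maybe using (Maybe; just; nothing; maybe′; zipWith; is-just; to-witness-T)
open import Data.Nat.Base as ℕ using (ℕ; zero; suc; z≤n; s≤s) renaming (_≤_ to _≤ℕ_; _⊔_ to _⊔ℕ_)
import Data.Nat.Properties as ℕ
open import Data.Product.Base using (Σ; _×_; _,_; proj₁; proj₂)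
open import Data.Sum.Base using (_⊎_; inj₁; inj₂)
open import Data.Unit.Base using (⊤; tt)
open import Data.Vec.Functional using ([]; _∷_)
open import Function.Base using (id; _∘_)
open import Relation.Binary.Definitions using (tri<; tri≈; tri>)
open import Relation.Binary.PropositionalEquality
  using (_≡_; refl; sym; trans; cong; cong₂; subst; subst₂)
open import Relation.Nullary.Decidable.Core using (yes; no)

-- The weakness of the base theory shapes the construction. Induction is available for sets only,
-- and exponentiation is not assumed total, so binary levels of a tree and codes of long sequences
-- need not exist. Length is therefore measured by the code of a node. A condition forces a
-- membership if its graph says so at all nodes with large enough code, a statement with an
-- unbounded universal quantifier. The sets of codes in `[b , 2b)`, which every chain reaching `b`
-- meets, turn such a statement into a `Δ₀⁰` one about the single number `b`, and only then does
-- collection apply to it. For the same reason a name carries its points of stabilisation as a set: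
-- bounded quantification and induction in the extension collect those points for boundedly many
-- arguments. Composition is the hard axiom, since the intermediate value is unbounded and no `Δ₀⁰`
-- formula defines the composite. The search is made by the nodes of the tree instead, up to a level
-- where all of them have found a value.

private
  variable
    n n′ n″ m m′ m″ : ℕ

-- Substitution

subᵗ-cong : {σ τ : Fin n → Term n′} → (∀ i → σ i ≡ τ i) → ∀ t → subᵗ σ t ≡ subᵗ τ t
subᵗ-cong h (var i)   = h i
subᵗ-cong h 𝟎         = refl
subᵗ-cong h (S t)     = cong S (subᵗ-cong h t)
subᵗ-cong h (H t)     = cong H (subᵗ-cong h t)
subᵗ-cong h (T t)     = cong T (subᵗ-cong h t)
subᵗ-cong h (s + t)   = cong₂ _+_ (subᵗ-cong h s) (subᵗ-cong h t)
subᵗ-cong h (s · t)   = cong₂ _·_ (subᵗ-cong h s) (subᵗ-cong h t)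
subᵗ-cong h ⟨ s , t ⟩ = cong₂ ⟨_,_⟩ (subᵗ-cong h s) (subᵗ-cong h t)

subᵗ-∘ : (τ : Fin n′ → Term n″) (σ : Fin n → Term n′) →
         ∀ t → subᵗ τ (subᵗ σ t) ≡ subᵗ (subᵗ τ ∘ σ) t
subᵗ-∘ τ σ (var i)   = refl
subᵗ-∘ τ σ 𝟎         = refl
subᵗ-∘ τ σ (S t)     = cong S (subᵗ-∘ τ σ t)
subᵗ-∘ τ σ (H t)     = cong H (subᵗ-∘ τ σ t)
subᵗ-∘ τ σ (T t)     = cong T (subᵗ-∘ τ σ t)
subᵗ-∘ τ σ (s + t)   = cong₂ _+_ (subᵗ-∘ τ σ s) (subᵗ-∘ τ σ t)
subᵗ-∘ τ σ (s · t)   = cong₂ _·_ (subᵗ-∘ τ σ s) (subᵗ-∘ τ σ t)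
subᵗ-∘ τ σ ⟨ s , t ⟩ = cong₂ ⟨_,_⟩ (subᵗ-∘ τ σ s) (subᵗ-∘ τ σ t)

subᵗ-id : ∀ (t : Term n) → subᵗ var t ≡ t
subᵗ-id (var i)   = refl
subᵗ-id 𝟎         = refl
subᵗ-id (S t)     = cong S (subᵗ-id t)
subᵗ-id (H t)     = cong H (subᵗ-id t)
subᵗ-id (T t)     = cong T (subᵗ-id t)
subᵗ-id (s + t)   = cong₂ _+_ (subᵗ-id s) (subᵗ-id t)
subᵗ-id (s · t)   = cong₂ _·_ (subᵗ-id s) (subᵗ-id t)
subᵗ-id ⟨ s , t ⟩ = cong₂ ⟨_,_⟩ (subᵗ-id s) (subᵗ-id t)

subᵗ-lift-wk : (σ : Fin n → Term n′) → ∀ t → subᵗ (liftᵗ σ) (wkᵗ t) ≡ wkᵗ (subᵗ σ t)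
subᵗ-lift-wk σ t = trans (subᵗ-∘ _ _ t) (sym (subᵗ-∘ _ _ t))

private
  liftᵗ-fuse : {τ : Fin n′ → Term n″} {σ : Fin n → Term n′} {υ : Fin n → Term n″} →
               (∀ i → subᵗ τ (σ i) ≡ υ i) → ∀ i → subᵗ (liftᵗ τ) (liftᵗ σ i) ≡ liftᵗ υ i
  liftᵗ-fuse         h zero    = refl
  liftᵗ-fuse {σ = σ} h (suc i) = trans (subᵗ-lift-wk _ (σ i)) (cong wkᵗ (h i))

  lift-fuse : {τ : Fin m′ → Fin m″} {σ : Fin m → Fin m′} {υ : Fin m → Fin m″} →
              (∀ i → τ (σ i) ≡ υ i) → ∀ i → lift 1 τ (lift 1 σ i) ≡ lift 1 υ i
  lift-fuse h zero    = refl
  lift-fuse h (suc i) = cong suc (h i)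

-- Together with `sub-id` this single fusion principle yields every other law of substitution used
-- below. The hypotheses are pointwise because functions on `Fin` are not extensional, so `υ` and
-- `p` may be any convenient form of the composites.
sub-fuse : {τ : Fin n′ → Term n″} {σ : Fin n → Term n′} {υ : Fin n → Term n″}
           {r : Fin m′ → Fin m″} {q : Fin m → Fin m′} {p : Fin m → Fin m″} →
           (∀ i → subᵗ τ (σ i) ≡ υ i) → (∀ X → r (q X) ≡ p X) →
           ∀ φ → sub τ r (sub σ q φ) ≡ sub υ p φ
sub-fuse {τ = τ} {σ} {υ} {r} {q} {p} h k = go
  where
  tm : ∀ t → subᵗ τ (subᵗ σ t) ≡ subᵗ υ t
  tm t = trans (subᵗ-∘ τ σ t) (subᵗ-cong h t)
  go : ∀ φ → sub τ r (sub σ q φ) ≡ sub υ p φ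
  go (s ≈ t) = cong₂ _≈_ (tm s) (tm t)
  go (s < t) = cong₂ _<_ (tm s) (tm t)
  go (t ∈ X) = cong₂ _∈_ (tm t) (k X)
  go ⊥′      = refl
  go (φ ∧ ψ) = cong₂ _∧_ (go φ) (go ψ)
  go (φ ∨ ψ) = cong₂ _∨_ (go φ) (go ψ)
  go (φ ⇒ ψ) = cong₂ _⇒_ (go φ) (go ψ)
  go (∀ⁿ φ)  = cong ∀ⁿ (sub-fuse (liftᵗ-fuse {τ = τ} {σ} h) k φ)
  go (∃ⁿ φ)  = cong ∃ⁿ (sub-fuse (liftᵗ-fuse {τ = τ} {σ} h) k φ)
  go (∀ˢ φ)  = cong ∀ˢ (sub-fuse h (lift-fuse k) φ)
  go (∃ˢ φ)  = cong ∃ˢ (sub-fuse h (lift-fuse k) φ)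

sub-id : {σ : Fin n → Term n} {q : Fin m → Fin m} →
         (∀ i → σ i ≡ var i) → (∀ X → q X ≡ X) → ∀ φ → sub σ q φ ≡ φ
sub-id {σ = σ} {q} h k = go
  where
  tm : ∀ t → subᵗ σ t ≡ t
  tm t = trans (subᵗ-cong h t) (subᵗ-id t)
  lᵗ : ∀ i → liftᵗ σ i ≡ var i
  lᵗ zero    = refl
  lᵗ (suc i) = cong wkᵗ (h i)
  lˢ : ∀ i → lift 1 q i ≡ i
  lˢ zero    = refl
  lˢ (suc i) = cong suc (k i)
  go : ∀ φ → sub σ q φ ≡ φ
  go (s ≈ t) = cong₂ _≈_ (tm s) (tm t)
  go (s < t) = cong₂ _<_ (tm s) (tm t)
  go (t ∈ X) = cong₂ _∈_ (tm t) (k X)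
  go ⊥′      = refl
  go (φ ∧ ψ) = cong₂ _∧_ (go φ) (go ψ)
  go (φ ∨ ψ) = cong₂ _∨_ (go φ) (go ψ)
  go (φ ⇒ ψ) = cong₂ _⇒_ (go φ) (go ψ)
  go (∀ⁿ φ)  = cong ∀ⁿ (sub-id lᵗ k φ)
  go (∃ⁿ φ)  = cong ∃ⁿ (sub-id lᵗ k φ)
  go (∀ˢ φ)  = cong ∀ˢ (sub-id h lˢ φ)
  go (∃ˢ φ)  = cong ∃ˢ (sub-id h lˢ φ)

sub-cong : {σ τ : Fin n → Term n′} {q r : Fin m → Fin m′} →
           (∀ i → σ i ≡ τ i) → (∀ X → q X ≡ r X) → ∀ φ → sub σ q φ ≡ sub τ r φ
sub-cong {σ = σ} {τ} {q} {r} h k φ =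
  trans (sym (sub-id (λ _ → refl) (λ _ → refl) (sub σ q φ)))
        (sub-fuse (λ i → trans (subᵗ-id _) (h i)) k φ)

sub-∘ : (τ : Fin n′ → Term n″) (r : Fin m′ → Fin m″) (σ : Fin n → Term n′) (q : Fin m → Fin m′) →
        ∀ φ → sub τ r (sub σ q φ) ≡ sub (subᵗ τ ∘ σ) (r ∘ q) φ
sub-∘ τ r σ q = sub-fuse (λ _ → refl) (λ _ → refl)

subᵗ-∷-wk : (t : Term n′) (σ : Fin n → Term n′) → ∀ s → subᵗ (t ∷ σ) (wkᵗ s) ≡ subᵗ σ s
subᵗ-∷-wk t σ s = subᵗ-∘ _ _ s

wkⁿ-[] : ∀ (φ : Formula n m) t → wkⁿ φ [ t ]ⁿ ≡ φ
wkⁿ-[] φ t = trans (sub-fuse (λ _ → refl) (λ _ → refl) φ) (sub-id (λ _ → refl) (λ _ → refl) φ)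

wkˢ-[] : ∀ (φ : Formula n m) X → wkˢ φ [ X ]ˢ ≡ φ
wkˢ-[] φ X = trans (sub-fuse (λ _ → refl) (λ _ → refl) φ) (sub-id (λ _ → refl) (λ _ → refl) φ)

sub-[]ⁿ : (σ : Fin n → Term n′) (q : Fin m → Fin m′) → ∀ φ t →
          sub (liftᵗ σ) q φ [ subᵗ σ t ]ⁿ ≡ sub σ q (φ [ t ]ⁿ)
sub-[]ⁿ σ q φ t = trans (sub-fuse h (λ _ → refl) φ) (sym (sub-fuse (λ _ → refl) (λ _ → refl) φ))
  where
  h : ∀ i → subᵗ (subᵗ σ t ∷ var) (liftᵗ σ i) ≡ subᵗ σ ((t ∷ var) i)
  h zero    = refl
  h (suc i) = trans (subᵗ-∷-wk _ _ (σ i)) (subᵗ-id (σ i))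

sub-[]ˢ : (σ : Fin n → Term n′) (q : Fin m → Fin m′) → ∀ φ X →
          sub σ (lift 1 q) φ [ q X ]ˢ ≡ sub σ q (φ [ X ]ˢ)
sub-[]ˢ σ q φ X = trans (sub-fuse (λ i → subᵗ-id (σ i)) h φ) (sym (sub-fuse (λ _ → refl) (λ _ → refl) φ))
  where
  h : ∀ Y → (q X ∷ id) (lift 1 q Y) ≡ q ((X ∷ id) Y)
  h zero    = refl
  h (suc Y) = refl

sub-lift-wkⁿ : (σ : Fin n → Term n′) (q : Fin m → Fin m′) → ∀ φ →
               sub (liftᵗ σ) q (wkⁿ φ) ≡ wkⁿ (sub σ q φ)
sub-lift-wkⁿ σ q φ =
  trans (sub-fuse (λ _ → refl) (λ _ → refl) φ) (sym (sub-fuse (λ _ → refl) (λ _ → refl) φ))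

sub-lift-wkˢ : (σ : Fin n → Term n′) (q : Fin m → Fin m′) → ∀ φ →
               sub σ (lift 1 q) (wkˢ φ) ≡ wkˢ (sub σ q φ)
sub-lift-wkˢ σ q φ =
  trans (sub-fuse (λ _ → refl) (λ _ → refl) φ) (sym (sub-fuse (λ i → subᵗ-id _) (λ _ → refl) φ))

sub-NSQ : (σ : Fin n → Term n′) (q : Fin m → Fin m′) → ∀ {φ} →
          NoSetQuantifier φ → NoSetQuantifier (sub σ q φ)
sub-NSQ σ q (eq s t)   = eq _ _
sub-NSQ σ q (less s t) = less _ _
sub-NSQ σ q (mem t X)  = mem _ _
sub-NSQ σ q bot        = bot
sub-NSQ σ q (and φ ψ)  = and (sub-NSQ σ q φ) (sub-NSQ σ q ψ)
sub-NSQ σ q (or φ ψ)   = or (sub-NSQ σ q φ) (sub-NSQ σ q ψ)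
sub-NSQ σ q (imp φ ψ)  = imp (sub-NSQ σ q φ) (sub-NSQ σ q ψ)
sub-NSQ σ q (all φ)    = all (sub-NSQ _ q φ)
sub-NSQ σ q (ex φ)     = ex (sub-NSQ _ q φ)

sub-Δ₀⁰ : (σ : Fin n → Term n′) (q : Fin m → Fin m′) → ∀ {φ} → Δ₀⁰ φ → Δ₀⁰ (sub σ q φ)
sub-Δ₀⁰ σ q (eq s t)   = eq _ _
sub-Δ₀⁰ σ q (less s t) = less _ _
sub-Δ₀⁰ σ q (mem t X)  = mem _ _
sub-Δ₀⁰ σ q bot        = bot
sub-Δ₀⁰ σ q (and φ ψ)  = and (sub-Δ₀⁰ σ q φ) (sub-Δ₀⁰ σ q ψ)
sub-Δ₀⁰ σ q (or φ ψ)   = or (sub-Δ₀⁰ σ q φ) (sub-Δ₀⁰ σ q ψ)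
sub-Δ₀⁰ σ q (imp φ ψ)  = imp (sub-Δ₀⁰ σ q φ) (sub-Δ₀⁰ σ q ψ)
sub-Δ₀⁰ σ q (all< t {φ} d) =
  subst Δ₀⁰ (cong (λ s → ∀ⁿ (#0 < s ⇒ sub (liftᵗ σ) q φ)) (sym (subᵗ-lift-wk σ t)))
    (all< (subᵗ σ t) (sub-Δ₀⁰ _ q d))
sub-Δ₀⁰ σ q (ex< t {φ} d) =
  subst Δ₀⁰ (cong (λ s → ∃ⁿ (#0 < s ∧ sub (liftᵗ σ) q φ)) (sym (subᵗ-lift-wk σ t)))
    (ex< (subᵗ σ t) (sub-Δ₀⁰ _ q d))

Δ₀⁰⇒NSQ : {φ : Formula n m} → Δ₀⁰ φ → NoSetQuantifier φ
Δ₀⁰⇒NSQ (eq s t)   = eq s t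
Δ₀⁰⇒NSQ (less s t) = less s t
Δ₀⁰⇒NSQ (mem t X)  = mem t X
Δ₀⁰⇒NSQ bot        = bot
Δ₀⁰⇒NSQ (and φ ψ)  = and (Δ₀⁰⇒NSQ φ) (Δ₀⁰⇒NSQ ψ)
Δ₀⁰⇒NSQ (or φ ψ)   = or (Δ₀⁰⇒NSQ φ) (Δ₀⁰⇒NSQ ψ)
Δ₀⁰⇒NSQ (imp φ ψ)  = imp (Δ₀⁰⇒NSQ φ) (Δ₀⁰⇒NSQ ψ)
Δ₀⁰⇒NSQ (all< t φ) = all (imp (less _ _) (Δ₀⁰⇒NSQ φ))
Δ₀⁰⇒NSQ (ex< t φ)  = ex (and (less _ _) (Δ₀⁰⇒NSQ φ))

module _ {Th : Theory} where

  -- Contexts are related by membership alone, so weakening, renaming, instantiation and removal of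
  -- fresh variables are all instances. Under a binder the substitution is lifted, and the equations
  -- for `liftᵗ` and `lift 1` realign the formulas.
  ⊢-sub : {Γ : List (Formula n m)} {Δ : List (Formula n′ m′)}
          (σ : Fin n → Term n′) (q : Fin m → Fin m′) →
          (∀ {ψ} → ψ ∈ˡ Γ → sub σ q ψ ∈ˡ Δ) →
          ∀ {φ} → Th ∣ Γ ⊢ φ → Th ∣ Δ ⊢ sub σ q φ
  private
    ⊢-sub-∷ : {Γ : List (Formula n m)} {Δ : List (Formula n′ m′)}
              (σ : Fin n → Term n′) (q : Fin m → Fin m′) →
              (∀ {ψ} → ψ ∈ˡ Γ → sub σ q ψ ∈ˡ Δ) →
              ∀ {φ χ} → Th ∣ χ List.∷ Γ ⊢ φ → Th ∣ sub σ q χ List.∷ Δ ⊢ sub σ q φ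
    ⊢-sub-∷ σ q h = ⊢-sub σ q λ { (here refl) → here refl ; (there i) → there (h i) }

    liftⁿ-∈ : {Γ : List (Formula n m)} {Δ : List (Formula n′ m′)}
              (σ : Fin n → Term n′) (q : Fin m → Fin m′) →
              (∀ {ψ} → ψ ∈ˡ Γ → sub σ q ψ ∈ˡ Δ) →
              ∀ {ψ} → ψ ∈ˡ List.map wkⁿ Γ → sub (liftᵗ σ) q ψ ∈ˡ List.map wkⁿ Δ
    liftⁿ-∈ σ q h i with ∈-map⁻ wkⁿ i
    ... | χ , j , refl = subst (_∈ˡ _) (sym (sub-lift-wkⁿ σ q χ)) (∈-map⁺ wkⁿ (h j))

    liftˢ-∈ : {Γ : List (Formula n m)} {Δ : List (Formula n′ m′)}
              (σ : Fin n → Term n′) (q : Fin m → Fin m′) →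
              (∀ {ψ} → ψ ∈ˡ Γ → sub σ q ψ ∈ˡ Δ) →
              ∀ {ψ} → ψ ∈ˡ List.map wkˢ Γ → sub σ (lift 1 q) ψ ∈ˡ List.map wkˢ Δ
    liftˢ-∈ σ q h i with ∈-map⁻ wkˢ i
    ... | χ , j , refl = subst (_∈ˡ _) (sym (sub-lift-wkˢ σ q χ)) (∈-map⁺ wkˢ (h j))

  ⊢-sub {Δ = Δ} σ q h (axm {φ = φ} a) =
    subst (Th ∣ Δ ⊢_) (sym (sub-fuse (λ ()) (λ ()) φ)) (axm a)
  ⊢-sub σ q h (hyp i)     = hyp (h i)
  ⊢-sub σ q h (raa d)     = raa (⊢-sub-∷ σ q h d)
  ⊢-sub σ q h (∧I d e)    = ∧I (⊢-sub σ q h d) (⊢-sub σ q h e)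
  ⊢-sub σ q h (∧E₁ d)     = ∧E₁ (⊢-sub σ q h d)
  ⊢-sub σ q h (∧E₂ d)     = ∧E₂ (⊢-sub σ q h d)
  ⊢-sub σ q h (∨I₁ d)     = ∨I₁ (⊢-sub σ q h d)
  ⊢-sub σ q h (∨I₂ d)     = ∨I₂ (⊢-sub σ q h d)
  ⊢-sub σ q h (∨E d e f)  = ∨E (⊢-sub σ q h d) (⊢-sub-∷ σ q h e) (⊢-sub-∷ σ q h f)
  ⊢-sub σ q h (⇒I d)      = ⇒I (⊢-sub-∷ σ q h d)
  ⊢-sub σ q h (⇒E d e)    = ⇒E (⊢-sub σ q h d) (⊢-sub σ q h e)
  ⊢-sub σ q h (∀ⁿI d)     = ∀ⁿI (⊢-sub (liftᵗ σ) q (liftⁿ-∈ σ q h) d)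
  ⊢-sub {Δ = Δ} σ q h (∀ⁿE {φ = φ} d t) =
    subst (Th ∣ Δ ⊢_) (sub-[]ⁿ σ q φ t) (∀ⁿE (⊢-sub σ q h d) (subᵗ σ t))
  ⊢-sub {Δ = Δ} σ q h (∃ⁿI {φ = φ} t d) =
    ∃ⁿI (subᵗ σ t) (subst (Th ∣ Δ ⊢_) (sym (sub-[]ⁿ σ q φ t)) (⊢-sub σ q h d))
  ⊢-sub σ q h (∃ⁿE {ψ = ψ} d e) =
    ∃ⁿE (⊢-sub σ q h d)
      (subst (Th ∣ _ ⊢_) (sub-lift-wkⁿ σ q ψ) (⊢-sub-∷ (liftᵗ σ) q (liftⁿ-∈ σ q h) e))
  ⊢-sub σ q h (∀ˢI d)     = ∀ˢI (⊢-sub σ (lift 1 q) (liftˢ-∈ σ q h) d)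
  ⊢-sub {Δ = Δ} σ q h (∀ˢE {φ = φ} d X) =
    subst (Th ∣ Δ ⊢_) (sub-[]ˢ σ q φ X) (∀ˢE (⊢-sub σ q h d) (q X))
  ⊢-sub {Δ = Δ} σ q h (∃ˢI {φ = φ} X d) =
    ∃ˢI (q X) (subst (Th ∣ Δ ⊢_) (sym (sub-[]ˢ σ q φ X)) (⊢-sub σ q h d))
  ⊢-sub σ q h (∃ˢE {ψ = ψ} d e) =
    ∃ˢE (⊢-sub σ q h d)
      (subst (Th ∣ _ ⊢_) (sub-lift-wkˢ σ q ψ) (⊢-sub-∷ σ (lift 1 q) (liftˢ-∈ σ q h) e))
  ⊢-sub σ q h (≈I t)      = ≈I (subᵗ σ t)
  ⊢-sub {Δ = Δ} σ q h (≈E φ {s} {t} d e) =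
    subst (Th ∣ Δ ⊢_) (sub-[]ⁿ σ q φ t)
      (≈E (sub (liftᵗ σ) q φ) (⊢-sub σ q h d)
        (subst (Th ∣ Δ ⊢_) (sym (sub-[]ⁿ σ q φ s)) (⊢-sub σ q h e)))

  ⊢-mono : {Γ Δ : List (Formula n m)} → (∀ {ψ} → ψ ∈ˡ Γ → ψ ∈ˡ Δ) →
           ∀ {φ} → Th ∣ Γ ⊢ φ → Th ∣ Δ ⊢ φ
  ⊢-mono {Δ = Δ} h {φ} d = subst (Th ∣ Δ ⊢_) (sub-id (λ _ → refl) (λ _ → refl) φ)
    (⊢-sub var id (λ {ψ} i → subst (_∈ˡ Δ) (sym (sub-id (λ _ → refl) (λ _ → refl) ψ)) (h i)) d)

-- Algebra-valued semantics

-- Only meets and implication are primitive. Disjunction and existence are defined through negation,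
-- and `⊥-raa` makes this sound for classical logic. One soundness proof then serves both truth
-- relative to `P` and forcing.
record Algebra : Set₂ where
  infix  4 _⊑_
  infixr 7 _⊓_
  infixr 6 _⇛_
  field
    Ω       : Set₁
    _⊑_     : Ω → Ω → Set
    𝟙 ⊥̂     : Ω
    _⊓_ _⇛_ : Ω → Ω → Ω
    ⨅       : {I : Set} → (I → Ω) → Ω
    ⊑-refl  : ∀ {a} → a ⊑ a
    ⊑-trans : ∀ {a b c} → a ⊑ b → b ⊑ c → a ⊑ c
    ⊑-𝟙     : ∀ {a} → a ⊑ 𝟙
    ⊓-fst   : ∀ {a b} → a ⊓ b ⊑ a
    ⊓-snd   : ∀ {a b} → a ⊓ b ⊑ b
    ⊓-pair  : ∀ {a b c} → a ⊑ b → a ⊑ c → a ⊑ b ⊓ c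
    ⇛-intro : ∀ {a b c} → b ⊓ a ⊑ c → a ⊑ b ⇛ c
    ⇛-elim  : ∀ {a b c} → a ⊑ b ⇛ c → a ⊑ b → a ⊑ c
    ⨅-intro : ∀ {I a} {f : I → Ω} → (∀ i → a ⊑ f i) → a ⊑ ⨅ f
    ⨅-elim  : ∀ {I} {f : I → Ω} i → ⨅ f ⊑ f i
    ⊥-raa   : ∀ {a b} → (b ⇛ ⊥̂) ⊓ a ⊑ ⊥̂ → a ⊑ b

  infixr 6 _⊔_
  ∼_ : Ω → Ω
  ∼ a = a ⇛ ⊥̂

  _⊔_ : Ω → Ω → Ω
  a ⊔ b = ∼ (∼ a ⊓ ∼ b)

  ⨆ : {I : Set} → (I → Ω) → Ω
  ⨆ f = ∼ ⨅ (λ i → ∼ f i)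

  ⊓-mono : ∀ {a b c d} → a ⊑ c → b ⊑ d → a ⊓ b ⊑ c ⊓ d
  ⊓-mono p q = ⊓-pair (⊑-trans ⊓-fst p) (⊑-trans ⊓-snd q)

  ⇛-mono : ∀ {a b c d} → c ⊑ a → b ⊑ d → a ⇛ b ⊑ c ⇛ d
  ⇛-mono p q = ⇛-intro (⊑-trans (⇛-elim ⊓-snd (⊑-trans ⊓-fst p)) q)

  ∼-mono : ∀ {a b} → a ⊑ b → ∼ b ⊑ ∼ a
  ∼-mono p = ⇛-mono p ⊑-refl

  ⊔-mono : ∀ {a b c d} → a ⊑ c → b ⊑ d → a ⊔ b ⊑ c ⊔ d
  ⊔-mono p q = ∼-mono (⊓-mono (∼-mono p) (∼-mono q))

  ⨅-mono : ∀ {I} {f g : I → Ω} → (∀ i → f i ⊑ g i) → ⨅ f ⊑ ⨅ g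
  ⨅-mono p = ⨅-intro (λ i → ⊑-trans (⨅-elim i) (p i))

  ⨆-mono : ∀ {I} {f g : I → Ω} → (∀ i → f i ⊑ g i) → ⨆ f ⊑ ⨆ g
  ⨆-mono p = ∼-mono (⨅-mono (λ i → ∼-mono (p i)))

  ∼-intro : ∀ {a b} → b ⊓ a ⊑ ⊥̂ → a ⊑ ∼ b
  ∼-intro = ⇛-intro

  ⊔-inl : ∀ {a b} → a ⊑ a ⊔ b
  ⊔-inl = ∼-intro (⇛-elim (⊑-trans ⊓-fst ⊓-fst) ⊓-snd)

  ⊔-inr : ∀ {a b} → b ⊑ a ⊔ b
  ⊔-inr = ∼-intro (⇛-elim (⊑-trans ⊓-fst ⊓-snd) ⊓-snd)

  ⊔-case : ∀ {a b c d} → d ⊑ a ⊔ b → a ⊓ d ⊑ c → b ⊓ d ⊑ c → d ⊑ c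
  ⊔-case o p q = ⊥-raa (⇛-elim (⊑-trans ⊓-snd o) (⊓-pair (refute p) (refute q)))
    where
    refute : ∀ {x c d} → x ⊓ d ⊑ c → ∼ c ⊓ d ⊑ ∼ x
    refute r = ∼-intro (⇛-elim (⊑-trans ⊓-snd ⊓-fst) (⊑-trans (⊓-mono ⊑-refl ⊓-snd) r))

  ⨆-intro : ∀ {I} {f : I → Ω} i → f i ⊑ ⨆ f
  ⨆-intro i = ∼-intro (⇛-elim (⊑-trans ⊓-fst (⨅-elim i)) ⊓-snd)

  ⨆-case : ∀ {I} {f : I → Ω} {c d} → d ⊑ ⨆ f → (∀ i → f i ⊓ d ⊑ c) → d ⊑ c
  ⨆-case o p = ⊥-raa (⇛-elim (⊑-trans ⊓-snd o) (⨅-intro λ i →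
    ∼-intro (⇛-elim (⊑-trans ⊓-snd ⊓-fst) (⊑-trans (⊓-mono ⊑-refl ⊓-snd) (p i)))))

  ∼-curry : ∀ {a b} → ∼ (a ⊓ b) ⊑ a ⇛ ∼ b
  ∼-curry = ⇛-intro (⇛-intro (⇛-elim (⊑-trans ⊓-snd ⊓-snd) (⊓-pair (⊑-trans ⊓-snd ⊓-fst) ⊓-fst)))

  ∼-uncurry : ∀ {a b} → a ⇛ ∼ b ⊑ ∼ (a ⊓ b)
  ∼-uncurry = ⇛-intro (⇛-elim (⇛-elim ⊓-snd (⊑-trans ⊓-fst ⊓-fst)) (⊑-trans ⊓-fst ⊓-snd))

record NumberStructure : Set₁ where
  infix  4 _≋_
  infixl 6 _⊕_
  infixl 7 _⊗_
  field
    M             : Set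
    _≋_           : M → M → Set
    𝟘             : M
    s̲ h̲ t̲         : M → M
    _⊕_ _⊗_ pr    : M → M → M
    ≋-refl        : ∀ {x} → x ≋ x
    ≋-sym         : ∀ {x y} → x ≋ y → y ≋ x
    ≋-trans       : ∀ {x y z} → x ≋ y → y ≋ z → x ≋ z
    s-cong        : ∀ {x y} → x ≋ y → s̲ x ≋ s̲ y
    h-cong        : ∀ {x y} → x ≋ y → h̲ x ≋ h̲ y
    t-cong        : ∀ {x y} → x ≋ y → t̲ x ≋ t̲ y
    ⊕-cong        : ∀ {x y u v} → x ≋ y → u ≋ v → x ⊕ u ≋ y ⊕ v
    ⊗-cong        : ∀ {x y u v} → x ≋ y → u ≋ v → x ⊗ u ≋ y ⊗ v
    pr-cong       : ∀ {x y u v} → x ≋ y → u ≋ v → pr x u ≋ pr y v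

  val : Term n → (Fin n → M) → M
  val (var i)   ρ = ρ i
  val 𝟎         ρ = 𝟘
  val (S t)     ρ = s̲ (val t ρ)
  val (H t)     ρ = h̲ (val t ρ)
  val (T t)     ρ = t̲ (val t ρ)
  val (s + t)   ρ = val s ρ ⊕ val t ρ
  val (s · t)   ρ = val s ρ ⊗ val t ρ
  val ⟨ s , t ⟩ ρ = pr (val s ρ) (val t ρ)

  val-sub : {σ : Fin n → Term n′} {ρ′ : Fin n′ → M} {ρ : Fin n → M} →
            (∀ i → val (σ i) ρ′ ≋ ρ i) → ∀ t → val (subᵗ σ t) ρ′ ≋ val t ρ
  val-sub h (var i)   = h i
  val-sub h 𝟎         = ≋-refl
  val-sub h (S t)     = s-cong (val-sub h t)
  val-sub h (H t)     = h-cong (val-sub h t)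
  val-sub h (T t)     = t-cong (val-sub h t)
  val-sub h (s + t)   = ⊕-cong (val-sub h s) (val-sub h t)
  val-sub h (s · t)   = ⊗-cong (val-sub h s) (val-sub h t)
  val-sub h ⟨ s , t ⟩ = pr-cong (val-sub h s) (val-sub h t)

  val-cong : {ρ ρ′ : Fin n → M} → (∀ i → ρ i ≋ ρ′ i) → ∀ t → val t ρ ≋ val t ρ′
  val-cong h (var i)   = h i
  val-cong h 𝟎         = ≋-refl
  val-cong h (S t)     = s-cong (val-cong h t)
  val-cong h (H t)     = h-cong (val-cong h t)
  val-cong h (T t)     = t-cong (val-cong h t)
  val-cong h (s + t)   = ⊕-cong (val-cong h s) (val-cong h t)
  val-cong h (s · t)   = ⊗-cong (val-cong h s) (val-cong h t)
  val-cong h ⟨ s , t ⟩ = pr-cong (val-cong h s) (val-cong h t)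

  val-wk : ∀ (t : Term n) {x ρ} → val (wkᵗ t) (x ∷ ρ) ≋ val t ρ
  val-wk t = val-sub (λ _ → ≋-refl) t

-- The congruence `≋` is a plain relation and need not be stable, whereas `eq̲` is a truth value. By
-- `eq-elim` an equation may be treated as `≋` whenever the goal is an inequality of truth values,
-- which is all that Leibniz's law needs and avoids quotients.
record Interpretation (A : Algebra) (N : NumberStructure) : Set₁ where
  open Algebra A
  open NumberStructure N
  field
    𝒳        : Set
    eq̲ lt̲    : M → M → Ω
    mem̲      : M → 𝒳 → Ω
    eq-intro : ∀ {x y} → x ≋ y → ∀ {a} → a ⊑ eq̲ x y
    eq-elim  : ∀ {x y a c} → (x ≋ y → a ⊑ c) → a ⊑ eq̲ x y → a ⊑ c
    lt-resp  : ∀ {x y u v} → x ≋ y → u ≋ v → lt̲ x u ⊑ lt̲ y v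
    mem-resp : ∀ {x y X} → x ≋ y → mem̲ x X ⊑ mem̲ y X

  ⟦_⟧ : Formula n m → (Fin n → M) → (Fin m → 𝒳) → Ω
  ⟦ s ≈ t ⟧ ρ δ = eq̲ (val s ρ) (val t ρ)
  ⟦ s < t ⟧ ρ δ = lt̲ (val s ρ) (val t ρ)
  ⟦ t ∈ X ⟧ ρ δ = mem̲ (val t ρ) (δ X)
  ⟦ ⊥′    ⟧ ρ δ = ⊥̂
  ⟦ φ ∧ ψ ⟧ ρ δ = ⟦ φ ⟧ ρ δ ⊓ ⟦ ψ ⟧ ρ δ
  ⟦ φ ∨ ψ ⟧ ρ δ = ⟦ φ ⟧ ρ δ ⊔ ⟦ ψ ⟧ ρ δ
  ⟦ φ ⇒ ψ ⟧ ρ δ = ⟦ φ ⟧ ρ δ ⇛ ⟦ ψ ⟧ ρ δ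
  ⟦ ∀ⁿ φ  ⟧ ρ δ = ⨅ λ x → ⟦ φ ⟧ (x ∷ ρ) δ
  ⟦ ∃ⁿ φ  ⟧ ρ δ = ⨆ λ x → ⟦ φ ⟧ (x ∷ ρ) δ
  ⟦ ∀ˢ φ  ⟧ ρ δ = ⨅ λ X → ⟦ φ ⟧ ρ (X ∷ δ)
  ⟦ ∃ˢ φ  ⟧ ρ δ = ⨆ λ X → ⟦ φ ⟧ ρ (X ∷ δ)

  private
    _⊒⊑_ : Ω → Ω → Set
    a ⊒⊑ b = (a ⊑ b) × (b ⊑ a)

  ⟦⟧-sub : {σ : Fin n → Term n′} {ρ′ : Fin n′ → M} {ρ : Fin n → M}
           {q : Fin m → Fin m′} {δ′ : Fin m′ → 𝒳} {δ : Fin m → 𝒳} →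
           (∀ i → val (σ i) ρ′ ≋ ρ i) → (∀ X → δ′ (q X) ≡ δ X) →
           ∀ φ → (⟦ sub σ q φ ⟧ ρ′ δ′ ⊑ ⟦ φ ⟧ ρ δ) × (⟦ φ ⟧ ρ δ ⊑ ⟦ sub σ q φ ⟧ ρ′ δ′)
  ⟦⟧-sub {n} {n′} {m} {m′} {σ} {ρ′} {ρ} {q} {δ′} {δ} h k = go
    where
    num : ∀ φ x → ⟦ sub (liftᵗ σ) q φ ⟧ (x ∷ ρ′) δ′ ⊒⊑ ⟦ φ ⟧ (x ∷ ρ) δ
    num φ x = ⟦⟧-sub (λ { zero → ≋-refl ; (suc i) → ≋-trans (val-wk (σ i)) (h i) }) k φ
    set : ∀ φ X → ⟦ sub σ (lift 1 q) φ ⟧ ρ′ (X ∷ δ′) ⊒⊑ ⟦ φ ⟧ ρ (X ∷ δ)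
    set φ X = ⟦⟧-sub h (λ { zero → refl ; (suc i) → k i }) φ
    go : ∀ φ → ⟦ sub σ q φ ⟧ ρ′ δ′ ⊒⊑ ⟦ φ ⟧ ρ δ
    go (s ≈ t) =
      let p = val-sub h s ; r = val-sub h t in
      eq-elim (λ e → eq-intro (≋-trans (≋-sym p) (≋-trans e r))) ⊑-refl ,
      eq-elim (λ e → eq-intro (≋-trans p (≋-trans e (≋-sym r)))) ⊑-refl
    go (s < t) =
      let p = val-sub h s ; r = val-sub h t in
      lt-resp p r , lt-resp (≋-sym p) (≋-sym r)
    go (t ∈ X) rewrite k X =
      let p = val-sub h t in
      mem-resp p , mem-resp (≋-sym p)
    go ⊥′      = ⊑-refl , ⊑-refl
    go (φ ∧ ψ) = ⊓-mono (proj₁ (go φ)) (proj₁ (go ψ)) , ⊓-mono (proj₂ (go φ)) (proj₂ (go ψ))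
    go (φ ∨ ψ) = ⊔-mono (proj₁ (go φ)) (proj₁ (go ψ)) , ⊔-mono (proj₂ (go φ)) (proj₂ (go ψ))
    go (φ ⇒ ψ) = ⇛-mono (proj₂ (go φ)) (proj₁ (go ψ)) , ⇛-mono (proj₁ (go φ)) (proj₂ (go ψ))
    go (∀ⁿ φ)  = ⨅-mono (λ x → proj₁ (num φ x)) , ⨅-mono (λ x → proj₂ (num φ x))
    go (∃ⁿ φ)  = ⨆-mono (λ x → proj₁ (num φ x)) , ⨆-mono (λ x → proj₂ (num φ x))
    go (∀ˢ φ)  = ⨅-mono (λ X → proj₁ (set φ X)) , ⨅-mono (λ X → proj₂ (set φ X))
    go (∃ˢ φ)  = ⨆-mono (λ X → proj₁ (set φ X)) , ⨆-mono (λ X → proj₂ (set φ X))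

  ⟦⟧-cong : {ρ ρ′ : Fin n → M} {δ δ′ : Fin m → 𝒳} →
            (∀ i → ρ i ≋ ρ′ i) → (∀ X → δ X ≡ δ′ X) →
            ∀ φ → ⟦ φ ⟧ ρ δ ⊑ ⟦ φ ⟧ ρ′ δ′
  ⟦⟧-cong {ρ = ρ} {ρ′} {δ} {δ′} h k φ =
    subst (λ ψ → ⟦ ψ ⟧ ρ δ ⊑ ⟦ φ ⟧ ρ′ δ′) (sub-id (λ _ → refl) (λ _ → refl) φ)
      (proj₁ (⟦⟧-sub {σ = var} {q = id} h k φ))

  ⟦_⟧* : List (Formula n m) → (Fin n → M) → (Fin m → 𝒳) → Ω
  ⟦ List.[] ⟧* ρ δ    = 𝟙
  ⟦ φ List.∷ Γ ⟧* ρ δ = ⟦ φ ⟧ ρ δ ⊓ ⟦ Γ ⟧* ρ δ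

  ⟦⟧*-wkⁿ : ∀ (Γ : List (Formula n m)) {x ρ δ} → ⟦ Γ ⟧* ρ δ ⊑ ⟦ List.map wkⁿ Γ ⟧* (x ∷ ρ) δ
  ⟦⟧*-wkⁿ List.[]      = ⊑-refl
  ⟦⟧*-wkⁿ (φ List.∷ Γ) =
    ⊓-mono (proj₂ (⟦⟧-sub (λ _ → ≋-refl) (λ _ → refl) φ)) (⟦⟧*-wkⁿ Γ)

  ⟦⟧*-wkˢ : ∀ (Γ : List (Formula n m)) {X ρ δ} → ⟦ Γ ⟧* ρ δ ⊑ ⟦ List.map wkˢ Γ ⟧* ρ (X ∷ δ)
  ⟦⟧*-wkˢ List.[]      = ⊑-refl
  ⟦⟧*-wkˢ (φ List.∷ Γ) =
    ⊓-mono (proj₂ (⟦⟧-sub (λ _ → ≋-refl) (λ _ → refl) φ)) (⟦⟧*-wkˢ Γ)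

  ⟦⟧*-∈ : {Γ : List (Formula n m)} {φ : Formula n m} → φ ∈ˡ Γ → ∀ {ρ δ} → ⟦ Γ ⟧* ρ δ ⊑ ⟦ φ ⟧ ρ δ
  ⟦⟧*-∈ (here refl) = ⊓-fst
  ⟦⟧*-∈ (there i)   = ⊑-trans ⊓-snd (⟦⟧*-∈ i)

  ⟦⟧*-intro : (Γ : List (Formula n m)) → ∀ {a ρ δ} → (∀ {φ} → φ ∈ˡ Γ → a ⊑ ⟦ φ ⟧ ρ δ) → a ⊑ ⟦ Γ ⟧* ρ δ
  ⟦⟧*-intro List.[]      h = ⊑-𝟙
  ⟦⟧*-intro (φ List.∷ Γ) h = ⊓-pair (h (here refl)) (⟦⟧*-intro Γ (h ∘ there))

  module _ {Th : Theory} (valid : ∀ {φ} → Th φ → 𝟙 ⊑ ⟦ φ ⟧ [] []) where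

    sound : {Γ : List (Formula n m)} {φ : Formula n m} → Th ∣ Γ ⊢ φ →
            ∀ {ρ δ} → ⟦ Γ ⟧* ρ δ ⊑ ⟦ φ ⟧ ρ δ
    sound (axm {φ = φ} a) = ⊑-trans ⊑-𝟙 (⊑-trans (valid a) (proj₂ (⟦⟧-sub (λ ()) (λ ()) φ)))
    sound (hyp i) = ⟦⟧*-∈ i
    sound (raa d) = ⊥-raa (sound d)
    sound (∧I d e) = ⊓-pair (sound d) (sound e)
    sound (∧E₁ d) = ⊑-trans (sound d) ⊓-fst
    sound (∧E₂ d) = ⊑-trans (sound d) ⊓-snd
    sound (∨I₁ d) = ⊑-trans (sound d) ⊔-inl
    sound (∨I₂ d) = ⊑-trans (sound d) ⊔-inr
    sound (∨E d e f) = ⊔-case (sound d) (sound e) (sound f)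
    sound (⇒I d) = ⇛-intro (sound d)
    sound (⇒E d e) = ⇛-elim (sound d) (sound e)
    sound (∀ⁿI {Γ = Γ} d) = ⨅-intro (λ x → ⊑-trans (⟦⟧*-wkⁿ Γ) (sound d))
    sound (∀ⁿE {φ = φ} d t) {ρ} = ⊑-trans (sound d) (⊑-trans (⨅-elim (val t ρ))
      (proj₂ (⟦⟧-sub (λ { zero → ≋-refl ; (suc i) → ≋-refl }) (λ _ → refl) φ)))
    sound (∃ⁿI {φ = φ} t d) {ρ} = ⊑-trans (sound d)
      (⊑-trans (proj₁ (⟦⟧-sub (λ { zero → ≋-refl ; (suc i) → ≋-refl }) (λ _ → refl) φ))
               (⨆-intro (val t ρ)))
    sound (∃ⁿE {Γ = Γ} {ψ = ψ} d e) = ⨆-case (sound d) λ x →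
      ⊑-trans (⊓-mono ⊑-refl (⟦⟧*-wkⁿ Γ))
        (⊑-trans (sound e) (proj₁ (⟦⟧-sub (λ _ → ≋-refl) (λ _ → refl) ψ)))
    sound (∀ˢI {Γ = Γ} d) = ⨅-intro (λ x → ⊑-trans (⟦⟧*-wkˢ Γ) (sound d))
    sound (∀ˢE {φ = φ} d X) {ρ} {δ} = ⊑-trans (sound d) (⊑-trans (⨅-elim (δ X))
      (proj₂ (⟦⟧-sub (λ _ → ≋-refl) (λ { zero → refl ; (suc i) → refl }) φ)))
    sound (∃ˢI {φ = φ} X d) {ρ} {δ} = ⊑-trans (sound d)
      (⊑-trans (proj₁ (⟦⟧-sub (λ _ → ≋-refl) (λ { zero → refl ; (suc i) → refl }) φ))
               (⨆-intro (δ X)))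
    sound (∃ˢE {Γ = Γ} {ψ = ψ} d e) = ⨆-case (sound d) λ x →
      ⊑-trans (⊓-mono ⊑-refl (⟦⟧*-wkˢ Γ))
        (⊑-trans (sound e) (proj₁ (⟦⟧-sub (λ _ → ≋-refl) (λ _ → refl) ψ)))
    sound (≈I t) = eq-intro ≋-refl
    sound (≈E φ {s} {t} d e) {ρ} {δ} = eq-elim (λ s≋t → ⊑-trans (sound e)
      (⊑-trans (proj₁ (⟦⟧-sub {ρ = val t ρ ∷ ρ} (λ { zero → s≋t ; (suc i) → ≋-refl }) (λ _ → refl) φ))
               (proj₂ (⟦⟧-sub (λ { zero → ≋-refl ; (suc i) → ≋-refl }) (λ _ → refl) φ))))
      (sound d)

  ⟦⟧-closure : ∀ n m (φ : Formula n m) → (∀ ρ δ {a} → a ⊑ ⟦ φ ⟧ ρ δ) →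
               ∀ {a} → a ⊑ ⟦ closure n m φ ⟧ [] []
  ⟦⟧-closure zero    zero    φ h = h [] []
  ⟦⟧-closure zero    (suc m) φ h = ⟦⟧-closure zero m (∀ˢ φ) λ ρ δ → ⨅-intro λ X → h ρ (X ∷ δ)
  ⟦⟧-closure (suc n) m       φ h = ⟦⟧-closure n m (∀ⁿ φ) λ ρ δ → ⨅-intro λ x → h (x ∷ ρ) δ

  ⟦closure⟧-elim : ∀ n m (φ : Formula n m) {a} → a ⊑ ⟦ closure n m φ ⟧ [] [] →
                   ∀ ρ δ → a ⊑ ⟦ φ ⟧ ρ δ
  ⟦closure⟧-elim zero    zero    φ h ρ δ = ⊑-trans h (⟦⟧-cong (λ ()) (λ ()) φ)
  ⟦closure⟧-elim zero    (suc m) φ h ρ δ =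
    ⊑-trans (⟦closure⟧-elim zero m (∀ˢ φ) h ρ (δ ∘ suc))
      (⊑-trans (⨅-elim (δ zero))
        (⟦⟧-cong (λ _ → ≋-refl) (λ { zero → refl ; (suc _) → refl }) φ))
  ⟦closure⟧-elim (suc n) m       φ h ρ δ =
    ⊑-trans (⟦closure⟧-elim n m (∀ⁿ φ) h (ρ ∘ suc) δ)
      (⊑-trans (⨅-elim (ρ zero))
        (⟦⟧-cong (λ { zero → ≋-refl ; (suc _) → ≋-refl }) (λ _ → refl) φ))

-- Two-valued semantics with an arbitrary proposition P for falsity

record StableProp (P : Set) : Set₁ where
  constructor _,ₛ_
  field
    Tr   : Set
    stab : ((Tr → P) → P) → Tr
open StableProp public

tarski : Set → Algebra
tarski P = record
  { Ω       = StableProp P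
  ; _⊑_     = λ a b → Tr a → Tr b
  ; 𝟙       = (P → P) ,ₛ λ _ → id
  ; ⊥̂       = P ,ₛ λ k → k id
  ; _⊓_     = λ a b → (Tr a × Tr b) ,ₛ λ k →
                stab a (λ f → k (f ∘ proj₁)) , stab b (λ f → k (f ∘ proj₂))
  ; _⇛_     = λ a b → (Tr a → Tr b) ,ₛ λ k x → stab b (λ f → k (λ g → f (g x)))
  ; ⨅       = λ f → (∀ i → Tr (f i)) ,ₛ λ k i → stab (f i) (λ h → k (λ g → h (g i)))
  ; ⊑-refl  = id
  ; ⊑-trans = λ f g → g ∘ f
  ; ⊑-𝟙     = λ _ → id
  ; ⊓-fst   = proj₁
  ; ⊓-snd   = proj₂
  ; ⊓-pair  = λ f g x → f x , g x
  ; ⇛-intro = λ f x y → f (y , x)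
  ; ⇛-elim  = λ f g x → f x (g x)
  ; ⨅-intro = λ f x i → f i x
  ; ⨅-elim  = λ i f → f i
  ; ⊥-raa   = λ {a} {b} f x → stab b (λ k → f (k , x))
  }

record Structure (P : Set) : Set₁ where
  field
    number         : NumberStructure
    interpretation : Interpretation (tarski P) number
  open NumberStructure number public
  open Interpretation interpretation public

  infix 4 _⊨_
  _⊨_ : Formula n m → (Fin n → M) × (Fin m → 𝒳) → Set
  φ ⊨ (ρ , δ) = Tr (⟦ φ ⟧ ρ δ)

record Model (P : Set) : Set₁ where
  field
    structure : Structure P
  open Structure structure public
  field
    valid     : ∀ {φ} → RCA₀⁻ φ → φ ⊨ ([] , [])

-- Cantor pairing and codes for terms, formulas and environments

triangle : ℕ → ℕ
triangle zero    = 0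
triangle (suc k) = suc k ℕ.+ triangle k

triangle-mono : ∀ {i j} → i ≤ℕ j → triangle i ≤ℕ triangle j
triangle-mono {j = zero}  z≤n     = z≤n
triangle-mono {j = suc j} z≤n     = z≤n
triangle-mono             (s≤s p) = ℕ.+-mono-≤ (s≤s p) (triangle-mono p)

⟪_,_⟫ : ℕ → ℕ → ℕ
⟪ x , y ⟫ = x ℕ.+ triangle (x ℕ.+ y)

⟪⟫-separates : ∀ {x y x′ y′} → x ℕ.+ y ℕ.< x′ ℕ.+ y′ → ⟪ x , y ⟫ ℕ.< ⟪ x′ , y′ ⟫
⟪⟫-separates {x} {y} {x′} {y′} p = begin-strict
  x ℕ.+ triangle (x ℕ.+ y)               ≤⟨ ℕ.+-monoˡ-≤ _ (ℕ.m≤m+n x y) ⟩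
  (x ℕ.+ y) ℕ.+ triangle (x ℕ.+ y)       <⟨ ℕ.n<1+n _ ⟩
  triangle (suc (x ℕ.+ y))               ≤⟨ triangle-mono p ⟩
  triangle (x′ ℕ.+ y′)                   ≤⟨ ℕ.m≤n+m _ x′ ⟩
  x′ ℕ.+ triangle (x′ ℕ.+ y′)            ∎
  where open ℕ.≤-Reasoning

⟪⟫-injective : ∀ x y x′ y′ → ⟪ x , y ⟫ ≡ ⟪ x′ , y′ ⟫ → x ≡ x′ × y ≡ y′
⟪⟫-injective x y x′ y′ e with ℕ.<-cmp (x ℕ.+ y) (x′ ℕ.+ y′)
... | tri< p _ _ = ⊥-elim (ℕ.<⇒≢ (⟪⟫-separates {x} {y} {x′} {y′} p) e)
... | tri> _ _ p = ⊥-elim (ℕ.<⇒≢ (⟪⟫-separates {x′} {y′} {x} {y} p) (sym e))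
... | tri≈ _ p _ with ℕ.+-cancelʳ-≡ _ x x′ (trans e (cong (λ s → x′ ℕ.+ triangle s) (sym p)))
...   | refl = refl , ℕ.+-cancelˡ-≡ x y y′ p

data Code : Set where
  leaf : Code
  node : ℕ → Code → Code → Code

code : Code → ℕ
code leaf         = 0
code (node k a b) = suc ⟪ k , ⟪ code a , code b ⟫ ⟫

code-injective : ∀ a b → code a ≡ code b → a ≡ b
code-injective leaf         leaf            e = refl
code-injective (node k a b) (node k′ a′ b′) e
  with ⟪⟫-injective k _ k′ _ (ℕ.suc-injective e)
... | refl , e′ with ⟪⟫-injective (code a) _ (code a′) _ e′
...   | p , q = cong₂ (node k) (code-injective a a′ p) (code-injective b b′ q)

tag<code : ∀ k a b → k ℕ.< code (node k a b)
tag<code k a b = s≤s (ℕ.m≤m+n k _)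

encℕ : ℕ → Code
encℕ k = node k leaf leaf

decℕ : Code → ℕ
decℕ leaf         = 0
decℕ (node k _ _) = k

decFin : ∀ n → ℕ → Maybe (Fin n)
decFin zero    k       = nothing
decFin (suc n) zero    = just zero
decFin (suc n) (suc k) = Maybe.map suc (decFin n k)

decFin-toℕ : ∀ (i : Fin n) → decFin n (toℕ i) ≡ just i
decFin-toℕ zero    = refl
decFin-toℕ (suc i) = cong (Maybe.map suc) (decFin-toℕ i)

encTerm : Term n → Code
encTerm (var i)   = node 1 (encℕ (toℕ i)) leaf
encTerm 𝟎         = leaf
encTerm (S t)     = node 2 (encTerm t) leaf
encTerm (H t)     = node 3 (encTerm t) leaf
encTerm (T t)     = node 4 (encTerm t) leaf
encTerm (s + t)   = node 5 (encTerm s) (encTerm t)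
encTerm (s · t)   = node 6 (encTerm s) (encTerm t)
encTerm ⟨ s , t ⟩ = node 7 (encTerm s) (encTerm t)

-- Decoding is total with arbitrary values on junk; what counts is that it is a left inverse of the
-- encoding.
decTerm : ∀ n → Code → Term n
decTerm n (node 1 a b) = maybe′ var 𝟎 (decFin n (decℕ a))
decTerm n (node 2 a b) = S (decTerm n a)
decTerm n (node 3 a b) = H (decTerm n a)
decTerm n (node 4 a b) = T (decTerm n a)
decTerm n (node 5 a b) = decTerm n a + decTerm n b
decTerm n (node 6 a b) = decTerm n a · decTerm n b
decTerm n (node 7 a b) = ⟨ decTerm n a , decTerm n b ⟩
decTerm n _            = 𝟎

dec-encTerm : ∀ (t : Term n) → decTerm n (encTerm t) ≡ t
dec-encTerm (var i)   = cong (maybe′ var 𝟎) (decFin-toℕ i)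
dec-encTerm 𝟎         = refl
dec-encTerm (S t)     = cong S (dec-encTerm t)
dec-encTerm (H t)     = cong H (dec-encTerm t)
dec-encTerm (T t)     = cong T (dec-encTerm t)
dec-encTerm (s + t)   = cong₂ _+_ (dec-encTerm s) (dec-encTerm t)
dec-encTerm (s · t)   = cong₂ _·_ (dec-encTerm s) (dec-encTerm t)
dec-encTerm ⟨ s , t ⟩ = cong₂ ⟨_,_⟩ (dec-encTerm s) (dec-encTerm t)

encFormula : {φ : Formula n m} → NoSetQuantifier φ → Code
encFormula (eq s t)   = node 1 (encTerm s) (encTerm t)
encFormula (less s t) = node 2 (encTerm s) (encTerm t)
encFormula (mem t X)  = node 3 (encTerm t) (encℕ (toℕ X))
encFormula bot        = leaf
encFormula (and φ ψ)  = node 4 (encFormula φ) (encFormula ψ)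
encFormula (or φ ψ)   = node 5 (encFormula φ) (encFormula ψ)
encFormula (imp φ ψ)  = node 6 (encFormula φ) (encFormula ψ)
encFormula (all φ)    = node 7 (encFormula φ) leaf
encFormula (ex φ)     = node 8 (encFormula φ) leaf

decFormula : ∀ n m → Code → Formula n m
decFormula n m (node 1 a b) = decTerm n a ≈ decTerm n b
decFormula n m (node 2 a b) = decTerm n a < decTerm n b
decFormula n m (node 3 a b) = maybe′ (decTerm n a ∈_) ⊥′ (decFin m (decℕ b))
decFormula n m (node 4 a b) = decFormula n m a ∧ decFormula n m b
decFormula n m (node 5 a b) = decFormula n m a ∨ decFormula n m b
decFormula n m (node 6 a b) = decFormula n m a ⇒ decFormula n m b
decFormula n m (node 7 a b) = ∀ⁿ (decFormula (suc n) m a)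
decFormula n m (node 8 a b) = ∃ⁿ (decFormula (suc n) m a)
decFormula n m _            = ⊥′

dec-encFormula : {φ : Formula n m} (q : NoSetQuantifier φ) → decFormula n m (encFormula q) ≡ φ
dec-encFormula (eq s t)   = cong₂ _≈_ (dec-encTerm s) (dec-encTerm t)
dec-encFormula (less s t) = cong₂ _<_ (dec-encTerm s) (dec-encTerm t)
dec-encFormula {m = m} (mem t X) =
  trans (cong (maybe′ (decTerm _ (encTerm t) ∈_) ⊥′) (decFin-toℕ X)) (cong (_∈ X) (dec-encTerm t))
dec-encFormula bot        = refl
dec-encFormula (and φ ψ)  = cong₂ _∧_ (dec-encFormula φ) (dec-encFormula ψ)
dec-encFormula (or φ ψ)   = cong₂ _∨_ (dec-encFormula φ) (dec-encFormula ψ)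
dec-encFormula (imp φ ψ)  = cong₂ _⇒_ (dec-encFormula φ) (dec-encFormula ψ)
dec-encFormula (all φ)    = cong ∀ⁿ (dec-encFormula φ)
dec-encFormula (ex φ)     = cong ∃ⁿ (dec-encFormula φ)

-- Elements of the term model: the free variables of the initial context and
-- the Henkin witnesses, introduced one per stage.
data Tm (N : ℕ) : Set where
  ini        : Fin N → Tm N
  new        : ℕ → Tm N
  𝟎ᵐ         : Tm N
  Sᵐ Hᵐ Tᵐ   : Tm N → Tm N
  _+ᵐ_ _·ᵐ_ ⟨_,_⟩ᵐ : Tm N → Tm N → Tm N

encTm : ∀ {N} → Tm N → Code
encTm (ini i)     = node 1 (encℕ (toℕ i)) leaf
encTm (new k)     = node 8 (encℕ k) leaf
encTm 𝟎ᵐ          = leaf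
encTm (Sᵐ t)      = node 2 (encTm t) leaf
encTm (Hᵐ t)      = node 3 (encTm t) leaf
encTm (Tᵐ t)      = node 4 (encTm t) leaf
encTm (s +ᵐ t)    = node 5 (encTm s) (encTm t)
encTm (s ·ᵐ t)    = node 6 (encTm s) (encTm t)
encTm ⟨ s , t ⟩ᵐ  = node 7 (encTm s) (encTm t)

decTm : ∀ N → Code → Tm N
decTm N (node 1 a b) = maybe′ ini 𝟎ᵐ (decFin N (decℕ a))
decTm N (node 2 a b) = Sᵐ (decTm N a)
decTm N (node 3 a b) = Hᵐ (decTm N a)
decTm N (node 4 a b) = Tᵐ (decTm N a)
decTm N (node 5 a b) = decTm N a +ᵐ decTm N b
decTm N (node 6 a b) = decTm N a ·ᵐ decTm N b
decTm N (node 7 a b) = ⟨ decTm N a , decTm N b ⟩ᵐ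
decTm N (node 8 a b) = new (decℕ a)
decTm N _            = 𝟎ᵐ

dec-encTm : ∀ {N} (t : Tm N) → decTm N (encTm t) ≡ t
dec-encTm (ini i)    = cong (maybe′ ini 𝟎ᵐ) (decFin-toℕ i)
dec-encTm (new k)    = refl
dec-encTm 𝟎ᵐ         = refl
dec-encTm (Sᵐ t)     = cong Sᵐ (dec-encTm t)
dec-encTm (Hᵐ t)     = cong Hᵐ (dec-encTm t)
dec-encTm (Tᵐ t)     = cong Tᵐ (dec-encTm t)
dec-encTm (s +ᵐ t)   = cong₂ _+ᵐ_ (dec-encTm s) (dec-encTm t)
dec-encTm (s ·ᵐ t)   = cong₂ _·ᵐ_ (dec-encTm s) (dec-encTm t)
dec-encTm ⟨ s , t ⟩ᵐ = cong₂ ⟨_,_⟩ᵐ (dec-encTm s) (dec-encTm t)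

SetName : ℕ → Set
SetName K = Fin (suc K) ⊎ ℕ

encSet : ∀ {K} → SetName K → Code
encSet (inj₁ i) = node 0 (encℕ (toℕ i)) leaf
encSet (inj₂ k) = node 1 (encℕ k) leaf

decSet : ∀ K → Code → SetName K
decSet K (node 0 a b) = inj₁ (maybe′ id zero (decFin (suc K) (decℕ a)))
decSet K (node _ a b) = inj₂ (decℕ a)
decSet K leaf         = inj₂ 0

dec-encSet : ∀ {K} (X : SetName K) → decSet K (encSet X) ≡ X
dec-encSet {K} (inj₁ i) = cong (inj₁ ∘ maybe′ id zero) (decFin-toℕ {suc K} i)
dec-encSet (inj₂ k) = refl

module _ {A : Set} (enc : A → Code) (dec : Code → A) (dec-enc : ∀ a → dec (enc a) ≡ a) where

  encEnv : ∀ n → (Fin n → A) → Code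
  encEnv zero    ρ = leaf
  encEnv (suc n) ρ = node 0 (enc (ρ zero)) (encEnv n (ρ ∘ suc))

  decEnv : ∀ n → Code → Fin n → A
  decEnv (suc n) (node _ a b) zero    = dec a
  decEnv (suc n) leaf         zero    = dec leaf
  decEnv (suc n) (node _ a b) (suc i) = decEnv n b i
  decEnv (suc n) leaf         (suc i) = decEnv n leaf i

  dec-encEnv : ∀ n ρ i → decEnv n (encEnv n ρ) i ≡ ρ i
  dec-encEnv (suc n) ρ zero    = dec-enc (ρ zero)
  dec-encEnv (suc n) ρ (suc i) = dec-encEnv n (ρ ∘ suc) i

-- The context must have a set variable in scope, because removing a fresh set
-- variable from a derivation substitutes an old one for it.
Conservative : Theory → Formula n (suc m) → Set
Conservative Th ψ =
  ∀ {n′ m′} (σ : Fin _ → Term n′) (q : Fin _ → Fin m′) → Fin m′ →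
  (Δ : List (Formula n′ m′)) → All NoSetQuantifier Δ →
  Th ∣ sub σ (lift 1 q) ψ List.∷ List.map wkˢ Δ ⊢ ⊥′ → Th ∣ Δ ⊢ ⊥′

module _ {Th : Theory} where

  ⊢-∷ : {Γ : List (Formula n m)} {φ χ : Formula n m} → Th ∣ Γ ⊢ φ → Th ∣ χ List.∷ Γ ⊢ φ
  ⊢-∷ = ⊢-mono there

  ⊢-exfalso : {Γ : List (Formula n m)} {φ : Formula n m} → Th ∣ Γ ⊢ ⊥′ → Th ∣ Γ ⊢ φ
  ⊢-exfalso d = raa (⊢-∷ d)

  ⊢-strip : {Γ : List (Formula n m)} {Δ : List (Formula n′ m′)} {φ : Formula n m}
            (σ : Fin n → Term n′) (q : Fin m → Fin m′) →
            List.map (sub σ q) Γ ≡ Δ → Th ∣ Γ ⊢ φ → Th ∣ Δ ⊢ sub σ q φ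
  ⊢-strip σ q refl = ⊢-sub σ q (∈-map⁺ (sub σ q))

  map-sub-wkⁿ : ∀ (Γ : List (Formula n m)) t → List.map (_[ t ]ⁿ) (List.map wkⁿ Γ) ≡ Γ
  map-sub-wkⁿ List.[]      t = refl
  map-sub-wkⁿ (φ List.∷ Γ) t = cong₂ List._∷_ (wkⁿ-[] φ t) (map-sub-wkⁿ Γ t)

  map-sub-wkˢ : ∀ (Γ : List (Formula n m)) X → List.map (_[ X ]ˢ) (List.map wkˢ Γ) ≡ Γ
  map-sub-wkˢ List.[]      X = refl
  map-sub-wkˢ (φ List.∷ Γ) X = cong₂ List._∷_ (wkˢ-[] φ X) (map-sub-wkˢ Γ X)

  -- If the Henkin axiom is refutable, then so is each reason for its truth: `∃ⁿ χ` is derivable,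
  -- and `¬′ χ` is derivable for a generic element. These contradict each other. The first mentions
  -- no fresh variable, so `𝟎` may be substituted for it.
  henkin : {Δ : List (Formula n m)} {χ : Formula (suc n) m} →
           Th ∣ (wkⁿ (∃ⁿ χ) ⇒ χ) List.∷ List.map wkⁿ Δ ⊢ ⊥′ → Th ∣ Δ ⊢ ⊥′
  henkin {Δ = Δ} {χ} d =
    ∃ⁿE (subst (Th ∣ Δ ⊢_) (wkⁿ-[] (∃ⁿ χ) 𝟎) (⊢-strip (𝟎 ∷ var) id (map-sub-wkⁿ Δ 𝟎) exists))
        (⇒E (⊢-∷ refute) (hyp (here refl)))
    where
    exists : Th ∣ List.map wkⁿ Δ ⊢ wkⁿ (∃ⁿ χ)
    exists = raa (⇒E (⊢-∷ (⇒I d)) (⇒I (⊢-exfalso (⇒E (hyp (there (here refl))) (hyp (here refl))))))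
    refute : Th ∣ List.map wkⁿ Δ ⊢ ¬′ χ
    refute = ⇒I (⇒E (⊢-∷ (⇒I d)) (⇒I (hyp (there (here refl)))))

  ¬∀⇒∃¬ : {Γ : List (Formula n m)} {φ : Formula (suc n) m} →
          Th ∣ Γ ⊢ ¬′ (∀ⁿ φ) → Th ∣ Γ ⊢ ∃ⁿ (¬′ φ)
  ¬∀⇒∃¬ {n} {Γ = Γ} {φ} d = raa (⇒E (⊢-∷ d) (∀ⁿI (raa
    (⇒E (hyp (there (here refl)))
        (∃ⁿI #0 (subst (Th ∣ (¬′ φ) List.∷ wkⁿ (¬′ ∃ⁿ (¬′ φ)) List.∷ List.map wkⁿ Γ ⊢_)
          (sym (cong (_⇒ ⊥′) eq₀)) (hyp (here refl))))))))
    where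
    eq₀ : sub (liftᵗ (var ∘ suc)) id φ [ #0 ]ⁿ ≡ φ
    eq₀ = trans (sub-fuse {υ = var} (λ { zero → refl ; (suc i) → refl }) (λ _ → refl) φ)
                (sub-id (λ _ → refl) (λ _ → refl) φ)

  closureE : ∀ n m (φ : Formula n m) {Γ : List (Formula n′ m′)} →
             Th ∣ Γ ⊢ fromSentence (closure n m φ) →
             (σ : Fin n → Term n′) (q : Fin m → Fin m′) → Th ∣ Γ ⊢ sub σ q φ
  closureE zero zero φ d σ q = subst (Th ∣ _ ⊢_) (sub-cong (λ ()) (λ ()) φ) d
  closureE zero (suc m) φ d σ q =
    subst (Th ∣ _ ⊢_)
      (sub-fuse (λ i → subᵗ-id (σ i)) (λ { zero → refl ; (suc X) → refl }) φ)
      (∀ˢE (closureE zero m (∀ˢ φ) d σ (q ∘ suc)) (q zero))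
  closureE (suc n) m φ d σ q =
    subst (Th ∣ _ ⊢_)
      (sub-fuse (λ { zero → refl ; (suc i) → trans (subᵗ-∷-wk _ _ (σ (suc i))) (subᵗ-id _) })
                (λ _ → refl) φ)
      (∀ⁿE (closureE n m (∀ⁿ φ) d (σ ∘ suc) q) (σ zero))

max : (Fin n → ℕ) → ℕ
max {zero}  f = 0
max {suc n} f = f zero ⊔ℕ max (f ∘ suc)

≤-max : ∀ (f : Fin n → ℕ) i → f i ≤ℕ max f
≤-max f zero    = ℕ.m≤m⊔n _ _
≤-max f (suc i) = ℕ.≤-trans (≤-max (f ∘ suc) i) (ℕ.m≤n⊔m (f zero) _)

-- Henkin's construction for arithmetical formulas

module Henkin
  (Th : Theory) {n₀ m₀ : ℕ} (Γ₀ : List (Formula n₀ (suc m₀))) (Γ₀-NSQ : All NoSetQuantifier Γ₀)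
  where

  P : Set
  P = Th ∣ Γ₀ ⊢ ⊥′

  Elem Name : Set
  Elem = Tm n₀
  Name = SetName m₀

  Stage : ℕ → Set
  Stage k = Formula (k ℕ.+ n₀) (k ℕ.+ suc m₀)

  -- Witness `j` comes into being on passing from stage `j` to stage `suc j`; before that its value
  -- is the junk term `𝟎`. A term thus has its final meaning only from stage `bound t` on, which is
  -- why truth is later defined as derivability at all sufficiently late stages.
  witness : ∀ k → ℕ → Term (k ℕ.+ n₀)
  witness zero    j = 𝟎
  witness (suc k) j with j ℕ.≟ k
  ... | yes _ = #0
  ... | no  _ = wkᵗ (witness k j)

  witnessˢ : ∀ k → ℕ → Fin (k ℕ.+ suc m₀)
  witnessˢ zero    j = zero
  witnessˢ (suc k) j with j ℕ.≟ k
  ... | yes _ = zero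
  ... | no  _ = suc (witnessˢ k j)

  at : ∀ k → Elem → Term (k ℕ.+ n₀)
  at k (ini i)     = var (k ↑ʳ i)
  at k (new j)     = witness k j
  at k 𝟎ᵐ          = 𝟎
  at k (Sᵐ t)      = S (at k t)
  at k (Hᵐ t)      = H (at k t)
  at k (Tᵐ t)      = T (at k t)
  at k (s +ᵐ t)    = at k s + at k t
  at k (s ·ᵐ t)    = at k s · at k t
  at k ⟨ s , t ⟩ᵐ  = ⟨ at k s , at k t ⟩

  atˢ : ∀ k → Name → Fin (k ℕ.+ suc m₀)
  atˢ k (inj₁ i) = k ↑ʳ i
  atˢ k (inj₂ j) = witnessˢ k j

  bound : Elem → ℕ
  bound (ini i)     = 0
  bound (new j)     = suc j
  bound 𝟎ᵐ          = 0
  bound (Sᵐ t)      = bound t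
  bound (Hᵐ t)      = bound t
  bound (Tᵐ t)      = bound t
  bound (s +ᵐ t)    = bound s ⊔ℕ bound t
  bound (s ·ᵐ t)    = bound s ⊔ℕ bound t
  bound ⟨ s , t ⟩ᵐ  = bound s ⊔ℕ bound t

  boundˢ : Name → ℕ
  boundˢ (inj₁ i) = 0
  boundˢ (inj₂ j) = suc j

  at-suc : ∀ {k} t → bound t ≤ℕ k → at (suc k) t ≡ wkᵗ (at k t)
  at-suc (ini i)     p = refl
  at-suc {k} (new j) p with j ℕ.≟ k
  ... | yes refl = ⊥-elim (ℕ.<-irrefl refl p)
  ... | no  _    = refl
  at-suc 𝟎ᵐ          p = refl
  at-suc (Sᵐ t)      p = cong S (at-suc t p)
  at-suc (Hᵐ t)      p = cong H (at-suc t p)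
  at-suc (Tᵐ t)      p = cong T (at-suc t p)
  at-suc (s +ᵐ t)    p = cong₂ _+_ (at-suc s (ℕ.m⊔n≤o⇒m≤o _ _ p)) (at-suc t (ℕ.m⊔n≤o⇒n≤o (bound s) _ p))
  at-suc (s ·ᵐ t)    p = cong₂ _·_ (at-suc s (ℕ.m⊔n≤o⇒m≤o _ _ p)) (at-suc t (ℕ.m⊔n≤o⇒n≤o (bound s) _ p))
  at-suc ⟨ s , t ⟩ᵐ  p = cong₂ ⟨_,_⟩ (at-suc s (ℕ.m⊔n≤o⇒m≤o _ _ p)) (at-suc t (ℕ.m⊔n≤o⇒n≤o (bound s) _ p))

  atˢ-suc : ∀ {k} X → boundˢ X ≤ℕ k → atˢ (suc k) X ≡ suc (atˢ k X)
  atˢ-suc (inj₁ i)     p = refl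
  atˢ-suc {k} (inj₂ j) p with j ℕ.≟ k
  ... | yes refl = ⊥-elim (ℕ.<-irrefl refl p)
  ... | no  _    = refl

  at-new : ∀ k → at (suc k) (new k) ≡ #0
  at-new k with k ℕ.≟ k
  ... | yes _ = refl
  ... | no ¬p = ⊥-elim (¬p refl)

  atˢ-new : ∀ k → atˢ (suc k) (inj₂ k) ≡ zero
  atˢ-new k with k ℕ.≟ k
  ... | yes _ = refl
  ... | no ¬p = ⊥-elim (¬p refl)

  inst : ∀ k → Formula n m → (Fin n → Elem) → (Fin m → Name) → Stage k
  inst k φ ρ δ = sub (at k ∘ ρ) (atˢ k ∘ δ) φ

  decρ : ∀ n → Code → Fin n → Elem
  decρ = decEnv encTm (decTm n₀) dec-encTm

  decδ : ∀ m → Code → Fin m → Name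
  decδ = decEnv encSet (decSet m₀) dec-encSet

  -- The formula described by a code, with its two innermost variables
  -- interpreted by the witnesses that are fresh at stage k.
  describe : ∀ k → Code → Stage (suc k)
  describe k (node _ (node n a b) (node m c _)) =
    sub (#0 ∷ (at (suc k) ∘ decρ n b)) (zero ∷ (atˢ (suc k) ∘ decδ m c)) (decFormula (suc n) (suc m) a)
  describe k _ = ⊥′

  wk : ∀ {k} → Stage k → Stage (suc k)
  wk = sub (var ∘ suc) suc

  -- A code is admitted only under the hypothesis that it adds no new
  -- refutation, which replaces the undecidable case distinction of the usual
  -- construction of a maximal consistent theory.
  In : ∀ k → Stage k → Set
  Admissible : ∀ k → Stage (suc k) → Set

  In zero    φ = φ ∈ˡ Γ₀
  In (suc k) φ = (Σ (Stage k) λ ψ → In k ψ × φ ≡ wk ψ)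
               -- Stage `k` deals with the code whose number is `k`, so each request has its own
               -- stage and no enumeration has to be inverted.
               ⊎ (Σ Code λ u → code u ≡ k × φ ≡ describe k u × NoSetQuantifier φ × Admissible k φ)

  Admissible k φ = ∀ Δ → All (In k) Δ → Th ∣ φ List.∷ List.map wk Δ ⊢ ⊥′ → P

  In-NSQ : ∀ k {φ} → In k φ → NoSetQuantifier φ
  In-NSQ zero    i = All.lookup Γ₀-NSQ i
  In-NSQ (suc k) (inj₁ (ψ , i , refl)) = sub-NSQ _ _ (In-NSQ k i)
  In-NSQ (suc k) (inj₂ (_ , _ , _ , q , _)) = q

  aSet : ∀ k → Fin (k ℕ.+ suc m₀)
  aSet k = k ↑ʳ zero

  wk-strip : ∀ {k} (φ : Stage k) → sub (𝟎 ∷ var) (aSet k ∷ id) (wk φ) ≡ φ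
  wk-strip φ = trans (sub-fuse (λ _ → refl) (λ _ → refl) φ) (sub-id (λ _ → refl) (λ _ → refl) φ)

  map-wk-strip : ∀ {k} (Δ : List (Stage k)) → List.map (sub (𝟎 ∷ var) (aSet k ∷ id)) (List.map wk Δ) ≡ Δ
  map-wk-strip List.[]      = refl
  map-wk-strip (φ List.∷ Δ) = cong₂ List._∷_ (wk-strip φ) (map-wk-strip Δ)

  private
    -- Since `code` is injective, at most one formula is new at each stage. A finite list of
    -- hypotheses therefore consists of inherited formulas and at most that one, and its
    -- admissibility concerns exactly such lists.
    Split : ∀ k → List (Stage (suc k)) → Set
    Split k Δ = Σ (List (Stage k)) λ Δ′ → All (In k) Δ′ ×
      ( (∀ {φ} → φ ∈ˡ Δ → φ ∈ˡ List.map wk Δ′)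
      ⊎ Σ Code λ u → code u ≡ k × Admissible k (describe k u) ×
        (∀ {φ} → φ ∈ˡ Δ → φ ∈ˡ describe k u List.∷ List.map wk Δ′))

    split : ∀ k Δ → All (In (suc k)) Δ → Split k Δ
    split k List.[] All.[] = List.[] , All.[] , inj₁ λ ()
    split k (φ List.∷ Δ) (i All.∷ is) with split k Δ is
    split k (φ List.∷ Δ) (inj₁ (ψ , i , refl) All.∷ is) | Δ′ , js , inj₁ h =
      ψ List.∷ Δ′ , i All.∷ js , inj₁ λ { (here refl) → here refl ; (there j) → there (h j) }
    split k (φ List.∷ Δ) (inj₁ (ψ , i , refl) All.∷ is) | Δ′ , js , inj₂ (u , e , a , h) =
      ψ List.∷ Δ′ , i All.∷ js , inj₂ (u , e , a , λ
        { (here refl) → there (here refl)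
        ; (there j)   → case-∷ (h j) })
      where
      case-∷ : ∀ {χ} → χ ∈ˡ describe k u List.∷ List.map wk Δ′ →
               χ ∈ˡ describe k u List.∷ wk ψ List.∷ List.map wk Δ′
      case-∷ (here p)  = here p
      case-∷ (there p) = there (there p)
    split k (φ List.∷ Δ) (inj₂ (u , e , refl , _ , a) All.∷ is) | Δ′ , js , inj₁ h =
      Δ′ , js , inj₂ (u , e , a , λ { (here refl) → here refl ; (there j) → there (h j) })
    split k (φ List.∷ Δ) (inj₂ (u , e , refl , _ , a) All.∷ is) | Δ′ , js , inj₂ (u′ , e′ , a′ , h)
      with code-injective u′ u (trans e′ (sym e))
    ... | refl = Δ′ , js , inj₂ (u , e , a , λ { (here refl) → here refl ; (there j) → h j })

  consistent : ∀ k Δ → All (In k) Δ → Th ∣ Δ ⊢ ⊥′ → P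
  consistent zero    Δ is d = ⊢-mono (All.lookup is) d
  consistent (suc k) Δ is d with split k Δ is
  ... | Δ′ , js , inj₁ h               =
    -- Only inherited formulas occur, so the two fresh variables are eliminated by substituting `𝟎`
    -- and an old set.
    consistent k Δ′ js (⊢-strip (𝟎 ∷ var) (aSet k ∷ id) (map-wk-strip Δ′) (⊢-mono h d))
  ... | Δ′ , js , inj₂ (u , e , a , h) = a Δ′ js (⊢-mono h d)

  infix 3 _⊩_
  _⊩_ : ∀ k → Stage k → Set
  k ⊩ φ = Σ (List (Stage k)) λ Δ → All (In k) Δ × (Th ∣ Δ ⊢ φ)

  ⊩-suc : ∀ {k φ} → k ⊩ φ → suc k ⊩ wk φ
  ⊩-suc (Δ , is , d) = List.map wk Δ , mapIn is , ⊢-sub (var ∘ suc) suc (∈-map⁺ wk) d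
    where
    mapIn : ∀ {k} {Δ : List (Stage k)} → All (In k) Δ → All (In (suc k)) (List.map wk Δ)
    mapIn All.[]       = All.[]
    mapIn (i All.∷ is) = inj₁ (_ , i , refl) All.∷ mapIn is

  Ev : (∀ k → Stage k) → Set
  Ev f = Σ ℕ λ K → ∀ k → K ≤ℕ k → k ⊩ f k

  Ev₀ : {f : ∀ k → Stage k} → (∀ k → Th ∣ List.[] ⊢ f k) → Ev f
  Ev₀ h = 0 , λ k _ → List.[] , All.[] , h k

  Ev₁ : {f g : ∀ k → Stage k} → (∀ k {Δ} → Th ∣ Δ ⊢ f k → Th ∣ Δ ⊢ g k) → Ev f → Ev g
  Ev₁ h (K , a) = K , λ k p → let Δ , is , d = a k p in Δ , is , h k d

  Ev₂ : {f g l : ∀ k → Stage k} →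
        (∀ k {Δ} → Th ∣ Δ ⊢ f k → Th ∣ Δ ⊢ g k → Th ∣ Δ ⊢ l k) → Ev f → Ev g → Ev l
  Ev₂ h (K , a) (L , b) = K ⊔ℕ L , λ k p →
    let Δ , is , d = a k (ℕ.m⊔n≤o⇒m≤o K L p)
        Θ , js , e = b k (ℕ.m⊔n≤o⇒n≤o K L p)
    in Δ List.++ Θ , ++⁺ is js , h k (⊢-mono ∈-++⁺ˡ d) (⊢-mono (∈-++⁺ʳ Δ) e)

  Ev-≡ : {f g : ∀ k → Stage k} → (∀ k → f k ≡ g k) → Ev f → Ev g
  Ev-≡ h = Ev₁ λ k {Δ} → subst (Th ∣ Δ ⊢_) (h k)

  Ev-⊥ : Ev (λ _ → ⊥′) → P
  Ev-⊥ (K , a) = let Δ , is , d = a K ℕ.≤-refl in consistent K Δ is d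

  Holds : Formula n m → (Fin n → Elem) → (Fin m → Name) → Set
  Holds φ ρ δ = Ev λ k → inst k φ ρ δ

  Bound : (Fin n → Elem) → (Fin m → Name) → ℕ
  Bound ρ δ = max (bound ∘ ρ) ⊔ℕ max (boundˢ ∘ δ)

  module _ (ρ : Fin n → Elem) (δ : Fin m → Name) {k} (p : Bound ρ δ ≤ℕ k) where
    ρ-suc : ∀ i → at (suc k) (ρ i) ≡ wkᵗ (at k (ρ i))
    ρ-suc i = at-suc (ρ i) (ℕ.≤-trans (≤-max (bound ∘ ρ) i) (ℕ.m⊔n≤o⇒m≤o _ _ p))
    δ-suc : ∀ i → atˢ (suc k) (δ i) ≡ suc (atˢ k (δ i))
    δ-suc i = atˢ-suc (δ i) (ℕ.≤-trans (≤-max (boundˢ ∘ δ) i) (ℕ.m⊔n≤o⇒n≤o (max (bound ∘ ρ)) _ p))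

    inst-suc : ∀ φ → inst (suc k) φ ρ δ ≡ wk (inst k φ ρ δ)
    inst-suc φ = sym (sub-fuse (λ i → sym (ρ-suc i)) (λ i → sym (δ-suc i)) φ)

  persist : ∀ (φ : Formula n m) ρ δ {k} → Bound ρ δ ≤ℕ k → k ⊩ inst k φ ρ δ → Holds φ ρ δ
  persist φ ρ δ {k} p a = k , λ k′ q → go (ℕ.≤⇒≤′ q)
    where
    go : ∀ {k′} → k ℕ.≤′ k′ → k′ ⊩ inst k′ φ ρ δ
    go (ℕ.≤′-reflexive refl) = a
    go (ℕ.≤′-step q) = subst (_ ⊩_) (sym (inst-suc ρ δ (ℕ.≤-trans p (ℕ.≤′⇒≤ q)) φ)) (⊩-suc (go q))

  private
    fresh : ∀ k → Formula (suc n) (suc m) → (Fin n → Elem) → (Fin m → Name) → Stage (suc k)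
    fresh k φ ρ δ = sub (#0 ∷ (wkᵗ ∘ at k ∘ ρ)) (zero ∷ (suc ∘ atˢ k ∘ δ)) φ

  -- The stage is the code of the formula together with its parameters. Tagging that code with
  -- `Bound ρ δ` makes the stage number exceed the bound, so all parameters have their final meaning
  -- when the formula is considered.
  admit : ∀ {φ : Formula (suc n) (suc m)} → NoSetQuantifier φ → ∀ ρ δ →
          (∀ k → Bound ρ δ ≤ℕ k → Admissible k (fresh k φ ρ δ)) →
          Σ ℕ λ k → Holds φ (new k ∷ ρ) (inj₂ k ∷ δ)
  admit {n} {m} {φ} q ρ δ adm = k , persist φ (new k ∷ ρ) (inj₂ k ∷ δ) {suc k} bounded
    (_ , inj₂ (u , refl , described , sub-NSQ _ _ q , subst (Admissible k) same (adm k k-bounded)) All.∷ All.[] , hyp (here refl))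
    where
    u : Code
    u = node (Bound ρ δ) (node n (encFormula q) (encEnv encTm (decTm n₀) dec-encTm n ρ))
                         (node m (encEnv encSet (decSet m₀) dec-encSet m δ) leaf)
    k : ℕ
    k = code u
    k-bounded : Bound ρ δ ≤ℕ k
    k-bounded = ℕ.<⇒≤ (tag<code (Bound ρ δ)
      (node n (encFormula q) (encEnv encTm (decTm n₀) dec-encTm n ρ))
      (node m (encEnv encSet (decSet m₀) dec-encSet m δ) leaf))
    bounded : Bound (new k ∷ ρ) (inj₂ k ∷ δ) ≤ℕ suc k
    bounded = ℕ.⊔-lub
      (ℕ.⊔-lub ℕ.≤-refl (ℕ.m≤n⇒m≤1+n (ℕ.m⊔n≤o⇒m≤o (max (bound ∘ ρ)) _ k-bounded)))
      (ℕ.⊔-lub ℕ.≤-refl (ℕ.m≤n⇒m≤1+n (ℕ.m⊔n≤o⇒n≤o (max (bound ∘ ρ)) _ k-bounded)))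
    described : inst (suc k) φ (new k ∷ ρ) (inj₂ k ∷ δ) ≡ describe k u
    described rewrite dec-encFormula q = sub-cong
      (λ { zero → at-new k
         ; (suc i) → cong (at (suc k)) (sym (dec-encEnv encTm (decTm n₀) dec-encTm n ρ i)) })
      (λ { zero → atˢ-new k
         ; (suc i) → cong (atˢ (suc k)) (sym (dec-encEnv encSet (decSet m₀) dec-encSet m δ i)) })
      φ
    same : fresh k φ ρ δ ≡ inst (suc k) φ (new k ∷ ρ) (inj₂ k ∷ δ)
    same = sub-cong
      (λ { zero → sym (at-new k) ; (suc i) → sym (ρ-suc ρ δ k-bounded i) })
      (λ { zero → sym (atˢ-new k) ; (suc i) → sym (δ-suc ρ δ k-bounded i) }) φ

  private
    map-fuse : {τ : Fin n′ → Term n″} {σ : Fin n → Term n′} {υ : Fin n → Term n″}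
               {r : Fin m′ → Fin m″} {q : Fin m → Fin m′} {p : Fin m → Fin m″} →
               (∀ i → subᵗ τ (σ i) ≡ υ i) → (∀ X → r (q X) ≡ p X) →
               ∀ Δ → List.map (sub τ r) (List.map (sub σ q) Δ) ≡ List.map (sub υ p) Δ
    map-fuse h e List.[]      = refl
    map-fuse h e (φ List.∷ Δ) = cong₂ List._∷_ (sub-fuse h e φ) (map-fuse h e Δ)

  -- Maximality without deciding anything: `φ` itself is submitted, with dummy fresh variables. A
  -- refutation from the hypotheses of that stage would be a derivation of `¬′ φ`, which yields `P`
  -- by assumption, and so `φ` is admissible.
  Holds-dec : {φ : Formula n m} → NoSetQuantifier φ → ∀ ρ δ →
              (Holds (¬′ φ) ρ δ → P) → Holds φ ρ δ
  Holds-dec {φ = φ} q ρ δ refuted =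
    let k , h = admit (sub-NSQ (var ∘ suc) suc q) ρ δ adm
    in Ev-≡ (λ j → sub-fuse (λ _ → refl) (λ _ → refl) φ) h
    where
    adm : ∀ k → Bound ρ δ ≤ℕ k → Admissible k (fresh k (sub (var ∘ suc) suc φ) ρ δ)
    adm k p Δ is d = refuted (persist (¬′ φ) ρ δ p (Δ , is , ⇒I
      (⊢-strip (𝟎 ∷ var) (aSet k ∷ id) (cong₂ List._∷_ stripped (map-wk-strip Δ)) d)))
      where
      stripped : sub (𝟎 ∷ var) (aSet k ∷ id) (fresh k (sub (var ∘ suc) suc φ) ρ δ) ≡ inst k φ ρ δ
      stripped = trans (cong (sub (𝟎 ∷ var) (aSet k ∷ id)) (sub-fuse (λ _ → refl) (λ _ → refl) φ))
        (sub-fuse (λ i → trans (subᵗ-∷-wk _ _ (at k (ρ i))) (subᵗ-id _)) (λ _ → refl) φ)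

  -- The witness is found before anything is known about `∃ⁿ χ`, because the implication from `∃ⁿ χ`
  -- to its instance is always admissible by `henkin`.
  Holds-henkin : {χ : Formula (suc n) m} → NoSetQuantifier χ → ∀ ρ δ →
                 Σ Elem λ x → Holds (∃ⁿ χ) ρ δ → Holds χ (x ∷ ρ) δ
  Holds-henkin {χ = χ} q ρ δ =
    let k , h = admit {φ = sub (var ∘ suc) suc (∃ⁿ χ) ⇒ wkˢ χ}
                  (imp (sub-NSQ _ _ (ex q)) (sub-NSQ _ _ q)) ρ δ adm
    in new k , λ e → Ev₂ (λ j {Δ} a b → subst (Th ∣ Δ ⊢_) (conclusion k j)
         (⇒E a (subst (Th ∣ Δ ⊢_) (sym (premise k j)) b))) h e
    where
    conclusion : ∀ k j → inst j (wkˢ χ) (new k ∷ ρ) (inj₂ k ∷ δ) ≡ inst j χ (new k ∷ ρ) δ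
    conclusion k j = sub-fuse (λ _ → refl) (λ _ → refl) χ
    premise : ∀ k j → inst j (sub (var ∘ suc) suc (∃ⁿ χ)) (new k ∷ ρ) (inj₂ k ∷ δ) ≡ inst j (∃ⁿ χ) ρ δ
    premise k j = sub-∘ (at j ∘ (new k ∷ ρ)) (atˢ j ∘ (inj₂ k ∷ δ)) (var ∘ suc) suc (∃ⁿ χ)
    adm : ∀ k → Bound ρ δ ≤ℕ k → Admissible k (fresh k (sub (var ∘ suc) suc (∃ⁿ χ) ⇒ wkˢ χ) ρ δ)
    adm k p Δ is d = consistent k Δ is (henkin {χ = χ′} (⊢-strip var (aSet k ∷ id)
      (cong₂ List._∷_ (cong₂ _⇒_ left right) (map-fuse (λ _ → refl) (λ _ → refl) Δ)) d))
      where
      χ′ : Formula (suc (k ℕ.+ n₀)) (k ℕ.+ suc m₀)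
      χ′ = sub (liftᵗ (at k ∘ ρ)) (atˢ k ∘ δ) χ
      left : sub var (aSet k ∷ id) (sub (#0 ∷ (wkᵗ ∘ at k ∘ ρ)) (zero ∷ (suc ∘ atˢ k ∘ δ))
               (sub (var ∘ suc) suc (∃ⁿ χ))) ≡ wkⁿ (∃ⁿ χ′)
      left = trans (cong (sub var (aSet k ∷ id)) (sub-∘ (#0 ∷ (wkᵗ ∘ at k ∘ ρ)) (zero ∷ (suc ∘ atˢ k ∘ δ)) (var ∘ suc) suc (∃ⁿ χ)))
        (trans (sub-fuse {σ = wkᵗ ∘ at k ∘ ρ} {wkᵗ ∘ at k ∘ ρ} (λ _ → subᵗ-id _) (λ _ → refl) (∃ⁿ χ))
               (sym (sub-∘ (var ∘ suc) id (at k ∘ ρ) (atˢ k ∘ δ) (∃ⁿ χ))))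
      right : sub var (aSet k ∷ id) (sub (#0 ∷ (wkᵗ ∘ at k ∘ ρ)) (zero ∷ (suc ∘ atˢ k ∘ δ)) (wkˢ χ)) ≡ χ′
      right = trans (cong (sub var (aSet k ∷ id)) (sub-fuse {υ = liftᵗ (at k ∘ ρ)} (λ { zero → refl ; (suc i) → refl })
                                              (λ _ → refl) χ))
                    (sub-fuse (λ i → subᵗ-id (liftᵗ (at k ∘ ρ) i)) (λ _ → refl) χ)

  -- `Conservative` turns a refutation after adjoining `ψ` for a fresh set into a refutation of the
  -- stage, and `consistent` turns that into `P`. This is admissibility of `ψ`. The dummy number
  -- variable is replaced by `𝟎` first.
  Holds-conservative : {ψ : Formula n (suc m)} → NoSetQuantifier ψ → Conservative Th ψ → ∀ ρ δ →
                       Σ Name λ X → Holds ψ ρ (X ∷ δ)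
  Holds-conservative {ψ = ψ} q conservative ρ δ =
    let k , h = admit {φ = wkⁿ ψ} (sub-NSQ _ _ q) ρ δ adm
    in inj₂ k , Ev-≡ (λ j → sub-fuse (λ _ → refl) (λ _ → refl) ψ) h
    where
    adm : ∀ k → Bound ρ δ ≤ℕ k → Admissible k (fresh k (wkⁿ ψ) ρ δ)
    adm k p Δ is d = consistent k Δ is (conservative (at k ∘ ρ) (atˢ k ∘ δ) (aSet k) Δ
      (All.map (In-NSQ k) is)
      (⊢-strip (𝟎 ∷ var) id (cong₂ List._∷_ stripped (map-fuse (λ _ → refl) (λ _ → refl) Δ)) d))
      where
      stripped : sub (𝟎 ∷ var) id (fresh k (wkⁿ ψ) ρ δ) ≡ sub (at k ∘ ρ) (lift 1 (atˢ k ∘ δ)) ψ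
      stripped = trans (cong (sub (𝟎 ∷ var) id) (sub-fuse (λ _ → refl) (λ _ → refl) ψ))
        (sub-fuse (λ i → trans (subᵗ-∷-wk _ _ (at k (ρ i))) (subᵗ-id _))
                  (λ { zero → refl ; (suc X) → refl }) ψ)

  Holds-stable : {φ : Formula n m} → NoSetQuantifier φ → ∀ ρ δ →
                 ((Holds φ ρ δ → P) → P) → Holds φ ρ δ
  Holds-stable q ρ δ k = Holds-dec q ρ δ (λ h → k (λ g → Ev-⊥ (Ev₂ (λ _ → ⇒E) h g)))

  Holds-¬ : {φ : Formula n m} → NoSetQuantifier φ → ∀ ρ δ →
            (Holds φ ρ δ → P) → Holds (¬′ φ) ρ δ
  Holds-¬ {φ = φ} q ρ δ h = Holds-dec (imp q bot) ρ δ λ k →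
    h (Ev₁ (λ _ d → raa (⇒E (⊢-∷ d) (hyp (here refl)))) k)

  Holds-∀E : {φ : Formula (suc n) m} → ∀ ρ δ → Holds (∀ⁿ φ) ρ δ → ∀ x → Holds φ (x ∷ ρ) δ
  Holds-∀E {φ = φ} ρ δ h x = Ev₁ (λ k {Δ} d → subst (Th ∣ Δ ⊢_)
    (sub-fuse (λ { zero → refl ; (suc i) → trans (subᵗ-∷-wk _ _ (at k (ρ i))) (subᵗ-id _) })
              (λ _ → refl) φ) (∀ⁿE d (at k x))) h

  Holds-∃I : {φ : Formula (suc n) m} → ∀ ρ δ x → Holds φ (x ∷ ρ) δ → Holds (∃ⁿ φ) ρ δ
  Holds-∃I {φ = φ} ρ δ x = Ev₁ λ k {Δ} d → ∃ⁿI (at k x) (subst (Th ∣ Δ ⊢_) (sym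
    (sub-fuse (λ { zero → refl ; (suc i) → trans (subᵗ-∷-wk _ _ (at k (ρ i))) (subᵗ-id _) })
              (λ _ → refl) φ)) d)

  number : NumberStructure
  number = record
    { M       = Elem
    ; _≋_     = λ x y → Ev λ k → at k x ≈ at k y
    ; 𝟘       = 𝟎ᵐ
    ; s̲       = Sᵐ
    ; h̲       = Hᵐ
    ; t̲       = Tᵐ
    ; _⊕_     = _+ᵐ_
    ; _⊗_     = _·ᵐ_
    ; pr      = ⟨_,_⟩ᵐ
    ; ≋-refl  = Ev₀ λ _ → ≈I _
    ; ≋-sym   = Ev₁ λ _ → symm
    ; ≋-trans = Ev₂ λ _ d e → replace #0 (symm d) e
    ; s-cong  = Ev₁ λ _ d → symm (replace (S #0) d (≈I _))
    ; h-cong  = Ev₁ λ _ d → symm (replace (H #0) d (≈I _))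
    ; t-cong  = Ev₁ λ _ d → symm (replace (T #0) d (≈I _))
    ; ⊕-cong  = Ev₂ λ _ → cong-op (#0 + #1)
    ; ⊗-cong  = Ev₂ λ _ → cong-op (#0 · #1)
    ; pr-cong = Ev₂ λ _ → cong-op ⟨ #0 , #1 ⟩
    }
    where
    replace : ∀ {Γ : List (Formula n m)} (r : Term 1) {s t u} → Th ∣ Γ ⊢ s ≈ t →
              Th ∣ Γ ⊢ subᵗ (s ∷ []) r ≈ u → Th ∣ Γ ⊢ subᵗ (t ∷ []) r ≈ u
    replace {Γ = Γ} r {s} {t} {u} d e =
      subst₂ (λ a b → Th ∣ Γ ⊢ a ≈ b) (fused t) (stripped t)
        (≈E (subᵗ (#0 ∷ []) r ≈ wkᵗ u) d
          (subst₂ (λ a b → Th ∣ Γ ⊢ a ≈ b) (sym (fused s)) (sym (stripped s)) e))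
      where
      fused : ∀ v → subᵗ (v ∷ var) (subᵗ (#0 ∷ []) r) ≡ subᵗ (v ∷ []) r
      fused v = trans (subᵗ-∘ _ _ r) (subᵗ-cong (λ { zero → refl }) r)
      stripped : ∀ v → subᵗ (v ∷ var) (wkᵗ u) ≡ u
      stripped v = trans (subᵗ-∷-wk v var u) (subᵗ-id u)
    symm : ∀ {Γ : List (Formula n m)} {s t} → Th ∣ Γ ⊢ s ≈ t → Th ∣ Γ ⊢ t ≈ s
    symm d = replace #0 d (≈I _)
    cong-op : ∀ {Γ : List (Formula n m)} (r : Term 2) {s t u v} → Th ∣ Γ ⊢ s ≈ t → Th ∣ Γ ⊢ u ≈ v →
              Th ∣ Γ ⊢ subᵗ (s ∷ u ∷ []) r ≈ subᵗ (t ∷ v ∷ []) r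
    cong-op {Γ = Γ} r {s} {t} {u} {v} d e = subst₂ (λ a b → Th ∣ Γ ⊢ a ≈ b) (fused₁ t) (fused₂ t)
      (≈E (subᵗ (wkᵗ s ∷ wkᵗ u ∷ []) r ≈ subᵗ (#0 ∷ wkᵗ v ∷ []) r) d
        (subst₂ (λ a b → Th ∣ Γ ⊢ a ≈ b) (sym (fused₁ s)) (sym (fused₂ s))
          (subst₂ (λ a b → Th ∣ Γ ⊢ a ≈ b) (fused₁′ v) (fused₂′ v)
            (≈E (subᵗ (wkᵗ s ∷ wkᵗ u ∷ []) r ≈ subᵗ (wkᵗ s ∷ #0 ∷ []) r) e
              (subst₂ (λ a b → Th ∣ Γ ⊢ a ≈ b) (sym (fused₁′ u)) (sym (fused₂′ u)) (≈I _))))))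
      where
      strip : ∀ w x → subᵗ (x ∷ var) (wkᵗ w) ≡ w
      strip w x = trans (subᵗ-∷-wk x var w) (subᵗ-id w)
      fuse : ∀ x (ρ : Fin 2 → Term _) (ρ′ : Fin 2 → Term _) → (∀ i → subᵗ (x ∷ var) (ρ i) ≡ ρ′ i) →
             subᵗ (x ∷ var) (subᵗ ρ r) ≡ subᵗ ρ′ r
      fuse x ρ ρ′ h = trans (subᵗ-∘ _ _ r) (subᵗ-cong h r)
      fused₁ fused₂ fused₁′ fused₂′ : ∀ x → _
      fused₁  x = fuse x _ (s ∷ u ∷ []) λ { 0F → strip s x ; 1F → strip u x }
      fused₂  x = fuse x _ (x ∷ v ∷ []) λ { 0F → refl ; 1F → strip v x }
      fused₁′ x = fuse x _ (s ∷ u ∷ []) λ { 0F → strip s x ; 1F → strip u x }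
      fused₂′ x = fuse x _ (s ∷ x ∷ []) λ { 0F → strip s x ; 1F → refl }

  private
    leibniz : ∀ {Γ : List (Formula n m)} (φ : Formula (suc n) m) {s t ψ χ} → Th ∣ Γ ⊢ s ≈ t →
              φ [ s ]ⁿ ≡ ψ → φ [ t ]ⁿ ≡ χ → Th ∣ Γ ⊢ ψ → Th ∣ Γ ⊢ χ
    leibniz φ d refl refl e = ≈E φ d e

    strip-∷ : ∀ (s t : Term n) → subᵗ (s ∷ var) (wkᵗ t) ≡ t
    strip-∷ s t = trans (subᵗ-∷-wk s var t) (subᵗ-id t)

  interpretation : Interpretation (tarski P) number
  interpretation = record
    { 𝒳        = Name
    ; eq̲       = λ x y → (Ev λ k → at k x ≈ at k y)
                   ,ₛ Holds-stable {φ = #0 ≈ #1} (eq _ _) (x ∷ y ∷ []) []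
    ; lt̲       = λ x y → (Ev λ k → at k x < at k y)
                   ,ₛ Holds-stable {φ = #0 < #1} (less _ _) (x ∷ y ∷ []) []
    ; mem̲      = λ x X → (Ev λ k → at k x ∈ atˢ k X)
                   ,ₛ Holds-stable {φ = #0 ∈ 0F} (mem _ _) (x ∷ []) (X ∷ [])
    ; eq-intro = λ p _ → p
    ; eq-elim  = λ f g a → f (g a) a
    ; lt-resp  = λ {x} {y} {u} {v} p r h →
        Ev₂ (λ k d → leibniz (wkᵗ (at k y) < #0) d
               (cong (_< at k u) (strip-∷ (at k u) (at k y)))
               (cong (_< at k v) (strip-∷ (at k v) (at k y)))) r
          (Ev₂ (λ k d → leibniz (#0 < wkᵗ (at k u)) d
               (cong (at k x <_) (strip-∷ (at k x) (at k u)))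
               (cong (at k y <_) (strip-∷ (at k y) (at k u)))) p h)
    ; mem-resp = λ {x} {y} {X} → Ev₂ λ k d → leibniz (#0 ∈ atˢ k X) d refl refl
    }

  structure : Structure P
  structure = record { number = number ; interpretation = interpretation }

  open Structure structure using (_⊨_; val)

  at-val : ∀ k (t : Term n) ρ → at k (val t ρ) ≡ subᵗ (at k ∘ ρ) t
  at-val k (var i)   ρ = refl
  at-val k 𝟎         ρ = refl
  at-val k (S t)     ρ = cong S (at-val k t ρ)
  at-val k (H t)     ρ = cong H (at-val k t ρ)
  at-val k (T t)     ρ = cong T (at-val k t ρ)
  at-val k (s + t)   ρ = cong₂ _+_ (at-val k s ρ) (at-val k t ρ)
  at-val k (s · t)   ρ = cong₂ _·_ (at-val k s ρ) (at-val k t ρ)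
  at-val k ⟨ s , t ⟩ ρ = cong₂ ⟨_,_⟩ (at-val k s ρ) (at-val k t ρ)

  -- The truth lemma. Both directions are proved together because implication exchanges them. It
  -- stops at arithmetical formulas, since set quantifiers are given no Henkin witnesses.
  ⊨⇒Holds : {φ : Formula n m} → NoSetQuantifier φ → ∀ ρ δ → φ ⊨ (ρ , δ) → Holds φ ρ δ
  Holds⇒⊨ : {φ : Formula n m} → NoSetQuantifier φ → ∀ ρ δ → Holds φ ρ δ → φ ⊨ (ρ , δ)

  ⊨⇒Holds (eq s t)   ρ δ h = Ev-≡ (λ k → cong₂ _≈_ (at-val k s ρ) (at-val k t ρ)) h
  ⊨⇒Holds (less s t) ρ δ h = Ev-≡ (λ k → cong₂ _<_ (at-val k s ρ) (at-val k t ρ)) h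
  ⊨⇒Holds (mem t X)  ρ δ h = Ev-≡ (λ k → cong (_∈ atˢ k (δ X)) (at-val k t ρ)) h
  ⊨⇒Holds bot        ρ δ h = 0 , λ k _ → ⊥-stage k
    where
    -- Falsity is `P`, a derivation of `⊥′` from `Γ₀`; it is carried along to every stage.
    ⊥-stage : ∀ k → k ⊩ ⊥′
    ⊥-stage zero    = Γ₀ , All.tabulate id , h
    ⊥-stage (suc k) = ⊩-suc (⊥-stage k)
  ⊨⇒Holds (and p q)  ρ δ (h , g) = Ev₂ (λ _ → ∧I) (⊨⇒Holds p ρ δ h) (⊨⇒Holds q ρ δ g)
  ⊨⇒Holds (or p q)   ρ δ h = Holds-stable (or p q) ρ δ λ k → h
    ( (λ a → k (Ev₁ (λ _ → ∨I₁) (⊨⇒Holds p ρ δ a)))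
    , (λ b → k (Ev₁ (λ _ → ∨I₂) (⊨⇒Holds q ρ δ b))))
  ⊨⇒Holds (imp {φ} {ψ} p q) ρ δ h = Holds-dec (imp p q) ρ δ λ k →
    Ev-⊥ (Ev₂ (λ _ d e → ⇒E d (⇒I (⊢-∷ e))) k (⊨⇒Holds q ρ δ (h (Holds⇒⊨ p ρ δ
      (Ev₁ (λ _ d → raa (⇒E (⊢-∷ d) (⇒I (⊢-exfalso (⇒E (hyp (there (here refl))) (hyp (here refl))))))) k)))))
  ⊨⇒Holds (all {φ} p) ρ δ h = Holds-dec (all p) ρ δ λ k →
    let x , w = Holds-henkin (imp p bot) ρ δ
    in Ev-⊥ (Ev₂ (λ _ → ⇒E) (w (Ev₁ (λ _ → ¬∀⇒∃¬) k)) (⊨⇒Holds p (x ∷ ρ) δ (h x)))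
  ⊨⇒Holds (ex p)     ρ δ h = Holds-stable (ex p) ρ δ λ k →
    h λ x a → k (Holds-∃I ρ δ x (⊨⇒Holds p (x ∷ ρ) δ a))

  Holds⇒⊨ (eq s t)   ρ δ h = Ev-≡ (λ k → sym (cong₂ _≈_ (at-val k s ρ) (at-val k t ρ))) h
  Holds⇒⊨ (less s t) ρ δ h = Ev-≡ (λ k → sym (cong₂ _<_ (at-val k s ρ) (at-val k t ρ))) h
  Holds⇒⊨ (mem t X)  ρ δ h = Ev-≡ (λ k → sym (cong (_∈ atˢ k (δ X)) (at-val k t ρ))) h
  Holds⇒⊨ bot        ρ δ h = Ev-⊥ h
  Holds⇒⊨ (and p q)  ρ δ h = Holds⇒⊨ p ρ δ (Ev₁ (λ _ → ∧E₁) h) , Holds⇒⊨ q ρ δ (Ev₁ (λ _ → ∧E₂) h)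
  Holds⇒⊨ (or {φ} {ψ} p q) ρ δ h (f , g) = Ev-⊥ (Ev₂ (λ _ d e → ∨E d
      (⇒E (⊢-∷ (∧E₁ e)) (hyp (here refl))) (⇒E (⊢-∷ (∧E₂ e)) (hyp (here refl)))) h
    (Ev₂ (λ _ → ∧I) (Holds-¬ p ρ δ (f ∘ Holds⇒⊨ p ρ δ)) (Holds-¬ q ρ δ (g ∘ Holds⇒⊨ q ρ δ))))
  Holds⇒⊨ (imp p q)  ρ δ h a = Holds⇒⊨ q ρ δ (Ev₂ (λ _ → ⇒E) h (⊨⇒Holds p ρ δ a))
  Holds⇒⊨ (all p)    ρ δ h x = Holds⇒⊨ p (x ∷ ρ) δ (Holds-∀E ρ δ h x)
  Holds⇒⊨ (ex p)     ρ δ h f =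
    let x , w = Holds-henkin p ρ δ
    in f x (Holds⇒⊨ p (x ∷ ρ) δ (w h))

  ⊨-initial : ∀ {φ} → φ ∈ˡ Γ₀ → φ ⊨ (ini , inj₁)
  ⊨-initial {φ} i = Holds⇒⊨ (All.lookup Γ₀-NSQ i) ini inj₁
    (persist φ ini inj₁ {0} (ℕ.≤-reflexive (cong₂ _⊔ℕ_ (max-0 n₀) (max-0 m₀)))
      (Γ₀ , All.tabulate id , subst (Th ∣ Γ₀ ⊢_) (sym (sub-id (λ _ → refl) (λ _ → refl) φ)) (hyp i)))
    where
    max-0 : ∀ n → max {n} (λ _ → 0) ≡ 0
    max-0 zero    = refl
    max-0 (suc n) = max-0 n

  ⊨-axiom : {φ : Formula n m} → NoSetQuantifier φ → Th (closure n m φ) → ∀ ρ δ → φ ⊨ (ρ , δ)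
  ⊨-axiom {n} {m} {φ} q a ρ δ = Holds⇒⊨ q ρ δ
    (Ev₀ λ k → closureE n m φ (axm a) (at k ∘ ρ) (atˢ k ∘ δ))

  ⊨-conservative : {ψ : Formula n (suc m)} → NoSetQuantifier ψ → Conservative Th ψ → ∀ ρ δ →
                   Σ Name λ X → ψ ⊨ (ρ , X ∷ δ)
  ⊨-conservative q c ρ δ =
    let X , h = Holds-conservative q c ρ δ in X , Holds⇒⊨ q ρ (X ∷ δ) h

-- Models of RCA₀⁻

nsq? : (φ : Formula n m) → Maybe (NoSetQuantifier φ)
nsq? (s ≈ t) = just (eq s t)
nsq? (s < t) = just (less s t)
nsq? (t ∈ X) = just (mem t X)
nsq? ⊥′      = just bot
nsq? (φ ∧ ψ) = zipWith and (nsq? φ) (nsq? ψ)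
nsq? (φ ∨ ψ) = zipWith or (nsq? φ) (nsq? ψ)
nsq? (φ ⇒ ψ) = zipWith imp (nsq? φ) (nsq? ψ)
nsq? (∀ⁿ φ)  = Maybe.map all (nsq? φ)
nsq? (∃ⁿ φ)  = Maybe.map ex (nsq? φ)
nsq? (∀ˢ φ)  = nothing
nsq? (∃ˢ φ)  = nothing

Nsq : Formula n m → Set
Nsq φ = IsTrue (is-just (nsq? φ))

nsq : (φ : Formula n m) {_ : Nsq φ} → NoSetQuantifier φ
nsq φ {p} = to-witness-T (nsq? φ) p

BASIC⇒NSQ : ∀ {φ} → BASIC φ → NoSetQuantifier φ
BASIC⇒NSQ S≢0     = nsq _
BASIC⇒NSQ S-inj   = nsq _
BASIC⇒NSQ +-zero  = nsq _
BASIC⇒NSQ +-suc   = nsq _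
BASIC⇒NSQ ·-zero  = nsq _
BASIC⇒NSQ ·-suc   = nsq _
BASIC⇒NSQ ≮0      = nsq _
BASIC⇒NSQ <-suc   = nsq _
BASIC⇒NSQ <-tri   = nsq _
BASIC⇒NSQ pred    = nsq _
BASIC⇒NSQ pair    = nsq _
BASIC⇒NSQ pairInj = nsq _
BASIC⇒NSQ pairSur = nsq _
BASIC⇒NSQ H-pair  = nsq _
BASIC⇒NSQ H-zero  = nsq _
BASIC⇒NSQ T-pair  = nsq _
BASIC⇒NSQ T-zero  = nsq _

conservative-comp : {Th : Theory} {ψ : Formula n (suc m)} →
                    Th (closure n m (∃ˢ ψ)) → Conservative Th ψ
conservative-comp {n} {m} {ψ = ψ} a σ q X Δ _ d = ∃ˢE (closureE n m (∃ˢ ψ) (axm a) σ q) d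

-- This is the classical shift of a set quantifier out of the conclusion. Refuting the implication
-- proves its premise, from which the fresh set is removed by substituting `X`; the axiom then
-- supplies a set for `ψ`, and the conclusion proves the implication.
conservative-⇒ : {Th : Theory} {φ : Formula n m} {ψ : Formula n (suc m)} →
                 Th (closure n m (φ ⇒ ∃ˢ ψ)) → Conservative Th (wkˢ φ ⇒ ψ)
conservative-⇒ {n} {m} {Th = Th} {φ} {ψ} a σ q X Δ _ d =
  ∃ˢE (⇒E (closureE n m (φ ⇒ ∃ˢ ψ) (axm a) σ q) premise)
      (⇒E (⊢-∷ (⇒I d)) (⇒I (hyp (there (here refl)))))
  where
  premise : Th ∣ Δ ⊢ sub σ q φ
  premise = subst (Th ∣ Δ ⊢_) (wkˢ-[] (sub σ q φ) X)
    (⊢-strip var (X ∷ id) (map-sub-wkˢ {Th = Th} Δ X)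
      (subst (Th ∣ List.map wkˢ Δ ⊢_) (sub-lift-wkˢ σ q φ)
        (raa (⇒E (⊢-∷ (⇒I d)) (⇒I (⊢-exfalso (⇒E (hyp (there (here refl))) (hyp (here refl)))))))))

module Standard {n₀ m₀ : ℕ} (Γ₀ : List (Formula n₀ (suc m₀))) (q : All NoSetQuantifier Γ₀) where

  open Henkin RCA₀⁻ Γ₀ q public
  open Structure structure public using (_⊨_; ⟦⟧-closure)

  private
    valid : ∀ n m (φ : Formula n m) → (∀ ρ δ → φ ⊨ (ρ , δ)) → closure n m φ ⊨ ([] , [])
    valid n m φ h = ⟦⟧-closure n m φ (λ ρ δ _ → h ρ δ) {Algebra.𝟙 (tarski P)} id

  ⊨-RCA₀⁻ : ∀ {φ} → RCA₀⁻ φ → φ ⊨ ([] , [])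
  ⊨-RCA₀⁻ a@(inj₁ (inj₁ b)) = ⊨-axiom {0} {0} (BASIC⇒NSQ b) a [] []
  ⊨-RCA₀⁻ a@(inj₁ (inj₂ (inj₁ refl))) = valid 1 1 induct (⊨-axiom (nsq induct) a)
    where
    induct : Formula 1 1
    induct = 𝟎 ∈ 0F ∧ ∀ⁿ (#0 ∈ 0F ⇒ S #0 ∈ 0F) ⇒ #0 ∈ 0F
  ⊨-RCA₀⁻ a@(inj₁ (inj₂ (inj₂ (comp {n} {m} {φ} d)))) = valid n m _ λ ρ δ k →
    let X , h = ⊨-conservative (all (and (imp (mem #0 0F) φ-NSQ) (imp φ-NSQ (mem #0 0F))))
                  (conservative-comp a) ρ δ
    in k X h
    where
    φ-NSQ : NoSetQuantifier (wkˢ φ)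
    φ-NSQ = sub-NSQ var suc (Δ₀⁰⇒NSQ d)
  ⊨-RCA₀⁻ a@(inj₂ refl) g h p k =
    let f , w = ⊨-conservative {n = 0} {m = 2} {ψ = wkˢ (1F ∈𝓕 ∧ 0F ∈𝓕) ⇒ composite} (nsq _) (conservative-⇒ a) [] (h ∷ g ∷ [])
    in k f (w p)
    where
    composite : Formula 0 3
    composite = 0F ∈𝓕 ∧ ∀ⁿ (∀ⁿ (∀ⁿ
      (⟨ #2 , #0 ⟩ ∈ 1F ∧ ⟨ #0 , #1 ⟩ ∈ 2F ⇒ ⟨ #2 , #1 ⟩ ∈ 0F)))

  model : Model P
  model = record { structure = structure ; valid = ⊨-RCA₀⁻ }

-- Classical reasoning relative to P

module Classical (P : Set) where

  record Stab (A : Set) : Set where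
    constructor mkStab
    field
      unstab : ((A → P) → P) → A
  open Stab {{...}} public

  infixr 2 _∨ᴾ_
  _∨ᴾ_ : Set → Set → Set
  A ∨ᴾ B = (A → P) × (B → P) → P

  ∃ᴾ : {I : Set} → (I → Set) → Set
  ∃ᴾ F = (∀ i → F i → P) → P

  private
    variable
      A B C : Set

  cases : {{Stab C}} → A ∨ᴾ B → (A → C) → (B → C) → C
  cases d f g = unstab λ k → d ((λ a → k (f a)) , (λ b → k (g b)))

  left : A → A ∨ᴾ B
  left a (f , _) = f a

  right : B → A ∨ᴾ B
  right b (_ , g) = g b

  given : {I : Set} {F : I → Set} {{_ : Stab C}} → ∃ᴾ F → (∀ i → F i → C) → C
  given e f = unstab λ k → e (λ i a → k (f i a))

  absurd : {{Stab C}} → P → C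
  absurd p = unstab λ _ → p

  decide : {{Stab C}} → (A : Set) → (A → C) → ((A → P) → C) → C
  decide A f g = unstab λ k → k (g (λ a → k (f a)))

  choose : {I : Set} {F : Fin n → I → Set} → (∀ i → ∃ᴾ (F i)) → ∃ᴾ λ (f : Fin n → I) → ∀ i → F i (f i)
  choose {zero}  h k = k (λ ()) (λ ())
  choose {suc n} h k = h zero λ x a → choose (h ∘ suc) λ f b →
    k (x ∷ f) λ { zero → a ; (suc i) → b i }

  instance
    stab-P : Stab P
    stab-P = mkStab λ k → k id

    stab-× : {{Stab A}} → {{Stab B}} → Stab (A × B)
    stab-× = mkStab λ k → unstab (λ f → k (f ∘ proj₁)) , unstab (λ f → k (f ∘ proj₂))

    stab-∀ : {I : Set} {F : I → Set} {{_ : ∀ {i} → Stab (F i)}} → Stab (∀ i → F i)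
    stab-∀ {F = F} = mkStab λ k i → unstab {F i} λ f → k λ g → f (g i)

-- Arithmetic inside a model

module Arithmetic {P : Set} (𝔐 : Model P) where

  open Model 𝔐

  open Classical P public

  infix 4 _≐_ _⋖_ _⪯_ _∊_
  -- Taking `x ⋖ s̲ y` for `x ⪯ y` keeps the relation atomic, whereas the disjunction would carry a
  -- double negation.
  _≐_ _⋖_ _⪯_ : M → M → Set
  x ≐ y = Tr (eq̲ x y)
  x ⋖ y = Tr (lt̲ x y)
  x ⪯ y = x ⋖ s̲ y

  _∊_ : M → 𝒳 → Set
  x ∊ X = Tr (mem̲ x X)

  instance
    stab-≐ : ∀ {x y} → Stab (Tr (eq̲ x y))
    stab-≐ {x} {y} = mkStab (stab (eq̲ x y))

    stab-⋖ : ∀ {x y} → Stab (Tr (lt̲ x y))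
    stab-⋖ {x} {y} = mkStab (stab (lt̲ x y))

    stab-∊ : ∀ {x X} → Stab (Tr (mem̲ x X))
    stab-∊ {x} {X} = mkStab (stab (mem̲ x X))

  ≋⇒≐ : ∀ {x y} → x ≋ y → x ≐ y
  ≋⇒≐ p = eq-intro p {Algebra.𝟙 (tarski P)} id

  ≐-elim : ∀ {C : Set} {{_ : Stab C}} {x y} → x ≐ y → (x ≋ y → C) → C
  ≐-elim {C} {x} {y} e f = eq-elim {a = Algebra.𝟙 (tarski P)} {c = C ,ₛ unstab} (λ p _ → f p) (λ _ → e) id

  ≐-refl : ∀ {x} → x ≐ x
  ≐-refl = ≋⇒≐ ≋-refl

  ≐-sym : ∀ {x y} → x ≐ y → y ≐ x
  ≐-sym e = ≐-elim e λ p → ≋⇒≐ (≋-sym p)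

  ≐-trans : ∀ {x y z} → x ≐ y → y ≐ z → x ≐ z
  ≐-trans e f = ≐-elim e λ p → ≐-elim f λ q → ≋⇒≐ (≋-trans p q)

  s-≐ : ∀ {x y} → x ≐ y → s̲ x ≐ s̲ y
  s-≐ e = ≐-elim e λ p → ≋⇒≐ (s-cong p)

  h-≐ : ∀ {x y} → x ≐ y → h̲ x ≐ h̲ y
  h-≐ e = ≐-elim e λ p → ≋⇒≐ (h-cong p)

  t-≐ : ∀ {x y} → x ≐ y → t̲ x ≐ t̲ y
  t-≐ e = ≐-elim e λ p → ≋⇒≐ (t-cong p)

  ⊕-≐ : ∀ {x y u v} → x ≐ y → u ≐ v → x ⊕ u ≐ y ⊕ v
  ⊕-≐ e f = ≐-elim e λ p → ≐-elim f λ q → ≋⇒≐ (⊕-cong p q)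

  ⊗-≐ : ∀ {x y u v} → x ≐ y → u ≐ v → x ⊗ u ≐ y ⊗ v
  ⊗-≐ e f = ≐-elim e λ p → ≐-elim f λ q → ≋⇒≐ (⊗-cong p q)

  pr-≐ : ∀ {x y u v} → x ≐ y → u ≐ v → pr x u ≐ pr y v
  pr-≐ e f = ≐-elim e λ p → ≐-elim f λ q → ≋⇒≐ (pr-cong p q)

  ⋖-≐ : ∀ {x y u v} → x ≐ y → u ≐ v → x ⋖ u → y ⋖ v
  ⋖-≐ e f l = ≐-elim e λ p → ≐-elim f λ q → lt-resp p q l

  ∊-≐ : ∀ {x y X} → x ≐ y → x ∊ X → y ∊ X
  ∊-≐ e h = ≐-elim e λ p → mem-resp p h

  private
    basic : ∀ {φ} → BASIC φ → φ ⊨ ([] , [])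
    basic a = valid (inj₁ (inj₁ a))

  s≢0 : ∀ {x} → s̲ x ≐ 𝟘 → P
  s≢0 {x} = basic S≢0 x

  ⊕-zero : ∀ {x} → x ⊕ 𝟘 ≐ x
  ⊕-zero {x} = basic +-zero x

  ⊕-suc : ∀ {x y} → x ⊕ s̲ y ≐ s̲ (x ⊕ y)
  ⊕-suc {x} {y} = basic +-suc y x

  ⊗-zero : ∀ {x} → x ⊗ 𝟘 ≐ 𝟘
  ⊗-zero {x} = basic ·-zero x

  ⊗-suc : ∀ {x y} → x ⊗ s̲ y ≐ x ⊗ y ⊕ x
  ⊗-suc {x} {y} = basic ·-suc y x

  ⋖0 : ∀ {x} → x ⋖ 𝟘 → P
  ⋖0 {x} = basic ≮0 x

  ⋖-suc : ∀ {x y} → x ⪯ y → x ⋖ y ∨ᴾ x ≐ y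
  ⋖-suc {x} {y} = proj₁ (basic <-suc y x)

  ⋖⇒⪯ : ∀ {x y} → x ⋖ y → x ⪯ y
  ⋖⇒⪯ {x} {y} l = proj₂ (basic <-suc y x) (left l)

  ≐⇒⪯ : ∀ {x y} → x ≐ y → x ⪯ y
  ≐⇒⪯ {x} {y} l = proj₂ (basic <-suc y x) (right l)

  compare : ∀ {C : Set} {{_ : Stab C}} x y → (x ⋖ y → C) → (x ≐ y → C) → (y ⋖ x → C) → C
  compare x y f g h = cases (basic <-tri y x) f (λ d → cases d g h)

  predecessor : ∀ {x} → 𝟘 ⋖ x → ∃ᴾ λ y → x ≐ s̲ y
  predecessor {x} l k = basic BASIC.pred x l λ y (_ , e) → k y (≐-sym e)

  pr-surjective : ∀ {z} → 𝟘 ⋖ z → ∃ᴾ λ x → ∃ᴾ λ y → x ⋖ z × y ⋖ z × pr x y ≐ z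
  pr-surjective {z} l k = basic pairSur z l λ x (x<z , e) → e λ y (y<z , p) → k x λ g → g y (x<z , y<z , p)

  h-pr : ∀ {x y} → h̲ (pr x y) ≐ x
  h-pr {x} {y} = basic H-pair y x

  t-pr : ∀ {x y} → t̲ (pr x y) ≐ y
  t-pr {x} {y} = basic T-pair y x

  -- By the pairing axiom twice a pair is a sum ending in `2`, hence a successor, whereas twice `0`
  -- is `0`.
  pr≢0 : ∀ {x y} → pr x y ≐ 𝟘 → P
  pr≢0 {x} {y} e = s≢0 (≐-trans (≐-sym (≐-trans ⊕-suc (s-≐ ⊕-suc)))
    (≐-trans (≐-sym (proj₁ (basic pair 𝟘 y x) e)) ⊗-zero))

  _defines_ : 𝒳 → (M → Set) → Set
  X defines A = ∀ x → (x ∊ X → A x) × (A x → x ∊ X)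

  _encodes_ : 𝒳 → (M → M → Set) → Set
  X encodes R = ∀ x y → (pr x y ∊ X → R x y) × (R x y → pr x y ∊ X)

  comprehension : {φ : Formula (suc n) m} → Δ₀⁰ φ → ∀ ρ δ →
                  ∃ᴾ λ X → X defines λ x → φ ⊨ (x ∷ ρ , δ)
  comprehension {n} {m} {φ} d ρ δ k =
    ⟦closure⟧-elim n m (∃ˢ (∀ⁿ (#0 ∈ 0F ⇔ wkˢ φ))) {Algebra.𝟙 (tarski P)}
      (λ _ → valid (inj₁ (inj₂ (inj₂ (comp d))))) ρ δ id λ X h → k X λ x →
        (λ a → proj₁ (⟦⟧-sub (λ _ → ≋-refl) (λ _ → refl) φ) (proj₁ (h x) a)) ,
        (λ a → proj₂ (h x) (proj₂ (⟦⟧-sub (λ _ → ≋-refl) (λ _ → refl) φ) a))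

  induction : ∀ X → 𝟘 ∊ X → (∀ x → x ∊ X → s̲ x ∊ X) → ∀ x → x ∊ X
  induction X z st x = valid (inj₁ (inj₂ (inj₁ refl))) X x (z , st)

  Δ-induction : {φ : Formula (suc n) m} → Δ₀⁰ φ → ∀ {ρ δ} → φ ⊨ (𝟘 ∷ ρ , δ) →
                (∀ x → φ ⊨ (x ∷ ρ , δ) → φ ⊨ (s̲ x ∷ ρ , δ)) → ∀ x → φ ⊨ (x ∷ ρ , δ)
  Δ-induction {φ = φ} d {ρ} {δ} z st x = given {{mkStab (stab (⟦ φ ⟧ (x ∷ ρ) δ))}}
    (comprehension d ρ δ) λ X h → proj₁ (h x) (induction X (proj₂ (h 𝟘) z)
      (λ y a → proj₂ (h (s̲ y)) (st y (proj₁ (h y) a))) x)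

  -- Order

  ⋖-trans : ∀ {x y z} → x ⋖ y → y ⋖ z → x ⋖ z
  ⋖-trans {x} {y} {z} p q = Δ-induction
    (imp (less #1 #2) (imp (less #2 #0) (less #1 #0))) {x ∷ y ∷ []} {[]}
    (λ _ q → absurd (⋖0 q))
    (λ z ih p q → cases (⋖-suc q) (λ q → ⋖⇒⪯ (ih p q)) (λ e → ⋖⇒⪯ (⋖-≐ ≐-refl e p)))
    z p q

  n⋖s : ∀ {x} → x ⋖ s̲ x
  n⋖s = ≐⇒⪯ ≐-refl

  ⋖-irrefl : ∀ {x} → x ⋖ x → P
  ⋖-irrefl {x} = Δ-induction (imp (less #0 #0) bot) {[]} {[]} ⋖0
    (λ x ih l → cases (⋖-suc l) (λ l → ih (⋖-trans n⋖s l)) (λ e → ih (⋖-≐ ≐-refl e n⋖s))) x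

  0⪯ : ∀ {x} → 𝟘 ⪯ x
  0⪯ {x} = Δ-induction (less 𝟎 (S #0)) {[]} {[]} n⋖s (λ x ih → ⋖⇒⪯ ih) x

  ⋖⇒s⪯ : ∀ {x y} → x ⋖ y → s̲ x ⪯ y
  ⋖⇒s⪯ {x} {y} l = compare (s̲ x) y ⋖⇒⪯ ≐⇒⪯
    (λ y<sx → cases (⋖-suc y<sx) (λ g → absurd (⋖-irrefl (⋖-trans l g)))
                                (λ e → absurd (⋖-irrefl (⋖-≐ ≐-refl e l))))

  s⪯⇒⋖ : ∀ {x y} → s̲ x ⪯ y → x ⋖ y
  s⪯⇒⋖ l = cases (⋖-suc l) (⋖-trans n⋖s) (λ e → ⋖-≐ ≐-refl e n⋖s)

  ⪯-⋖-trans : ∀ {x y z} → x ⪯ y → y ⋖ z → x ⋖ z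
  ⪯-⋖-trans p q = cases (⋖-suc p) (λ p → ⋖-trans p q) (λ e → ⋖-≐ (≐-sym e) ≐-refl q)

  ⋖-⪯-trans : ∀ {x y z} → x ⋖ y → y ⪯ z → x ⋖ z
  ⋖-⪯-trans p q = cases (⋖-suc q) (⋖-trans p) (λ e → ⋖-≐ ≐-refl e p)

  ⪯-trans : ∀ {x y z} → x ⪯ y → y ⪯ z → x ⪯ z
  ⪯-trans = ⪯-⋖-trans

  ⪯-refl : ∀ {x} → x ⪯ x
  ⪯-refl = n⋖s

  ⪯-s : ∀ {x y} → x ⪯ y → s̲ x ⪯ s̲ y
  ⪯-s = ⋖⇒s⪯

  compare-⪯ : ∀ {C : Set} {{_ : Stab C}} x y → (x ⋖ y → C) → (y ⪯ x → C) → C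
  compare-⪯ x y f g = compare x y f (λ e → g (≐⇒⪯ (≐-sym e))) (λ l → g (⋖⇒⪯ l))

  ⋖⇒¬⪯ : ∀ {x y} → x ⋖ y → y ⪯ x → P
  ⋖⇒¬⪯ l g = ⋖-irrefl (⋖-⪯-trans l g)

  ⪯-antisym : ∀ {x y} → x ⪯ y → y ⪯ x → x ≐ y
  ⪯-antisym p q = cases (⋖-suc p) (λ l → absurd (⋖⇒¬⪯ l q)) id

  upper : ∀ x y → ∃ᴾ λ z → x ⪯ z × y ⪯ z
  upper x y k = compare-⪯ x y (λ l → k y (⋖⇒⪯ l , ⪯-refl)) (λ l → k x (⪯-refl , l))

  strong-induction : ∀ X → (∀ x → (∀ y → y ⋖ x → y ∊ X) → x ∊ X) → ∀ x → x ∊ X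
  strong-induction X st x = st x (Δ-induction (all< #0 (mem #0 0F)) {[]} {X ∷ []}
    (λ y l → absurd (⋖0 l))
    (λ x ih y l → cases (⋖-suc l) (ih y) (λ e → ∊-≐ (≐-sym e) (st x ih))) x)

  Δ-strong-induction : {φ : Formula (suc n) m} → Δ₀⁰ φ → ∀ ρ δ →
    (∀ x → (∀ y → y ⋖ x → φ ⊨ (y ∷ ρ , δ)) → φ ⊨ (x ∷ ρ , δ)) → ∀ x → φ ⊨ (x ∷ ρ , δ)
  Δ-strong-induction {φ = φ} d ρ δ st x = given {{mkStab (stab (⟦ φ ⟧ (x ∷ ρ) δ))}}
    (comprehension d ρ δ) λ X h → proj₁ (h x) (strong-induction X
      (λ y ih → proj₂ (h y) (st y (λ z l → proj₁ (h z) (ih z l)))) x)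

  least : ∀ X {x} → x ∊ X → ∃ᴾ λ y → y ∊ X × (∀ z → z ⋖ y → z ∊ X → P)
  least X {x} a k = Δ-strong-induction (imp (mem #0 0F) bot) [] (X ∷ [])
    (λ y ih b → k y (b , ih)) x a

module Prefix {P : Set} (𝔐 : Model P) (E : Exponentiation) where

  open Model 𝔐
  open Arithmetic 𝔐 public
  open Exponentiation E
  open Trees E

  -- Doubling and halving

  infixr 5 _⨾_
  _⨾_ : ∀ {x y z} → x ≐ y → y ≐ z → x ≐ z
  _⨾_ = ≐-trans

  suc-⊕ : ∀ {x y} → s̲ x ⊕ y ≐ s̲ (x ⊕ y)
  suc-⊕ {x} {y} = Δ-induction (eq (S #1 + #0) (S (#1 + #0))) {x ∷ []} {[]}
    (⊕-zero ⨾ ≐-sym (s-≐ ⊕-zero))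
    (λ y ih → ⊕-suc ⨾ s-≐ ih ⨾ ≐-sym (s-≐ ⊕-suc)) y

  0-⊕ : ∀ {x} → 𝟘 ⊕ x ≐ x
  0-⊕ {x} = Δ-induction (eq (𝟎 + #0) #0) {[]} {[]} ⊕-zero (λ x ih → ⊕-suc ⨾ s-≐ ih) x

  0-⊗ : ∀ {x} → 𝟘 ⊗ x ≐ 𝟘
  0-⊗ {x} = Δ-induction (eq (𝟎 · #0) 𝟎) {[]} {[]} ⊗-zero (λ x ih → ⊗-suc ⨾ ⊕-zero ⨾ ih) x

  ⊕-monoʳ-⪯ : ∀ {a x y} → x ⪯ y → a ⊕ x ⪯ a ⊕ y
  ⊕-monoʳ-⪯ {a} {x} {y} l = Δ-induction
    (imp (less #2 (S #0)) (less (#1 + #2) (S (#1 + #0)))) {a ∷ x ∷ []} {[]}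
    (λ l → cases (⋖-suc l) (λ l → absurd (⋖0 l)) (λ e → ≐⇒⪯ (⊕-≐ ≐-refl e)))
    (λ y ih l → cases (⋖-suc l) (λ l → ⋖⇒⪯ (⋖-≐ ≐-refl (≐-sym ⊕-suc) (ih l)))
                               (λ e → ≐⇒⪯ (⊕-≐ ≐-refl e))) y l

  ⊕-monoʳ-⋖ : ∀ {a x y} → x ⋖ y → a ⊕ x ⋖ a ⊕ y
  ⊕-monoʳ-⋖ l = s⪯⇒⋖ (⋖-≐ ⊕-suc ≐-refl (⊕-monoʳ-⪯ (⋖⇒s⪯ l)))

  ⪯-⊕ : ∀ {a x} → a ⪯ a ⊕ x
  ⪯-⊕ = ⋖-≐ ⊕-zero ≐-refl (⊕-monoʳ-⪯ 0⪯)

  2*_ : M → M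
  2* x = s̲ (s̲ 𝟘) ⊗ x
  infix 8 2*_

  2*-≐ : ∀ {x y} → x ≐ y → 2* x ≐ 2* y
  2*-≐ = ⊗-≐ ≐-refl

  2*-suc : ∀ {x} → 2* s̲ x ≐ s̲ (s̲ (2* x))
  2*-suc = ⊗-suc ⨾ ⊕-suc ⨾ s-≐ (⊕-suc ⨾ s-≐ ⊕-zero)

  2*-⊕ : ∀ {a b} → 2* (a ⊕ b) ≐ 2* a ⊕ 2* b
  2*-⊕ {a} {b} = Δ-induction (eq (𝟐 · (#1 + #0)) (𝟐 · #1 + 𝟐 · #0)) {a ∷ []} {[]}
    (2*-≐ ⊕-zero ⨾ ≐-sym (⊕-≐ ≐-refl ⊗-zero ⨾ ⊕-zero))
    (λ b ih → 2*-≐ ⊕-suc ⨾ 2*-suc ⨾ s-≐ (s-≐ ih) ⨾ ≐-sym (⊕-≐ ≐-refl 2*-suc ⨾ ⊕-suc ⨾ s-≐ ⊕-suc)) b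

  ⊕-twice : ∀ {a b} → a ⊕ b ⊕ b ≐ a ⊕ 2* b
  ⊕-twice {a} {b} = Δ-induction (eq (#1 + #0 + #0) (#1 + 𝟐 · #0)) {a ∷ []} {[]}
    (⊕-zero ⨾ ⊕-≐ ≐-refl (≐-sym ⊗-zero))
    (λ b ih → ⊕-suc ⨾ s-≐ (⊕-≐ ⊕-suc ≐-refl ⨾ suc-⊕ ⨾ s-≐ ih) ⨾
              ≐-sym (⊕-≐ ≐-refl 2*-suc ⨾ ⊕-suc ⨾ s-≐ ⊕-suc)) b

  ⊗-2* : ∀ {a b} → a ⊗ 2* b ≐ 2* (a ⊗ b)
  ⊗-2* {a} {b} = Δ-induction (eq (#1 · (𝟐 · #0)) (𝟐 · (#1 · #0))) {a ∷ []} {[]}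
    (⊗-≐ ≐-refl ⊗-zero ⨾ ⊗-zero ⨾ ≐-sym (2*-≐ ⊗-zero ⨾ ⊗-zero))
    (λ b ih → ⊗-≐ ≐-refl 2*-suc ⨾ ⊗-suc ⨾ ⊕-≐ ⊗-suc ≐-refl ⨾ ⊕-twice ⨾ ⊕-≐ ih ≐-refl ⨾
              ≐-sym (2*-≐ ⊗-suc ⨾ 2*-⊕)) b

  2*-mono-⋖ : ∀ {x y} → x ⋖ y → s̲ (2* x) ⋖ 2* y
  2*-mono-⋖ {x} {y} l = Δ-induction (imp (less #1 #0) (less (S (𝟐 · #1)) (𝟐 · #0))) {x ∷ []} {[]}
    (λ l → absurd (⋖0 l))
    (λ y ih l → ⋖-≐ ≐-refl (≐-sym 2*-suc) (cases (⋖-suc l)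
      (λ l → ⋖⇒⪯ (⋖⇒⪯ (ih l))) (λ e → ≐⇒⪯ (s-≐ (2*-≐ e))))) y l

  2*-mono-⪯ : ∀ {x y} → x ⪯ y → 2* x ⪯ 2* y
  2*-mono-⪯ l = cases (⋖-suc l) (λ l → ⋖⇒⪯ (⋖-trans n⋖s (2*-mono-⋖ l))) (λ e → ≐⇒⪯ (2*-≐ e))

  ⪯-2* : ∀ {x} → x ⪯ 2* x
  ⪯-2* {x} = Δ-induction (less #0 (S (𝟐 · #0))) {[]} {[]} 0⪯
    (λ x ih → ⋖-≐ ≐-refl (s-≐ (≐-sym 2*-suc)) (⋖⇒⪯ (⪯-s ih))) x

  ⋖-2* : ∀ {x} → 𝟘 ⋖ x → x ⋖ 2* x
  ⋖-2* {x} l = given (predecessor l) λ y e →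
    ⋖-≐ (≐-sym e) (≐-sym (2*-≐ e ⨾ 2*-suc)) (⪯-s ⪯-2*)

  2*-cancel-⋖ : ∀ {x y} → 2* x ⋖ 2* y → x ⋖ y
  2*-cancel-⋖ {x} {y} l = compare-⪯ x y id λ g → absurd (⋖⇒¬⪯ l (2*-mono-⪯ g))

  -- `h` is the integer part of `t / 2`. On codes of sequences it is the parent: the last entry is
  -- dropped.
  Half : M → M → Set
  Half t h = 2* h ⪯ t × t ⋖ 2* s̲ h

  half-cases : ∀ {t h} → Half t h → t ≐ 2* h ∨ᴾ t ≐ s̲ (2* h)
  half-cases (p , q) = cases (⋖-suc (⋖-≐ ≐-refl 2*-suc q))
    (λ l → left (⪯-antisym l p)) right

  half-exists : ∀ t → ∃ᴾ λ h → Half t h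
  half-exists t k = Δ-induction
    (ex< (S #0) (and (less (𝟐 · #0) (S #1)) (less #1 (𝟐 · S #0)))) {[]} {[]}
    (λ k → k 𝟘 (n⋖s , ≐⇒⪯ ⊗-zero , ⋖-≐ ≐-refl (≐-sym 2*-suc) 0⪯))
    (λ t ih k → ih λ h (h⪯t , p , q) → compare-⪯ (s̲ t) (2* s̲ h)
      (λ l → k h (⋖⇒⪯ h⪯t , ⋖⇒⪯ p , l))
      (λ l → k (s̲ h) (⪯-s h⪯t , l , ⋖-≐ ≐-refl (≐-sym 2*-suc) (⋖⇒⪯ (⋖⇒s⪯ q)))))
    t λ h (_ , p) → k h p

  half-unique : ∀ {t h h′} → Half t h → Half t h′ → h ≐ h′
  half-unique {t} {h} {h′} (p , q) (p′ , q′) = compare h h′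
    (λ l → absurd (⋖⇒¬⪯ q (⪯-trans (2*-mono-⪯ (⋖⇒s⪯ l)) p′))) id
    (λ l → absurd (⋖⇒¬⪯ q′ (⪯-trans (2*-mono-⪯ (⋖⇒s⪯ l)) p)))

  half-⋖ : ∀ {t h} → 𝟘 ⋖ t → Half t h → h ⋖ t
  half-⋖ {t} {h} 0<t (p , q) = compare-⪯ h t id λ l →
    absurd (⋖⇒¬⪯ (⋖-2* 0<t) (⪯-trans (2*-mono-⪯ l) p))

  half-⪯ : ∀ {t h} → Half t h → h ⪯ t
  half-⪯ (p , _) = ⪯-trans ⪯-2* p

  Exp : M → M → Set
  Exp x p = graph ⊨ (x ∷ p ∷ [] , [])

  instance
    stab-Exp : ∀ {x p} → Stab (Exp x p)
    stab-Exp = mkStab (stab (⟦ graph ⟧ _ _))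

  Exp-≐ : ∀ {x x′ p p′} → x ≐ x′ → p ≐ p′ → Exp x p → Exp x′ p′
  Exp-≐ e f a = ≐-elim e λ e → ≐-elim f λ f →
    ⟦⟧-cong (λ { 0F → e ; 1F → f }) (λ ()) graph a

  exp-⊨ : ∀ {s t : Term n} {ρ} {δ : Fin m → 𝒳} →
          (exp s t ⊨ (ρ , δ) → Exp (val s ρ) (val t ρ)) × (Exp (val s ρ) (val t ρ) → exp s t ⊨ (ρ , δ))
  exp-⊨ = ⟦⟧-sub (λ { 0F → ≋-refl ; 1F → ≋-refl }) (λ ()) graph

  private
    CΔ₀⁰-sound : ∀ {φ} → CΔ₀⁰ ⊢ φ → φ ⊨ ([] , [])
    CΔ₀⁰-sound d = sound {Th = CΔ₀⁰} (λ a _ → valid (inj₁ a)) d id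

  Exp-zero : ∀ {p} → (Exp 𝟘 p → p ≐ s̲ 𝟘) × (p ≐ s̲ 𝟘 → Exp 𝟘 p)
  Exp-zero {p} =
    let f , g = CΔ₀⁰-sound exp-zero p in
    (λ a → f (proj₂ exp-⊨ a)) , (λ e → proj₁ exp-⊨ (g e))

  Exp-suc : ∀ {x q} → Exp (s̲ x) q → ∃ᴾ λ p → Exp x p × q ≐ 2* p
  Exp-suc {x} {q} a k = proj₁ (CΔ₀⁰-sound exp-suc q x) (proj₂ exp-⊨ a) λ p (b , e) →
    k p (proj₁ exp-⊨ b , e)

  Exp-2* : ∀ {x p} → Exp x p → Exp (s̲ x) (2* p)
  Exp-2* {x} {p} a = proj₁ exp-⊨ (proj₂ (CΔ₀⁰-sound exp-suc (2* p) x) (λ k → k p (proj₂ exp-⊨ a , ≐-refl)))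

  Exp-⋖ : ∀ {x p} → Exp x p → x ⋖ p
  Exp-⋖ {x} {p} a = Δ-induction
    -- The value of the power changes along the induction on the exponent, so the induction formula
    -- covers all values below the fixed bound `s̲ p`. Halving a value keeps it below.
    (all< #1 (imp (sub-Δ₀⁰ (#1 ∷ #0 ∷ []) [] graph-Δ₀) (less #1 #0))) {s̲ p ∷ []} {[]}
    (λ q _ a → ⋖-≐ ≐-refl (≐-sym (proj₁ Exp-zero (proj₁ exp-⊨ a))) n⋖s)
    (λ x ih q q<b a → given (Exp-suc (proj₁ exp-⊨ a)) λ r (b , e) →
      let x<r = ih r (⪯-⋖-trans (⋖-≐ ≐-refl (s-≐ (≐-sym e)) ⪯-2*) q<b) (proj₂ exp-⊨ b)
      in ⋖-≐ ≐-refl (≐-sym e) (⪯-⋖-trans (⋖⇒s⪯ x<r) (⋖-2* (⪯-⋖-trans 0⪯ x<r))))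
    x p n⋖s (proj₂ exp-⊨ a)

  -- Initial segments

  -- The given `≼` has bounds of the form `≤`, which `Δ₀⁰` does not accept literally. This variant
  -- expresses them as strict bounds by successors.
  pre : Formula 2 0
  pre = ∃< (S #1) (∃< (S #2) (∃< #1 (exp #1 #2 ∧ var 4F ≈ #3 · #2 + #0)))

  preΔ : Δ₀⁰ pre
  preΔ = ex< (S #1) (ex< (S #2) (ex< #1 (and (sub-Δ₀⁰ (#1 ∷ #2 ∷ []) [] graph-Δ₀) (eq _ _))))

  infix 4 _≼ᵐ_
  record _≼ᵐ_ (σ τ : M) : Set where
    constructor mk≼
    field
      un≼ : pre ⊨ (σ ∷ τ ∷ [] , [])
  open _≼ᵐ_

  instance
    stab-≼ᵐ : ∀ {σ τ} → Stab (σ ≼ᵐ τ)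
    stab-≼ᵐ {σ} {τ} = mkStab λ k →
      mk≼ (stab (⟦ pre ⟧ (σ ∷ τ ∷ []) []) λ f → k λ l → f (un≼ l))

  ≼-≐ : ∀ {σ σ′ τ τ′} → σ ≐ σ′ → τ ≐ τ′ → σ ≼ᵐ τ → σ′ ≼ᵐ τ′
  ≼-≐ e f a = ≐-elim e λ e → ≐-elim f λ f →
    mk≼ (⟦⟧-cong (λ { 0F → e ; 1F → f }) (λ ()) pre (un≼ a))

  record Segment (σ τ : M) : Set where
    constructor segment
    field
      {p y x} : M
      p⪯τ     : p ⪯ τ
      y⪯τ     : y ⪯ τ
      x⋖p     : x ⋖ p
      2^y≐p   : Exp y p
      τ≐      : τ ≐ σ ⊗ p ⊕ x

  ≼-intro : ∀ {σ τ} → Segment σ τ → σ ≼ᵐ τ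
  ≼-intro {σ} {τ} (segment {p} {y} {x} a b c d e) = mk≼ λ k →
    k p (a , λ k → k y (b , λ k → k x (c , proj₂ exp-⊨ d , e)))

  ≼-elim : ∀ {C : Set} {{_ : Stab C}} {σ τ} → σ ≼ᵐ τ → (Segment σ τ → C) → C
  ≼-elim h f = given (un≼ h) λ p (a , h) → given h λ y (b , h) → given h λ x (c , d , e) →
    f (segment a b c (proj₁ exp-⊨ d) e)

  ≼-⊨ : ∀ {n m} {i j : Fin n} {ρ} {δ : Fin m → 𝒳} →
        (var i ≼ var j ⊨ (ρ , δ) → ρ i ≼ᵐ ρ j) × (ρ i ≼ᵐ ρ j → var i ≼ var j ⊨ (ρ , δ))
  ≼-⊨ {ρ = ρ} {δ} =
    (λ h → given h λ p (a , h) → given h λ y (b , h) → given h λ x (c , d , e) →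
      ≼-intro (segment (≤⇒⪯ a) (≤⇒⪯ b) c (proj₁ exp-⊨ d) e)) ,
    (λ h k → ≼-elim h λ (segment {p} {y} {x} a b c d e) →
      k p (⋖-suc a , λ k → k y (⋖-suc b , λ k → k x (c , proj₂ exp-⊨ d , e))))
    where
    ≤⇒⪯ : ∀ {x y} → x ⋖ y ∨ᴾ x ≐ y → x ⪯ y
    ≤⇒⪯ d = cases d ⋖⇒⪯ ≐⇒⪯

  ≼-refl : ∀ {τ} → 𝟘 ⋖ τ → τ ≼ᵐ τ
  ≼-refl {τ} l = ≼-intro (segment (⋖⇒s⪯ l) 0⪯ n⋖s (proj₂ Exp-zero ≐-refl)
    (≐-sym (⊕-zero ⨾ ⊗-suc ⨾ ⊕-≐ ⊗-zero ≐-refl ⨾ 0-⊕)))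

  ⋠0 : ∀ {σ} → σ ≼ᵐ 𝟘 → P
  ⋠0 h = ≼-elim h λ (segment a _ c _ _) →
    cases (⋖-suc a) ⋖0 (λ e → ⋖0 (⋖-≐ ≐-refl e c))

  0⋠ : ∀ {τ} → 𝟘 ≼ᵐ τ → P
  0⋠ h = ≼-elim h λ (segment a _ c _ e) →
    ⋖-irrefl (⋖-⪯-trans (⋖-≐ (≐-sym (e ⨾ ⊕-≐ 0-⊗ ≐-refl ⨾ 0-⊕)) ≐-refl c) a)

  ≼-half : ∀ {σ τ h} → σ ≼ᵐ h → Half τ h → σ ≼ᵐ τ
  ≼-half {σ} {τ} {h} l hf = ≼-elim l λ (segment {p} {y} {x} a b c d e) →
    let base = 2*-≐ e ⨾ 2*-⊕ ⨾ ⊕-≐ (≐-sym ⊗-2*) ≐-refl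
        p′ = ⪯-trans (2*-mono-⪯ a) (proj₁ hf)
        y′ = ⪯-trans (⪯-s b) (half-⋖′ (⋖-⪯-trans (⪯-⋖-trans 0⪯ c) a))
    in cases (half-cases hf)
      (λ t → ≼-intro (segment p′ y′ (⋖-trans n⋖s (2*-mono-⋖ c)) (Exp-2* d) (t ⨾ base)))
      (λ t → ≼-intro (segment p′ y′ (2*-mono-⋖ c) (Exp-2* d) (t ⨾ s-≐ base ⨾ ≐-sym ⊕-suc)))
    where
    half-⋖′ : 𝟘 ⋖ h → s̲ h ⪯ τ
    half-⋖′ l = ⋖⇒s⪯ (⋖-⪯-trans (⋖-2* l) (proj₁ hf))

  ⪯-⊗ : ∀ {a p} → 𝟘 ⋖ a → p ⪯ a ⊗ p
  ⪯-⊗ {a} {p} l = Δ-induction (less #0 (S (#1 · #0))) {a ∷ []} {[]} 0⪯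
    (λ p ih → given (predecessor l) λ b e →
      ⋖-≐ ≐-refl (s-≐ (≐-sym (⊗-suc ⨾ ⊕-≐ ≐-refl e ⨾ ⊕-suc))) (⪯-s (⪯-trans ih ⪯-⊕))) p

  -- With `≼-half` this is the recursion for initial segments, and the order laws below are strong
  -- inductions along it. Exponent `0` forces `p` to be `1` and `x` to be `0`. Otherwise `p` is
  -- twice some `q`, and with `x′` the half of `x` the number `σ ⊗ q ⊕ x′` is a half of `τ`, hence
  -- equal to `h`.
  ≼-step : ∀ {σ τ h} → Half τ h → σ ≼ᵐ τ → σ ≐ τ ∨ᴾ σ ≼ᵐ h
  ≼-step {σ} {τ} {h} hf l = ≼-elim l λ (segment {p} {y} {x} a b c d e) →
    compare 𝟘 y
      (λ 0<y → given (predecessor 0<y) λ z f → given (Exp-suc (Exp-≐ f ≐-refl d)) λ q (d′ , g) →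
        given (half-exists x) λ x′ X →
        let x′⋖q = 2*-cancel-⋖ (⪯-⋖-trans (proj₁ X) (⋖-≐ ≐-refl g c))
            τ≐ = e ⨾ ⊕-≐ (⊗-≐ ≐-refl g ⨾ ⊗-2*) ≐-refl
            hf′ : Half τ (σ ⊗ q ⊕ x′)
            hf′ = ⋖-≐ (≐-sym 2*-⊕) (≐-sym (s-≐ τ≐)) (⊕-monoʳ-⪯ (proj₁ X)) ,
                 ⋖-≐ (≐-sym τ≐) (≐-sym (2*-suc ⨾ s-≐ (s-≐ 2*-⊕) ⨾ ≐-sym (⊕-≐ ≐-refl 2*-suc ⨾ ⊕-suc ⨾ s-≐ ⊕-suc)))
                   (⊕-monoʳ-⋖ (proj₂ X))
            h≐ = half-unique hf hf′
            q⪯h : q ⪯ h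
            q⪯h = ⋖-≐ ≐-refl (s-≐ (≐-sym h≐)) (⪯-trans (⪯-⊗ 0⋖σ) ⪯-⊕)
        in right (≼-intro (segment q⪯h (⋖⇒⪯ (⋖-⪯-trans (Exp-⋖ d′) q⪯h)) x′⋖q d′ h≐)))
      (λ 0≐y → let p≐1 = proj₁ Exp-zero (Exp-≐ (≐-sym 0≐y) ≐-refl d)
                   x≐0 = cases (⋖-suc (⋖-≐ ≐-refl p≐1 c)) (λ l → absurd (⋖0 l)) id
               in left (≐-sym (e ⨾ ⊕-≐ (⊗-≐ ≐-refl p≐1 ⨾ ⊗-suc ⨾ ⊕-≐ ⊗-zero ≐-refl ⨾ 0-⊕) x≐0 ⨾ ⊕-zero)))
      (λ y<0 → absurd (⋖0 y<0))
    where
    0⋖σ : 𝟘 ⋖ σ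
    0⋖σ = compare 𝟘 σ id (λ e → absurd (0⋠ (≼-≐ (≐-sym e) ≐-refl l))) (λ l → absurd (⋖0 l))

  pre-⊨ : (s t : Term n) → ∀ {ρ} {δ : Fin m → 𝒳} →
          (sub (s ∷ t ∷ []) [] pre ⊨ (ρ , δ) → val s ρ ≼ᵐ val t ρ) ×
          (val s ρ ≼ᵐ val t ρ → sub (s ∷ t ∷ []) [] pre ⊨ (ρ , δ))
  pre-⊨ s t =
    let f , g = ⟦⟧-sub {σ = s ∷ t ∷ []} (λ { 0F → ≋-refl ; 1F → ≋-refl }) (λ ()) pre in
    (λ a → mk≼ (f a)) , (λ a → g (un≼ a))

  pre-set : ∃ᴾ λ X → X encodes _≼ᵐ_
  pre-set k = comprehension (sub-Δ₀⁰ (H #0 ∷ T #0 ∷ []) [] preΔ) [] [] λ X h → k X λ σ τ →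
    (λ a → ≼-≐ h-pr t-pr (proj₁ (pre-⊨ (H #0) (T #0)) (proj₁ (h (pr σ τ)) a))) ,
    (λ a → proj₂ (h (pr σ τ)) (proj₂ (pre-⊨ (H #0) (T #0)) (≼-≐ (≐-sym h-pr) (≐-sym t-pr) a)))

  private
    preΔ-at : ∀ (s t : Term n) → Δ₀⁰ {m = m} (sub (s ∷ t ∷ []) [] pre)
    preΔ-at s t = sub-Δ₀⁰ (s ∷ t ∷ []) [] preΔ

    ⊨⇒≼ : ∀ (s t : Term n) {ρ} {δ : Fin m → 𝒳} → sub (s ∷ t ∷ []) [] pre ⊨ (ρ , δ) → val s ρ ≼ᵐ val t ρ
    ⊨⇒≼ s t = proj₁ (pre-⊨ s t)

    ≼⇒⊨ : ∀ (s t : Term n) {ρ} {δ : Fin m → 𝒳} → val s ρ ≼ᵐ val t ρ → sub (s ∷ t ∷ []) [] pre ⊨ (ρ , δ)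
    ≼⇒⊨ s t = proj₂ (pre-⊨ s t)

  ≼⇒0⋖ : ∀ {σ τ} → σ ≼ᵐ τ → 𝟘 ⋖ τ
  ≼⇒0⋖ {σ} {τ} l = compare 𝟘 τ id (λ e → absurd (⋠0 (≼-≐ ≐-refl (≐-sym e) l))) (λ l → absurd (⋖0 l))

  0⋖≼ : ∀ {σ τ} → σ ≼ᵐ τ → 𝟘 ⋖ σ
  0⋖≼ {σ} {τ} l = compare 𝟘 σ id (λ e → absurd (0⋠ (≼-≐ (≐-sym e) ≐-refl l))) (λ l → absurd (⋖0 l))

  ≼-trans : ∀ {σ τ υ} → σ ≼ᵐ τ → τ ≼ᵐ υ → σ ≼ᵐ υ
  ≼-trans {σ} {τ} {υ} l g = ⊨⇒≼ #1 #0 (Δ-strong-induction {m = 0}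
    (imp (preΔ-at #2 #0) (preΔ-at #1 #0)) (σ ∷ τ ∷ []) []
    (λ υ ih g → let τ≼υ = ⊨⇒≼ #2 #0 g in ≼⇒⊨ #1 #0 (given (half-exists υ) λ h hf →
      cases (≼-step hf τ≼υ) (λ e → ≼-≐ ≐-refl e l)
        (λ τ≼h → ≼-half (⊨⇒≼ #1 #0 (ih h (half-⋖ (≼⇒0⋖ τ≼υ) hf) (≼⇒⊨ #2 #0 τ≼h))) hf)))
    υ (≼⇒⊨ #2 #0 g))

  ≼⇒⪯ : ∀ {σ τ} → σ ≼ᵐ τ → σ ⪯ τ
  ≼⇒⪯ {σ} {τ} l = Δ-strong-induction {m = 0}
    (imp (preΔ-at #1 #0) (less #1 (S #0))) (σ ∷ []) []
    (λ τ ih l → let σ≼τ = ⊨⇒≼ #1 #0 l in given (half-exists τ) λ h hf →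
      cases (≼-step hf σ≼τ) ≐⇒⪯
        (λ σ≼h → let h⋖τ = half-⋖ (≼⇒0⋖ σ≼τ) hf in
          ⋖⇒⪯ (⪯-⋖-trans (ih h h⋖τ (≼⇒⊨ #1 #0 σ≼h)) h⋖τ)))
    τ (≼⇒⊨ #1 #0 l)

  ≼-linear : ∀ {σ σ′ τ} → σ ≼ᵐ τ → σ′ ≼ᵐ τ → σ ≼ᵐ σ′ ∨ᴾ σ′ ≼ᵐ σ
  ≼-linear {σ} {σ′} {τ} l l′ (f , g) = Δ-strong-induction {m = 0}
    (imp (preΔ-at #1 #0) (imp (preΔ-at #2 #0) (or (preΔ-at #1 #2) (preΔ-at #2 #1)))) (σ ∷ σ′ ∷ []) []
    (λ τ ih l l′ (f , g) → let σ≼τ = ⊨⇒≼ #1 #0 l ; σ′≼τ = ⊨⇒≼ #2 #0 l′ in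
      given (half-exists τ) λ h hf →
      cases (≼-step hf σ≼τ) (λ e → g (≼⇒⊨ #2 #1 (≼-≐ ≐-refl (≐-sym e) σ′≼τ))) λ σ≼h →
      cases (≼-step hf σ′≼τ) (λ e → f (≼⇒⊨ #1 #2 (≼-≐ ≐-refl (≐-sym e) σ≼τ))) λ σ′≼h →
      ih h (half-⋖ (≼⇒0⋖ σ≼τ) hf) (≼⇒⊨ #1 #0 σ≼h) (≼⇒⊨ #2 #0 σ′≼h)
        ((λ a → f (≼⇒⊨ #1 #2 (⊨⇒≼ #1 #2 a))) , (λ a → g (≼⇒⊨ #2 #1 (⊨⇒≼ #2 #1 a)))))
    τ (≼⇒⊨ #1 #0 l) (≼⇒⊨ #2 #0 l′) ((λ l → f (⊨⇒≼ #1 #2 l)) , (λ l → g (⊨⇒≼ #2 #1 l)))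

  -- Linearity leaves the direction open, but a segment never has the larger code. Hence whether `σ`
  -- lies on a chain is settled once the chain passes the number `σ`.
  ≼-⪯ : ∀ {σ σ′ τ} → σ ≼ᵐ τ → σ′ ≼ᵐ τ → σ ⪯ σ′ → σ ≼ᵐ σ′
  ≼-⪯ {σ} {σ′} l l′ σ⪯σ′ = cases (≼-linear l l′) id
    λ g → ≼-≐ ≐-refl (⪯-antisym σ⪯σ′ (≼⇒⪯ g)) (≼-refl (0⋖≼ l))

  -- Level b consists of the codes in [b, 2b).  It need not be a level of the
  -- binary tree, but it is an antichain met by every initial-segment chain
  -- that reaches b, and no powers of two are needed to define it.
  level : ∀ {b τ} → 𝟘 ⋖ b → b ⪯ τ → ∃ᴾ λ σ → σ ≼ᵐ τ × b ⪯ σ × σ ⋖ 2* b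
  level {b} {τ} 0<b b⪯τ k = Δ-strong-induction {m = 0}
    (imp (less #1 (S #0)) (ex< (S #0) (and (preΔ-at #0 #1) (and (less #2 (S #0)) (less #0 (𝟐 · #2))))))
    (b ∷ []) []
    (λ τ ih b⪯τ k → compare-⪯ τ (2* b)
      (λ l → k τ (n⋖s , ≼⇒⊨ #0 #1 (≼-refl (⋖-⪯-trans 0<b b⪯τ)) , b⪯τ , l))
      (λ g → given (half-exists τ) λ h hf →
        let b⪯h = 2*-cancel-⋖ (⪯-⋖-trans g (proj₂ hf)) in
        ih h (half-⋖ (⋖-⪯-trans 0<b b⪯τ) hf) b⪯h λ σ (a , p , q , r) →
          k σ (⪯-trans a (half-⪯ hf) , ≼⇒⊨ #0 #1 (≼-half (⊨⇒≼ #0 #1 p) hf) , q , r)))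
    τ b⪯τ λ σ (_ , p , q , r) → k σ (⊨⇒≼ #0 #1 p , q , r)

-- Pairs, composition and collection

module Collection {P : Set} (𝔐 : Model P) where

  open Model 𝔐
  open Arithmetic 𝔐

  pr-hw-tw : ∀ {w} → 𝟘 ⋖ w → pr (h̲ w) (t̲ w) ≐ w
  pr-hw-tw l = given (pr-surjective l) λ x e → given e λ y (_ , _ , p) →
    ≐-trans (pr-≐ (≐-trans (h-≐ (≐-sym p)) h-pr) (≐-trans (t-≐ (≐-sym p)) t-pr)) p

  0⋖pr : ∀ {x y} → 𝟘 ⋖ pr x y
  0⋖pr {x} {y} = compare 𝟘 (pr x y) id (λ e → absurd (pr≢0 (≐-sym e))) (λ l → absurd (⋖0 l))

  -- Binary relations become sets through `H` and `T`. The number `𝟘` is not a pair and is excluded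
  -- explicitly, because functions must not contain it.
  pairs : {φ : Formula (suc (suc n)) m} → Δ₀⁰ φ → ∀ ρ δ →
          ∃ᴾ λ X → X encodes (λ x y → φ ⊨ (x ∷ y ∷ ρ , δ)) × (𝟘 ∊ X → P)
  pairs {n} {m} {φ} d ρ δ k =
    comprehension (and (less 𝟎 #0) (sub-Δ₀⁰ σ id d)) ρ δ λ X h →
    let shift : ∀ x y → (sub σ id φ ⊨ (pr x y ∷ ρ , δ) → φ ⊨ (x ∷ y ∷ ρ , δ))
                      × (φ ⊨ (x ∷ y ∷ ρ , δ) → sub σ id φ ⊨ (pr x y ∷ ρ , δ))
        shift x y =
          (λ a → ≐-elim {{mkStab (stab (⟦ φ ⟧ _ _))}} (h-pr {x} {y}) λ p →
                 ≐-elim {{mkStab (stab (⟦ φ ⟧ _ _))}} (t-pr {x} {y}) λ q →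
                 proj₁ (⟦⟧-sub {σ = σ} (λ { zero → p ; 1F → q ; (suc (suc i)) → ≋-refl }) (λ _ → refl) φ) a) ,
          (λ a → ≐-elim {{mkStab (stab (⟦ sub σ id φ ⟧ _ _))}} (h-pr {x} {y}) λ p →
                 ≐-elim {{mkStab (stab (⟦ sub σ id φ ⟧ _ _))}} (t-pr {x} {y}) λ q →
                 proj₂ (⟦⟧-sub {σ = σ} (λ { zero → p ; 1F → q ; (suc (suc i)) → ≋-refl }) (λ _ → refl) φ) a)
    in k X ((λ x y → (λ a → proj₁ (shift x y) (proj₂ (proj₁ (h (pr x y)) a)))
                   , (λ a → proj₂ (h (pr x y)) (0⋖pr , proj₂ (shift x y) a)))
           , λ a → ⋖0 (proj₁ (proj₁ (h 𝟘) a)))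
    where
    σ : Fin (suc (suc n)) → Term (suc n)
    σ = H #0 ∷ T #0 ∷ (var ∘ suc)

  Functional : 𝒳 → Set
  Functional f = (∀ x → ∃ᴾ λ y → pr x y ∊ f)
               × (∀ x y y′ → pr x y ∊ f × pr x y′ ∊ f → y ≐ y′)
               × (𝟘 ∊ f → P)

  composition : ∀ g h → Functional g → Functional h →
                ∃ᴾ λ f → Functional f × ∀ x y z → pr x z ∊ h × pr z y ∊ g → pr x y ∊ f
  composition g h g-fun h-fun = valid (inj₂ refl) g h (g-fun , h-fun)

  -- Composition lets the values of a function on different arguments be
  -- compared inside a set, so that a bounded search finds a largest value.
  module Maximum (F : 𝒳) (F-fun : Functional F) where

    private
      module _ (pairing-set comparison R : 𝒳)
        (hp : pairing-set encodes λ w y → 𝟘 ⋖ y × pr (h̲ w) (h̲ y) ∊ F × pr (t̲ w) (t̲ y) ∊ F)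
        (hc : comparison encodes λ y i → (h̲ y ⪯ t̲ y × i ≐ 𝟘) ∨ᴾ (t̲ y ⋖ h̲ y × i ≐ s̲ 𝟘))
        (R-fun : Functional R)
        (R-comp : ∀ x y z → pr x z ∊ pairing-set × pr z y ∊ comparison → pr x y ∊ R) where

        _≤F_ : M → M → Set
        x ≤F x′ = pr (pr x x′) 𝟘 ∊ R

        ≤F-intro : ∀ {x x′ u v} → pr x u ∊ F → pr x′ v ∊ F → u ⪯ v → x ≤F x′
        ≤F-intro {x} {x′} {u} {v} a b l = R-comp _ _ (pr u v)
          ( proj₂ (hp _ _) (0⋖pr , ∊-≐ (≐-sym (pr-≐ h-pr h-pr)) a , ∊-≐ (≐-sym (pr-≐ t-pr t-pr)) b)
          , proj₂ (hc _ _) (left (⋖-≐ (≐-sym h-pr) (s-≐ (≐-sym t-pr)) l , ≐-refl)))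

        ≤F-elim : ∀ {x x′ u v} → pr x u ∊ F → pr x′ v ∊ F → x ≤F x′ → u ⪯ v
        ≤F-elim {x} {x′} {u} {v} a b r = compare-⪯ v u
          (λ l → absurd (s≢0 (proj₁ (proj₂ R-fun) _ _ _
            ( R-comp _ _ (pr u v)
              ( proj₂ (hp _ _) (0⋖pr , ∊-≐ (≐-sym (pr-≐ h-pr h-pr)) a , ∊-≐ (≐-sym (pr-≐ t-pr t-pr)) b)
              , proj₂ (hc _ _) (right (⋖-≐ (≐-sym t-pr) (≐-sym h-pr) l , ≐-refl)))
            , r))))
          id

        maximum′ : ∀ c → ∃ᴾ λ v → ∀ x u → x ⪯ c → pr x u ∊ F → u ⪯ v
        maximum′ c k = Δ-induction
          -- The induction formula asserts an argument at which the maximum is attained. The maximal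
          -- value itself has no bound yet, so it could not be mentioned by a bounded quantifier.
          (ex< (S #0) (all< (S #1) (mem ⟨ ⟨ #0 , #1 ⟩ , 𝟎 ⟩ 0F))) {[]} {R ∷ []}
          (λ k → proj₁ F-fun 𝟘 λ u a → k 𝟘 (n⋖s , λ x l →
            let e = cases (⋖-suc l) (λ l → absurd (⋖0 l)) id
            in ≤F-intro (∊-≐ (pr-≐ (≐-sym e) ≐-refl) a) a ⪯-refl))
          (λ c ih k → ih λ x₀ (x₀⪯c , top) → proj₁ F-fun x₀ λ u₀ a₀ → proj₁ F-fun (s̲ c) λ u₁ a₁ →
            compare-⪯ u₀ u₁
              (λ l → k (s̲ c) (n⋖s , λ x x⪯sc → cases (⋖-suc x⪯sc)
                (λ x⪯c → given (proj₁ F-fun x) λ u a →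
                  ≤F-intro a a₁ (⪯-trans (≤F-elim a a₀ (top x x⪯c)) (⋖⇒⪯ l)))
                (λ e → ≤F-intro (∊-≐ (pr-≐ (≐-sym e) ≐-refl) a₁) a₁ ⪯-refl)))
              (λ g → k x₀ (⋖⇒⪯ x₀⪯c , λ x x⪯sc → cases (⋖-suc x⪯sc) (top x)
                (λ e → ≤F-intro (∊-≐ (pr-≐ (≐-sym e) ≐-refl) a₁) a₀ g))))
          c λ x₀ (_ , top) → proj₁ F-fun x₀ λ v b → k v λ x u l a → ≤F-elim a b (top x l)

    maximum : ∀ c → ∃ᴾ λ v → ∀ x u → x ⪯ c → pr x u ∊ F → u ⪯ v
    maximum c k =
      -- `Q` maps a pair of arguments to the pair of their values, and `C` maps a pair to `0` or `1`
      -- according to the order of its components; the comparison is their composite. Values of `Q`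
      -- are required to be positive because `0` has the same projections as `⟨ 0 , 0 ⟩`.
      pairs (and (less 𝟎 #1) (and (mem ⟨ H #0 , H #1 ⟩ 0F) (mem ⟨ T #0 , T #1 ⟩ 0F))) [] (F ∷ []) λ Q (hp , Q0) →
      pairs (or (and (less (H #0) (S (T #0))) (eq #1 𝟎)) (and (less (T #0) (H #0)) (eq #1 𝟏))) [] [] λ C (hc , C0) →
      composition C Q
        ( (λ y k → compare-⪯ (t̲ y) (h̲ y) (λ l → k 𝟏ᵐ (proj₂ (hc y 𝟏ᵐ) (right (l , ≐-refl))))
                                          (λ l → k 𝟘 (proj₂ (hc y 𝟘) (left (l , ≐-refl)))))
        , (λ y i j (a , b) → cases (proj₁ (hc y i) a)
            (λ (l , e) → cases (proj₁ (hc y j) b) (λ (_ , f) → ≐-trans e (≐-sym f)) (λ (g , _) → absurd (⋖⇒¬⪯ g l)))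
            (λ (g , e) → cases (proj₁ (hc y j) b) (λ (l , _) → absurd (⋖⇒¬⪯ g l)) (λ (_ , f) → ≐-trans e (≐-sym f))))
        , C0)
        ( (λ w k → proj₁ F-fun (h̲ w) λ u a → proj₁ F-fun (t̲ w) λ v b → k (pr u v) (proj₂ (hp w (pr u v))
            (0⋖pr , ∊-≐ (pr-≐ ≐-refl (≐-sym h-pr)) a , ∊-≐ (pr-≐ ≐-refl (≐-sym t-pr)) b)))
        , (λ w y y′ (a , b) →
            let p , a₁ , a₂ = proj₁ (hp w y) a
                q , b₁ , b₂ = proj₁ (hp w y′) b
            in ≐-trans (≐-sym (pr-hw-tw p)) (≐-trans
                 (pr-≐ (proj₁ (proj₂ F-fun) _ _ _ (a₁ , b₁)) (proj₁ (proj₂ F-fun) _ _ _ (a₂ , b₂)))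
                 (pr-hw-tw q)))
        , Q0)
        λ R (R-fun , R-comp) → maximum′ Q C R hp hc R-fun R-comp c k
      where
      𝟏ᵐ : M
      𝟏ᵐ = s̲ 𝟘

  -- The least `y` related to `x` is a function on the arguments below `a`, made total by the value
  -- `0` elsewhere. The successor of its maximum is the bound.
  collection : ∀ A a → (∀ x → x ⋖ a → ∃ᴾ λ y → pr x y ∊ A) →
               ∃ᴾ λ b → ∀ x → x ⋖ a → ∃ᴾ λ y → y ⋖ b × pr x y ∊ A
  collection A a total k =
    pairs (or (and (less #0 #2) (and (mem ⟨ #0 , #1 ⟩ 0F) (all< #1 (imp (mem ⟨ #1 , #0 ⟩ 0F) bot))))
              (and (imp (less #0 #2) bot) (eq #1 𝟎))) (a ∷ []) (A ∷ []) λ F (hF , F0) →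
    Maximum.maximum F
      ( (λ x k → decide (x ⋖ a)
          (λ l → total x l λ y b → comprehension (mem ⟨ #1 , #0 ⟩ 0F) (x ∷ []) (A ∷ []) λ Y hY →
            least Y (proj₂ (hY y) b) λ z (c , below) →
            k z (proj₂ (hF x z) (left (l , proj₁ (hY z) c , λ v l b → below v l (proj₂ (hY v) b)))))
          (λ ¬l → k 𝟘 (proj₂ (hF x 𝟘) (right (¬l , ≐-refl)))))
      , (λ x y y′ (p , q) → cases (proj₁ (hF x y) p)
          (λ (l , b , m) → cases (proj₁ (hF x y′) q)
            (λ (_ , b′ , m′) → compare y y′ (λ l → absurd (m′ y l b)) id (λ l → absurd (m y′ l b′)))
            (λ (¬l , _) → absurd (¬l l)))
          (λ (¬l , e) → cases (proj₁ (hF x y′) q)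
            (λ (l , _) → absurd (¬l l))
            (λ (_ , f) → ≐-trans e (≐-sym f))))
      , F0) a λ v bound → k (s̲ v) λ x x<a k → total x x<a λ y b →
        comprehension (mem ⟨ #1 , #0 ⟩ 0F) (x ∷ []) (A ∷ []) λ Y hY →
        least Y (proj₂ (hY y) b) λ z (c , below) →
        k z ( bound x z (⋖⇒⪯ x<a) (proj₂ (hF x z) (left (x<a , proj₁ (hY z) c , λ v l b → below v l (proj₂ (hY v) b))))
            , proj₁ (hY z) c)

  Δ-collection : {φ : Formula (suc (suc n)) m} → Δ₀⁰ φ → ∀ ρ δ a →
                 (∀ x → x ⋖ a → ∃ᴾ λ y → φ ⊨ (x ∷ y ∷ ρ , δ)) →
                 ∃ᴾ λ b → ∀ x → x ⋖ a → ∃ᴾ λ y → y ⋖ b × φ ⊨ (x ∷ y ∷ ρ , δ)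
  Δ-collection d ρ δ a total k = pairs d ρ δ λ X (h , _) →
    collection X a (λ x l k → total x l λ y b → k y (proj₂ (h x y) b))
      λ b c → k b λ x l k → c x l λ y (y<b , a) → k y (y<b , proj₁ (h x y) a)

-- Forcing

module _ {W : Set} (_≤_ : W → W → Set) (P : Set) where

  -- These are the regular open sets of conditions: by `dense`, what is forced densely below a
  -- condition is forced by it, with density read as a double negation relative to `P`. This closure
  -- is what validates `⊥-raa`.
  record Forced : Set₁ where
    field
      Forces : W → Set
      weaken : ∀ {w w′} → w′ ≤ w → Forces w → Forces w′
      dense  : ∀ {w} → (∀ w′ → w′ ≤ w → (∀ w″ → w″ ≤ w′ → Forces w″ → P) → P) → Forces w

module Kripke {W : Set} (_≤_ : W → W → Set) (≤-refl : ∀ {w} → w ≤ w)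
  (≤-trans : ∀ {u v w} → u ≤ v → v ≤ w → u ≤ w) (P : Set) where

  open Forced

  kripke : Algebra
  kripke = record
    { Ω       = Forced _≤_ P
    ; _⊑_     = λ a b → ∀ {w} → Forces a w → Forces b w
    ; 𝟙       = record { Forces = λ _ → P → P ; weaken = λ _ → id ; dense = λ _ → id }
    ; ⊥̂       = record { Forces = λ _ → P ; weaken = λ _ → id ; dense = λ k → k _ ≤-refl λ _ _ → id }
    ; _⊓_     = λ a b → record
        { Forces = λ w → Forces a w × Forces b w
        ; weaken = λ l (x , y) → weaken a l x , weaken b l y
        ; dense  = λ k → dense a (λ w l f → k w l λ w′ l′ → f w′ l′ ∘ proj₁)
                       , dense b (λ w l f → k w l λ w′ l′ → f w′ l′ ∘ proj₂) }
    ; _⇛_     = λ a b → record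
        { Forces = λ w → ∀ w′ → w′ ≤ w → Forces a w′ → Forces b w′
        ; weaken = λ l h w′ l′ → h w′ (≤-trans l′ l)
        ; dense  = λ k w′ l x → dense b λ w₁ l₁ f → k w₁ (≤-trans l₁ l) λ w₂ l₂ h →
            f w₂ l₂ (h w₂ ≤-refl (weaken a (≤-trans l₂ l₁) x)) }
    ; ⨅       = λ f → record
        { Forces = λ w → ∀ i → Forces (f i) w
        ; weaken = λ l h i → weaken (f i) l (h i)
        ; dense  = λ k i → dense (f i) λ w l g → k w l λ w′ l′ h → g w′ l′ (h i) }
    ; ⊑-refl  = id
    ; ⊑-trans = λ f g x → g (f x)
    ; ⊑-𝟙     = λ _ → id
    ; ⊓-fst   = proj₁
    ; ⊓-snd   = proj₂
    ; ⊓-pair  = λ f g x → f x , g x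
    ; ⇛-intro = λ {a} f x w′ l y → f (y , weaken a l x)
    ; ⇛-elim  = λ f g x → f x _ ≤-refl (g x)
    ; ⨅-intro = λ f x i → f i x
    ; ⨅-elim  = λ i f → f i
    ; ⊥-raa   = λ {a} {b} f x → dense b λ w l g → f (g , weaken a l x)
    }

-- The relation of initial segment is supplied as a set `PR`, so that names can be defined from it
-- by atomic formulas.
module Forcing {P : Set} (𝔐 : Model P) (E : Exponentiation)
  (PR : Model.𝒳 𝔐) (PR-def : Arithmetic._encodes_ 𝔐 PR (Prefix._≼ᵐ_ 𝔐 E))
  (T₀ : Model.𝒳 𝔐) where

  open Model 𝔐
  open Prefix 𝔐 E
  open Collection 𝔐

  record Condition : Set where
    field
      tree      : 𝒳
      initial   : ∀ {σ τ} → σ ≼ᵐ τ → τ ∊ tree → σ ∊ tree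
      nonzero   : ∀ {τ} → τ ∊ tree → 𝟘 ⋖ τ
      unbounded : ∀ b → ∃ᴾ λ τ → τ ∊ tree × b ⪯ τ
      inside    : ∀ {τ} → τ ∊ tree → τ ∊ T₀
  open Condition

  _≤ᶜ_ : Condition → Condition → Set
  q ≤ᶜ r = ∀ {τ} → τ ∊ tree q → τ ∊ tree r

  -- A bounded part of a tree does not affect the generic branch. For properties that become
  -- constant along chains, holding at almost all nodes amounts to being forced of all long segments
  -- of the branch.
  Almost : Condition → (M → Set) → Set
  Almost q A = ∃ᴾ λ b → ∀ τ → τ ∊ tree q → b ⪯ τ → A τ

  Almost-≤ : ∀ {q r A} → q ≤ᶜ r → Almost r A → Almost q A
  Almost-≤ l h k = h λ b f → k b λ τ i → f τ (l i)

  Almost-map : ∀ {q A B} → (∀ τ → τ ∊ tree q → A τ → B τ) → Almost q A → Almost q B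
  Almost-map f h k = h λ b g → k b λ τ i l → f τ i (g τ i l)

  Almost-from : ∀ {q A} b → (∀ τ → τ ∊ tree q → b ⪯ τ → A τ) → Almost q A
  Almost-from b f k = k b f

  Almost-× : ∀ {q A B} → Almost q A → Almost q B → Almost q (λ τ → A τ × B τ)
  Almost-× h g k = h λ b f → g λ c e → upper b c λ d (b⪯d , c⪯d) → k d λ τ i l →
    f τ i (⪯-trans b⪯d l) , e τ i (⪯-trans c⪯d l)

  Almost-⊥ : ∀ {q} → Almost q (λ _ → P) → P
  Almost-⊥ {q} h = h λ b f → unbounded q b λ τ (i , l) → f τ i l

  Almost-const : ∀ {q A} {{_ : Stab A}} → Almost q (λ _ → A) → A
  Almost-const {q} h = unstab λ k → Almost-⊥ {q} (Almost-map {q} (λ _ _ → k) h)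

  -- The nodes of `q` that lie in `Z` or below `B` form the new tree. Keeping those below `B` makes
  -- it closed under initial segments although `Z` is so only beyond `B`. Were it bounded, almost
  -- all nodes of `q` would avoid `Z`.
  restrict : ∀ q Z B → (∀ {σ τ} → B ⪯ σ → σ ≼ᵐ τ → τ ∊ Z → σ ∊ Z) →
             (Almost q (λ τ → τ ∊ Z → P) → P) →
             ∃ᴾ λ r → r ≤ᶜ q × (∀ τ → τ ∊ tree r → B ⪯ τ → τ ∊ Z)
  restrict q Z B down h k =
    comprehension (and (mem #0 0F) (or (less #0 #1) (mem #0 1F))) (B ∷ []) (tree q ∷ Z ∷ []) λ R hR →
    k (record
        { tree      = R
        ; initial   = λ {σ} {τ} l i → proj₂ (hR σ)
            ( initial q l (proj₁ (proj₁ (hR τ) i))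
            , λ (f , g) → compare-⪯ σ B f λ B⪯σ → proj₂ (proj₁ (hR τ) i)
                ( (λ τ<B → ⋖⇒¬⪯ τ<B (⪯-trans B⪯σ (≼⇒⪯ l)))
                , (λ z → g (down B⪯σ l z))))
        ; nonzero   = λ {τ} i → nonzero q (proj₁ (proj₁ (hR τ) i))
        ; unbounded = λ b k′ → h (Almost-from {q} b λ τ i l z → k′ τ (proj₂ (hR τ) (i , λ (_ , g) → g z) , l))
        ; inside    = λ {τ} i → inside q (proj₁ (proj₁ (hR τ) i))
        })
      ((λ {τ} i → proj₁ (proj₁ (hR τ) i)) ,
       λ τ i l → unstab λ n → proj₂ (proj₁ (hR τ) i) ((λ τ<B → ⋖⇒¬⪯ τ<B l) , n))

  -- That `v` holds from some level `[c , 2c)` on is a `Δ₀⁰` condition on `c`, as persistence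
  -- reduces it to the nodes of that level. Collection bounds these `c` for all `v ⋖ a` by one `d`,
  -- and a node beyond `2* d` has a segment in each of the levels. The successor taken for `c` makes
  -- the level positive.
  compact : ∀ q A a B → (∀ {v σ τ} → v ⋖ a → B ⪯ σ → σ ≼ᵐ τ → pr v σ ∊ A → pr v τ ∊ A) →
            (∀ v → v ⋖ a → Almost q λ τ → pr v τ ∊ A) →
            Almost q λ τ → ∀ v → v ⋖ a → pr v τ ∊ A
  compact q A a B up h k = Δ-collection
    (and (less #2 (S #1)) (and (less 𝟎 #1) (all< (𝟐 · #1)
      (imp (less #2 (S #0)) (imp (mem #0 0F) (mem ⟨ #1 , #0 ⟩ 1F))))))
    (B ∷ []) (tree q ∷ A ∷ []) a
    (λ v l k → h v l λ b f → upper b B λ c (b⪯c , B⪯c) → k (s̲ c)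
      ( ⋖⇒⪯ B⪯c , 0⪯ , λ σ _ c⪯σ i → f σ i (⪯-trans b⪯c (⋖⇒⪯ (s⪯⇒⋖ c⪯σ)))))
    λ d f → k (2* d) λ τ i 2d⪯τ v l → given (f v l) λ c (c<d , B⪯c , 0<c , g) →
      given (level 0<c (⪯-trans ⪯-2* (⪯-trans (2*-mono-⪯ (⋖⇒⪯ c<d)) 2d⪯τ))) λ σ (σ≼τ , c⪯σ , σ<2c) →
      up l (⪯-trans B⪯c c⪯σ) σ≼τ (g σ σ<2c c⪯σ (initial q σ≼τ i))

  -- If no stronger condition fixed a value `v`, then `restrict` would show that each `v ⋖ a` fails
  -- at almost all nodes of `q`. By `compact` all of them would fail together, against the
  -- hypothesis.
  pigeonhole : ∀ q A a B →
    (∀ {v σ τ} → v ⋖ a → B ⪯ σ → σ ≼ᵐ τ → (pr v σ ∊ A → pr v τ ∊ A) × (pr v τ ∊ A → pr v σ ∊ A)) →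
    Almost q (λ τ → ∃ᴾ λ v → v ⋖ a × pr v τ ∊ A) →
    ∃ᴾ λ v → ∃ᴾ λ r → v ⋖ a × r ≤ᶜ q × Almost r λ τ → pr v τ ∊ A
  pigeonhole q A a B persistent h k =
    pairs (imp (mem ⟨ #0 , #1 ⟩ 0F) bot) [] (A ∷ []) λ N (hN , _) →
    Almost-⊥ {q} (Almost-map {q} (λ τ _ (e , f) → e λ v (l , a) → proj₁ (hN v τ) (f v l) a)
      (Almost-× {q} h (compact q N a B
        (λ {v} {σ} {τ} l g s n → proj₂ (hN v τ) λ x → proj₁ (hN v σ) n (proj₂ (persistent l g s) x))
        (λ v l → λ k′ → comprehension (mem ⟨ #1 , #0 ⟩ 0F) (v ∷ []) (A ∷ []) λ Z hZ →
          restrict q Z B (λ {σ} {τ} g s z → proj₂ (hZ σ) (proj₂ (persistent l g s) (proj₁ (hZ τ) z)))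
            (λ al → Almost-map {q} (λ τ _ f → proj₂ (hN v τ) λ x → f (proj₂ (hZ τ) x)) al k′)
            λ r (r≤q , g) → k v λ k″ → k″ r (l , r≤q , Almost-from {r} B λ τ i l → proj₁ (hZ τ) (g τ i l))))))

  -- Names

  -- A name describes the set of all x such that ⟨ x , τ ⟩ ∈ graph for all
  -- sufficiently long τ on the generic branch; ⟨ x , b ⟩ ∈ modulus certifies
  -- that the answer does not change beyond b.
  record Name : Set where
    field
      graph   : 𝒳
      modulus : 𝒳
      stable  : ∀ {x b σ τ} → pr x b ∊ modulus → b ⪯ σ → σ ≼ᵐ τ →
                (pr x σ ∊ graph → pr x τ ∊ graph) × (pr x τ ∊ graph → pr x σ ∊ graph)
      total   : ∀ x → ∃ᴾ λ b → pr x b ∊ modulus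
  open Name

  _⊩_∊_ : Condition → M → Name → Set
  q ⊩ x ∊ ν = Almost q λ τ → pr x τ ∊ graph ν

  -- Beyond a modulus the nodes denying the membership are closed under initial segments, so
  -- restricting to them gives a condition.
  refute : ∀ {q} ν x → (q ⊩ x ∊ ν → P) →
           ∃ᴾ λ r → r ≤ᶜ q × Almost r λ τ → pr x τ ∊ graph ν → P
  refute {q} ν x h k = total ν x λ B B∊ →
    comprehension (imp (mem ⟨ #1 , #0 ⟩ 0F) bot) (x ∷ []) (graph ν ∷ []) λ Z hZ →
    restrict q Z B (λ {σ} {τ} B⪯σ l z → proj₂ (hZ σ) λ a → proj₁ (hZ τ) z (proj₁ (stable ν B∊ B⪯σ l) a))
      (λ al → h (Almost-map {q} (λ τ _ n → unstab λ f → n (proj₂ (hZ τ) f)) al))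
      λ r (l , g) → k r (l , Almost-from {r} B λ τ i b → proj₁ (hZ τ) (g τ i b))

  ⊩-dense : ∀ {q} ν x → (∀ r → r ≤ᶜ q → (∀ s → s ≤ᶜ r → s ⊩ x ∊ ν → P) → P) → q ⊩ x ∊ ν
  ⊩-dense {q} ν x h = unstab λ k → refute {q} ν x k λ r (l , absent) → h r l λ s m present →
    Almost-⊥ {s} (Almost-map {s} (λ τ _ (f , a) → f a) (Almost-× {s} (Almost-≤ {s} {r} m absent) present))

  open Kripke _≤ᶜ_ id (λ f g x → g (f x)) P
  open Forced

  private
    Ω : Set₁
    Ω = Forced _≤ᶜ_ P

  forcing : Interpretation kripke number
  forcing = record
    { 𝒳        = Name
    ; eq̲       = λ x y → constant (x ≐ y)
    ; lt̲       = λ x y → constant (x ⋖ y)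
    ; mem̲      = λ x ν → record
        { Forces = λ q → q ⊩ x ∊ ν
        ; weaken = λ {w} {w′} l → Almost-≤ {w′} {w} l
        ; dense  = λ {w} → ⊩-dense {w} ν x }
    ; eq-intro = λ p _ → ≋⇒≐ p
    ; eq-elim  = λ {x} {y} {a} {c} f g {w} z → dense c λ w′ l absent →
        ≐-elim (g z) λ p → absent w′ id (weaken c l (f p z))
    ; lt-resp  = λ p r → lt-resp p r
    ; mem-resp = λ {x} {y} {ν} p {w} → Almost-map {w} λ τ _ → ∊-≐ (pr-≐ (≋⇒≐ p) ≐-refl)
    }
    where
    constant : (A : Set) {{_ : Stab A}} → Ω
    constant A = record { Forces = λ _ → A ; weaken = λ _ → id
                        ; dense = λ {w} k → unstab λ absent → k w id λ _ _ → absent }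

  module K = Interpretation forcing
  open Algebra kripke using (_⊑_; _⇛_; _⊓_; _⊔_; ⨅; ⊥̂; ∼_; ⊑-refl; ∼-mono; ⨅-mono; ∼-curry; ∼-uncurry)

  infix 0 _⊨ᴷ_
  _⊨ᴷ_ : Formula n m → Condition × (Fin n → M) × (Fin m → Name) → Set
  φ ⊨ᴷ (q , ρ , δ) = Forces (K.⟦ φ ⟧ ρ δ) q

  Equivalent : Ω → Ω → Set
  Equivalent a b = (a ⊑ b) × (b ⊑ a)

  -- The family A of forcing statements is itself a set of the extension.
  Represented : (M → Ω) → Set
  Represented A = ∃ᴾ λ ν → ∀ x → Equivalent (A x) (K.mem̲ x ν)

  represented-≈ : ∀ {A B} → (∀ x → Equivalent (A x) (B x)) → Represented A → Represented B
  represented-≈ e r k = r λ ν h → k ν λ x →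
    (λ b → proj₁ (h x) (proj₂ (e x) b)) , (λ b → proj₁ (e x) (proj₂ (h x) b))

  ground : ∀ X → ∃ᴾ λ ν → ∀ x {q} → (x ∊ X → q ⊩ x ∊ ν) × (q ⊩ x ∊ ν → x ∊ X)
  ground X k =
    pairs (mem #0 0F) [] (X ∷ []) λ G (hG , _) →
    pairs (eq 𝟎 𝟎) [] [] λ U (hU , _) →
    k (record
        { graph   = G
        ; modulus = U
        ; stable  = λ {x} _ _ _ →
            (λ a → proj₂ (hG x _) (proj₁ (hG x _) a)) , (λ a → proj₂ (hG x _) (proj₁ (hG x _) a))
        ; total   = λ x k → k 𝟘 (proj₂ (hU x 𝟘) ≐-refl) })
      λ x {q} → (λ a → Almost-from {q} 𝟘 λ τ _ _ → proj₂ (hG x τ) a)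
              , (λ a → Almost-const {q} (Almost-map {q} (λ τ _ → proj₁ (hG x τ)) a))

  represented-mem : ∀ {k} (t : Term (suc k)) π ν → Represented λ x → K.mem̲ (val t (x ∷ π)) ν
  represented-mem {k} t π ν K =
    pairs (mem ⟨ t′ , #1 ⟩ 0F) π (graph ν ∷ []) λ G (hG , _) →
    pairs (mem ⟨ t′ , #1 ⟩ 0F) π (modulus ν ∷ []) λ U (hU , _) →
    let to : ∀ x y {X} → pr (val t′ (x ∷ y ∷ π)) y ∊ X → pr (val t (x ∷ π)) y ∊ X
        to x y = ∊-≐ (pr-≐ (≋⇒≐ (value x y)) ≐-refl)
        from : ∀ x y {X} → pr (val t (x ∷ π)) y ∊ X → pr (val t′ (x ∷ y ∷ π)) y ∊ X
        from x y = ∊-≐ (pr-≐ (≐-sym (≋⇒≐ (value x y))) ≐-refl)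
    in K (record
        { graph   = G
        ; modulus = U
        ; stable  = λ {x} {b} {σ} {τ} u l s →
            let f , g = stable ν (to x b (proj₁ (hU x b) u)) l s in
            (λ a → proj₂ (hG x τ) (from x τ (f (to x σ (proj₁ (hG x σ) a))))) ,
            (λ a → proj₂ (hG x σ) (from x σ (g (to x τ (proj₁ (hG x τ) a)))))
        ; total   = λ x k → total ν (val t (x ∷ π)) λ b u → k b (proj₂ (hU x b) (from x b u)) })
      λ x → (λ {q} → Almost-map {q} λ τ _ a → proj₂ (hG x τ) (from x τ a))
          , (λ {q} → Almost-map {q} λ τ _ a → to x τ (proj₁ (hG x τ) a))
    where
    ς : Fin (suc k) → Term (suc (suc k))
    ς = #0 ∷ λ i → var (suc (suc i))
    t′ : Term (suc (suc k))
    t′ = subᵗ ς t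
    value : ∀ x y → val t′ (x ∷ y ∷ π) ≋ val t (x ∷ π)
    value x y = val-sub {σ = ς} (λ { zero → ≋-refl ; (suc i) → ≋-refl }) t

  -- Forcing quantifies over all stronger conditions, but a name needs a property of single nodes.
  -- If the nodewise implication failed unboundedly often, the nodes with a true premise and a false
  -- conclusion would give a condition that forces the premise and refutes the conclusion.
  implication : ∀ {q} ν₁ x₁ ν₂ x₂ → (∀ r → r ≤ᶜ q → r ⊩ x₁ ∊ ν₁ → r ⊩ x₂ ∊ ν₂) →
                Almost q λ τ → pr x₁ τ ∊ graph ν₁ → pr x₂ τ ∊ graph ν₂
  implication {q} ν₁ x₁ ν₂ x₂ h k =
    total ν₁ x₁ λ B₁ u₁ → total ν₂ x₂ λ B₂ u₂ → upper B₁ B₂ λ B (B₁⪯B , B₂⪯B) →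
    comprehension (imp (imp (mem ⟨ #1 , #0 ⟩ 0F) (mem ⟨ #2 , #0 ⟩ 1F)) bot)
      (x₁ ∷ x₂ ∷ []) (graph ν₁ ∷ graph ν₂ ∷ []) λ Z hZ →
    restrict q Z B
      (λ {σ} {τ} l s z → proj₂ (hZ σ) λ i → proj₁ (hZ τ) z λ a →
        proj₁ (stable ν₂ u₂ (⪯-trans B₂⪯B l) s) (i (proj₂ (stable ν₁ u₁ (⪯-trans B₁⪯B l) s) a)))
      (λ al → Almost-map {q} (λ τ _ n a → unstab λ f → n (proj₂ (hZ τ) λ i → f (i a))) al k)
      λ r (l , g) → Almost-⊥ {r} (Almost-map {r} (λ τ _ (z , b) → proj₁ (hZ τ) z (λ _ → b))
        (Almost-× {r} (Almost-from {r} B g)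
          (h r l (Almost-from {r} B λ τ i m → unstab λ f → proj₁ (hZ τ) (g τ i m) λ a → absurd (f a)))))

  private
    both-moduli : ∀ ν₁ ν₂ → ∃ᴾ λ U →
      (∀ x → ∃ᴾ λ b → pr x b ∊ U) ×
      (∀ {x b σ τ} → pr x b ∊ U → b ⪯ σ → σ ≼ᵐ τ →
        ((pr x σ ∊ graph ν₁ → pr x τ ∊ graph ν₁) × (pr x τ ∊ graph ν₁ → pr x σ ∊ graph ν₁)) ×
        ((pr x σ ∊ graph ν₂ → pr x τ ∊ graph ν₂) × (pr x τ ∊ graph ν₂ → pr x σ ∊ graph ν₂)))
    both-moduli ν₁ ν₂ k =
      pairs (and (ex< (S #1) (mem ⟨ #1 , #0 ⟩ 0F)) (ex< (S #1) (mem ⟨ #1 , #0 ⟩ 1F)))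
        [] (modulus ν₁ ∷ modulus ν₂ ∷ []) λ U (hU , _) →
      k U ( (λ x k → total ν₁ x λ b₁ u₁ → total ν₂ x λ b₂ u₂ → upper b₁ b₂ λ b (l₁ , l₂) →
              k b (proj₂ (hU x b) ((λ k → k b₁ (l₁ , u₁)) , (λ k → k b₂ (l₂ , u₂)))))
          , (λ {x} {b} u l s → let e₁ , e₂ = proj₁ (hU x b) u in
              given e₁ (λ b₁ (l₁ , u₁) → stable ν₁ u₁ (⪯-trans l₁ l) s) ,
              given e₂ (λ b₂ (l₂ , u₂) → stable ν₂ u₂ (⪯-trans l₂ l) s)))

  represented-⇛ : ∀ {A B} → Represented A → Represented B → Represented λ x → A x ⇛ B x
  represented-⇛ {A} {B} r₁ r₂ k = r₁ λ ν₁ h₁ → r₂ λ ν₂ h₂ → both-moduli ν₁ ν₂ λ U (tot , stb) →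
    pairs (imp (mem ⟨ #0 , #1 ⟩ 0F) (mem ⟨ #0 , #1 ⟩ 1F)) [] (graph ν₁ ∷ graph ν₂ ∷ []) λ G (hG , _) →
    k (record
        { graph   = G
        ; modulus = U
        ; stable  = λ {x} {b} {σ} {τ} u l s → let (f₁ , g₁) , (f₂ , g₂) = stb u l s in
            (λ i → proj₂ (hG x τ) λ a → f₂ (proj₁ (hG x σ) i (g₁ a))) ,
            (λ i → proj₂ (hG x σ) λ a → g₂ (proj₁ (hG x τ) i (f₁ a)))
        ; total   = tot })
      λ x → (λ {q} i → Almost-map {q} (λ τ _ → proj₂ (hG x τ))
              (implication {q} ν₁ x ν₂ x λ r l a → proj₁ (h₂ x) {r} (i r l (proj₂ (h₁ x) {r} a))))
          , (λ {q} i r l a → proj₂ (h₂ x) {r} (Almost-map {r} (λ τ _ (f , b) → proj₁ (hG x τ) f b)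
              (Almost-× {r} (Almost-≤ {r} {q} l i) (proj₁ (h₁ x) {r} a))))

  represented-⊓ : ∀ {A B} → Represented A → Represented B → Represented λ x → A x ⊓ B x
  represented-⊓ {A} {B} r₁ r₂ k = r₁ λ ν₁ h₁ → r₂ λ ν₂ h₂ → both-moduli ν₁ ν₂ λ U (tot , stb) →
    pairs (and (mem ⟨ #0 , #1 ⟩ 0F) (mem ⟨ #0 , #1 ⟩ 1F)) [] (graph ν₁ ∷ graph ν₂ ∷ []) λ G (hG , _) →
    k (record
        { graph   = G
        ; modulus = U
        ; stable  = λ {x} {b} {σ} {τ} u l s → let (f₁ , g₁) , (f₂ , g₂) = stb u l s in
            (λ i → let a , b = proj₁ (hG x σ) i in proj₂ (hG x τ) (f₁ a , f₂ b)) ,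
            (λ i → let a , b = proj₁ (hG x τ) i in proj₂ (hG x σ) (g₁ a , g₂ b))
        ; total   = tot })
      λ x → (λ {q} (a , b) → Almost-map {q} (λ τ _ → proj₂ (hG x τ))
              (Almost-× {q} (proj₁ (h₁ x) {q} a) (proj₁ (h₂ x) {q} b)))
          , (λ {q} i → proj₂ (h₁ x) {q} (Almost-map {q} (λ τ _ a → proj₁ (proj₁ (hG x τ) a)) i) ,
                       proj₂ (h₂ x) {q} (Almost-map {q} (λ τ _ a → proj₂ (proj₁ (hG x τ) a)) i))

  represented-ground : ∀ {φ : Formula (suc n) m} → Δ₀⁰ φ → ∀ ρ δ {A} →
    (∀ x {q} → (Forces (A x) q → φ ⊨ (x ∷ ρ , δ)) × (φ ⊨ (x ∷ ρ , δ) → Forces (A x) q)) → Represented A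
  represented-ground d ρ δ e k = comprehension d ρ δ λ X hX → ground X λ ν h → k ν λ x →
    (λ {q} a → proj₁ (h x {q}) (proj₂ (hX x) (proj₁ (e x) a))) ,
    (λ {q} a → proj₂ (e x) (proj₁ (hX x) (proj₂ (h x {q}) a)))

  represented-⊥ : Represented λ _ → ⊥̂
  represented-⊥ = represented-ground (bot {m = 0}) [] [] {λ _ → ⊥̂} λ _ → id , id

  -- The bound is the first component of x so that terms with parameters need
  -- only be treated in represented-mem.
  represented-∀< : ∀ ν → Represented λ x → ⨅ λ y → K.lt̲ y (h̲ x) ⇛ K.mem̲ (pr y (t̲ x)) ν
  represented-∀< ν k =
    pairs (all< (H #0) (mem ⟨ ⟨ #0 , T #1 ⟩ , #2 ⟩ 0F)) [] (graph ν ∷ []) λ G (hG , _) →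
    pairs (all< (H #0) (ex< (S #2) (mem ⟨ ⟨ #1 , T #2 ⟩ , #0 ⟩ 0F))) [] (modulus ν ∷ []) λ U (hU , _) →
    let tot : ∀ x → ∃ᴾ λ b → pr x b ∊ U
        -- A modulus for the quantified statement must bound moduli for all instances below `h̲ x`,
        -- and it exists by collection.
        tot x k = Δ-collection (mem ⟨ ⟨ #0 , T #2 ⟩ , #1 ⟩ 0F) (x ∷ []) (modulus ν ∷ []) (h̲ x)
          (λ y _ → total ν (pr y (t̲ x)))
          λ b f → k b (proj₂ (hU x b) λ y l k → f y l λ b′ (b′<b , u) → k b′ (⋖⇒⪯ b′<b , u))
        stb : ∀ {x b σ τ} → pr x b ∊ U → b ⪯ σ → σ ≼ᵐ τ → ∀ {y} → y ⋖ h̲ x →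
              (pr (pr y (t̲ x)) σ ∊ graph ν → pr (pr y (t̲ x)) τ ∊ graph ν) ×
              (pr (pr y (t̲ x)) τ ∊ graph ν → pr (pr y (t̲ x)) σ ∊ graph ν)
        stb {x} {b} u l s {y} y< = given (proj₁ (hU x b) u y y<) λ b′ (b′⪯b , u′) →
          stable ν u′ (⪯-trans b′⪯b l) s
    in k (record
        { graph   = G
        ; modulus = U
        ; stable  = λ {x} {b} {σ} {τ} u l s →
            (λ a → proj₂ (hG x τ) λ y y< → proj₁ (stb u l s y<) (proj₁ (hG x σ) a y y<)) ,
            (λ a → proj₂ (hG x σ) λ y y< → proj₂ (stb u l s y<) (proj₁ (hG x τ) a y y<))
        ; total   = tot })
      λ x → (λ {q} h k → tot x λ B u →
               pairs (mem ⟨ ⟨ #0 , #2 ⟩ , #1 ⟩ 0F) (t̲ x ∷ []) (graph ν ∷ []) λ A (hA , _) →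
               Almost-map {q} (λ τ _ f → proj₂ (hG x τ) λ y l → proj₁ (hA y τ) (f y l))
                 (compact q A (h̲ x) B
                   (λ {y} {σ} {τ} y< l s a → proj₂ (hA y τ) (proj₁ (stb u l s y<) (proj₁ (hA y σ) a)))
                   (λ y l → Almost-map {q} (λ τ _ → proj₂ (hA y τ)) (h y q id l))) k)
          , (λ {q} h y r l y< → Almost-map {r} (λ τ _ a → proj₁ (hG x τ) a y y<) (Almost-≤ {r} {q} l h))

  represented-∼ : ∀ {A} → Represented A → Represented λ x → ∼ A x
  represented-∼ {A} r = represented-⇛ {A} {λ _ → ⊥̂} r represented-⊥

  -- Packing an environment into one number makes the names for subformulas uniform in their
  -- parameters. The quantifier case lengthens the environment, and the family is still indexed by a
  -- single number.
  decode : ∀ n → M → Fin n → M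
  decode (suc n) x zero    = h̲ x
  decode (suc n) x (suc i) = decode n (t̲ x) i

  encode : ∀ n → (Fin n → M) → M
  encode zero    ρ = 𝟘
  encode (suc n) ρ = pr (ρ zero) (encode n (ρ ∘ suc))

  decode-≐ : ∀ n {x y} → x ≐ y → ∀ i → decode n x i ≐ decode n y i
  decode-≐ (suc n) e zero    = h-≐ e
  decode-≐ (suc n) e (suc i) = decode-≐ n (t-≐ e) i

  decode-∷ : ∀ n x y i → decode (suc n) (pr x y) i ≐ (x ∷ decode n y) i
  decode-∷ n x y zero    = h-pr
  decode-∷ n x y (suc i) = decode-≐ n t-pr i

  decode-encode : ∀ n ρ i → decode n (encode n ρ) i ≐ ρ i
  decode-encode (suc n) ρ zero    = h-pr
  decode-encode (suc n) ρ (suc i) = ≐-trans (decode-≐ n t-pr i) (decode-encode n (ρ ∘ suc) i)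

  component : ∀ n → Term 1 → Fin n → Term 1
  component (suc n) t zero    = H t
  component (suc n) t (suc i) = component n (T t) i

  val-component : ∀ n t ρ i → val (component n t i) ρ ≡ decode n (val t ρ) i
  val-component (suc n) t ρ zero    = refl
  val-component (suc n) t ρ (suc i) = val-component n (T t) ρ i

  ⊨ᴷ-≐ : ∀ (φ : Formula n m) {q ρ ρ′ δ} → (∀ i → ρ i ≐ ρ′ i) → φ ⊨ᴷ (q , ρ , δ) → φ ⊨ᴷ (q , ρ′ , δ)
  ⊨ᴷ-≐ φ {q} {ρ} {ρ′} {δ} e a = dense (K.⟦ φ ⟧ ρ′ δ) λ r l absent →
    choose {F = λ i (_ : ⊤) → ρ i ≋ ρ′ i} (λ i k → ≐-elim (e i) (k tt)) λ _ p →
      absent r id (weaken (K.⟦ φ ⟧ ρ′ δ) {q} {r} l (K.⟦⟧-cong p (λ _ → refl) φ {q} a))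

  represented-decode : ∀ {φ : Formula n m} → Δ₀⁰ φ → ∀ δ → Represented λ x → K.⟦ φ ⟧ (decode n x) δ
  represented-decode {n} {m} {φ} d δ = go d
    where
    coded : Term n → Term 1
    coded = subᵗ (component n #0)
    val-coded : ∀ t x → val (coded t) (x ∷ []) ≋ val t (decode n x)
    val-coded t x = val-sub (λ i → subst (_≋ decode n x i) (sym (val-component n #0 (x ∷ []) i)) ≋-refl) t
    to : ∀ {x} t → val (coded t) (x ∷ []) ≐ val t (decode n x)
    to {x} t = ≋⇒≐ (val-coded t x)
    from : ∀ {x} t → val t (decode n x) ≐ val (coded t) (x ∷ [])
    from {x} t = ≐-sym (to t)
    bounded : ∀ t (ψ : Formula (suc n) m) → Represented (λ x → K.⟦ ψ ⟧ (decode (suc n) x) δ) →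
              Represented λ x → K.⟦ ∀< t ψ ⟧ (decode n x) δ
    bounded t ψ r k = r λ ν h → represented-∀< ν λ ν′ h′ →
      -- Substituting the pair of `t` and the environment makes the first component, which serves as
      -- the bound, equal to the value of `t`.
      represented-mem ⟨ coded t , #0 ⟩ [] ν′ λ ν″ h″ → k ν″ λ x →
      (λ {q} a → proj₁ (h″ x) {q} (proj₁ (h′ _) {q} λ y r l y< → proj₁ (h _) {r}
         (⊨ᴷ-≐ ψ (λ i → ≐-sym (≐-trans (decode-≐ (suc n) (pr-≐ ≐-refl t-pr) i) (decode-∷ n y x i)))
           (a y r l (⋖-≐ ≐-refl (≐-trans h-pr (≐-trans (to t) (≐-sym (≋⇒≐ (val-wk t))))) y<)))))
      , (λ {q} a y r l y< → ⊨ᴷ-≐ ψ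
           (λ i → ≐-trans (decode-≐ (suc n) (pr-≐ ≐-refl t-pr) i) (decode-∷ n y x i))
           (proj₂ (h _) {r} (proj₂ (h′ _) {q} (proj₂ (h″ x) {q} a) y r l
             (⋖-≐ ≐-refl (≐-sym (≐-trans h-pr (≐-trans (to t) (≐-sym (≋⇒≐ (val-wk t)))))) y<))))
    go : ∀ {φ} → Δ₀⁰ φ → Represented λ x → K.⟦ φ ⟧ (decode n x) δ
    go (eq s t) = represented-ground (eq {m = 0} (coded s) (coded t)) [] [] {λ x → K.⟦ s ≈ t ⟧ (decode n x) δ} λ x →
      (λ e → ≐-trans (to s) (≐-trans e (from t))) , (λ e → ≐-trans (from s) (≐-trans e (to t)))
    go (less s t) = represented-ground (less {m = 0} (coded s) (coded t)) [] [] {λ x → K.⟦ s < t ⟧ (decode n x) δ} λ x →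
      ⋖-≐ (from s) (from t) , ⋖-≐ (to s) (to t)
    go (mem t X) = represented-≈ {λ x → K.mem̲ (val (coded t) (x ∷ [])) (δ X)} {λ x → K.⟦ t ∈ X ⟧ (decode n x) δ}
      (λ x → (λ {q} → K.mem-resp {X = δ X} (val-coded t x) {q}) , (λ {q} → K.mem-resp {X = δ X} (≋-sym (val-coded t x)) {q}))
      (represented-mem (coded t) [] (δ X))
    go bot = represented-⊥
    go (and {φ = φ} {ψ} c d) = represented-⊓ {λ x → K.⟦ φ ⟧ (decode n x) δ} {λ x → K.⟦ ψ ⟧ (decode n x) δ} (go c) (go d)
    go (imp {φ = φ} {ψ} c d) = represented-⇛ {λ x → K.⟦ φ ⟧ (decode n x) δ} {λ x → K.⟦ ψ ⟧ (decode n x) δ} (go c) (go d)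
    go (or {φ = φ} {ψ} c d) =
      represented-∼ {λ x → ∼ K.⟦ φ ⟧ (decode n x) δ ⊓ ∼ K.⟦ ψ ⟧ (decode n x) δ}
        (represented-⊓ {λ x → ∼ K.⟦ φ ⟧ (decode n x) δ} {λ x → ∼ K.⟦ ψ ⟧ (decode n x) δ}
          (represented-∼ {λ x → K.⟦ φ ⟧ (decode n x) δ} (go c))
          (represented-∼ {λ x → K.⟦ ψ ⟧ (decode n x) δ} (go d)))
    go (all< t {φ = φ} d) = bounded t φ (represented-decode d δ)
    -- Existence is by definition a negated universal statement; currying turns the negated
    -- conjunction into the bounded form already treated.
    go (ex< t {φ = φ} d) =
      represented-≈ {λ x → ∼ K.⟦ ∀< t (¬′ φ) ⟧ (decode n x) δ} {λ x → K.⟦ ∃< t φ ⟧ (decode n x) δ}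
        (λ x → (λ {q} → ∼-mono {⨅ λ y → ∼ (K.⟦ #0 < wkᵗ t ∧ φ ⟧ (y ∷ decode n x) δ)}
                               {K.⟦ ∀< t (¬′ φ) ⟧ (decode n x) δ}
                  (λ {q} a y → ∼-curry {K.⟦ #0 < wkᵗ t ⟧ (y ∷ decode n x) δ} {K.⟦ φ ⟧ (y ∷ decode n x) δ} {q} (a y)) {q})
             , (λ {q} → ∼-mono {K.⟦ ∀< t (¬′ φ) ⟧ (decode n x) δ}
                               {⨅ λ y → ∼ (K.⟦ #0 < wkᵗ t ∧ φ ⟧ (y ∷ decode n x) δ)}
                  (λ {q} a y → ∼-uncurry {K.⟦ #0 < wkᵗ t ⟧ (y ∷ decode n x) δ} {K.⟦ φ ⟧ (y ∷ decode n x) δ} {q} (a y)) {q}))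
        (represented-∼ {λ x → K.⟦ ∀< t (¬′ φ) ⟧ (decode n x) δ}
          (bounded t (¬′ φ) (represented-∼ {λ x → K.⟦ φ ⟧ (decode (suc n) x) δ} (represented-decode d δ))))

  represented : ∀ {φ : Formula (suc n) m} → Δ₀⁰ φ → ∀ ρ δ → Represented λ x → K.⟦ φ ⟧ (x ∷ ρ) δ
  represented {n} {φ = φ} d ρ δ k = represented-decode d δ λ ν h →
    represented-mem ⟨ #0 , #1 ⟩ (encode n ρ ∷ []) ν λ ν′ h′ → k ν′ λ x →
    let e : ∀ i → decode (suc n) (pr x (encode n ρ)) i ≐ (x ∷ ρ) i
        e = λ { zero → h-pr ; (suc i) → decode-encode (suc n) (x ∷ ρ) (suc i) }
    in (λ {q} a → proj₁ (h′ x) {q} (proj₁ (h _) {q} (⊨ᴷ-≐ φ (λ i → ≐-sym (e i)) a)))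
     , (λ {q} a → ⊨ᴷ-≐ φ e (proj₂ (h _) {q} (proj₂ (h′ x) {q} a)))

  ⊩-≐ : ∀ {q x y} ν → x ≐ y → q ⊩ x ∊ ν → q ⊩ y ∊ ν
  ⊩-≐ {q} ν e = Almost-map {q} λ τ _ → ∊-≐ (pr-≐ e ≐-refl)

  -- The axioms of RCA₀⁻ are forced

  comprehension-forced : ∀ {φ : Formula (suc n) m} → Δ₀⁰ φ → ∀ q ρ δ →
                         ∃ˢ (∀ⁿ (#0 ∈ 0F ⇔ wkˢ φ)) ⊨ᴷ (q , ρ , δ)
  comprehension-forced {φ = φ} d q ρ δ r l absent = represented d ρ δ λ ν h → absent ν r id λ x →
    let to , from = K.⟦⟧-sub {σ = var} {q = suc} {δ′ = ν ∷ δ} {δ = δ} (λ _ → ≋-refl) (λ _ → refl) φ in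
    (λ s _ a → from {s} (proj₂ (h x) {s} a)) , (λ s _ a → proj₁ (h x) {s} (to {s} a))

  -- Each induction step becomes a nodewise implication, and `compact` makes those up to `x` true
  -- together at almost all nodes. At one such node, induction in the ground model gives the
  -- conclusion.
  induction-forced : ∀ ν x q → (𝟎 ∈ 0F ∧ ∀ⁿ (#0 ∈ 0F ⇒ S #0 ∈ 0F) ⊨ᴷ (q , x ∷ [] , ν ∷ [])) → q ⊩ x ∊ ν
  induction-forced ν x q (z , step) k =
    pairs (imp (mem ⟨ #0 , #1 ⟩ 0F) (mem ⟨ S #0 , #1 ⟩ 0F)) [] (graph ν ∷ []) λ A (hA , _) →
    -- The step at `y ⪯ x` also involves the modulus at `s̲ y`, so arguments up to `s̲ x` are
    -- needed.
    Δ-collection (mem ⟨ #0 , #1 ⟩ 0F) [] (modulus ν ∷ []) (s̲ (s̲ x)) (λ y _ → total ν y) λ B bounded →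
    Almost-map {q} (λ τ _ (z , a) → Δ-induction (imp (less #0 (S #1)) (mem ⟨ #0 , #2 ⟩ 0F))
        {x ∷ τ ∷ []} {graph ν ∷ []} (λ _ → z)
        (λ y ih l → proj₁ (hA y τ) (a y (⋖-trans n⋖s l)) (ih (⋖-trans n⋖s l))) x n⋖s)
      (Almost-× {q} z (compact q A (s̲ x) B
        (λ {y} {σ} {τ} l B⪯σ s a → proj₂ (hA y τ) λ n →
          given (bounded y (⋖⇒⪯ l)) λ b (b<B , u) → given (bounded (s̲ y) (⋖⇒s⪯ l)) λ c (c<B , v) →
          proj₁ (stable ν v (⪯-trans (⋖⇒⪯ c<B) B⪯σ) s)
            (proj₁ (hA y σ) a (proj₂ (stable ν u (⪯-trans (⋖⇒⪯ b<B) B⪯σ) s) n)))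
        (λ y _ → Almost-map {q} (λ τ _ → proj₂ (hA y τ)) (implication {q} ν y ν (s̲ y) (step y))))) k

  -- The value selected at x is read off at the first level at which every node
  -- of the tree exhibits one.
  module Selection (w : Condition) (ν : Name)
    (values : ∀ x q → q ≤ᶜ w → ∃ᴾ λ v → ∃ᴾ λ r → r ≤ᶜ q × r ⊩ pr x v ∊ ν) where

    -- Asking for a modulus below the node makes the answer final, so that it persists to all longer
    -- nodes.
    Shown : M → M → Set
    Shown u σ = (∃ᴾ λ b → b ⪯ σ × pr u b ∊ modulus ν) × pr u σ ∊ graph ν

    module _ (V : 𝒳) (hV : V encodes Shown) where

      Good : M → M → Set
      Good x b = 𝟘 ⋖ b × ∀ σ → σ ⋖ 2* b → b ⪯ σ → σ ∊ tree w → ∃ᴾ λ v → v ⋖ σ × pr (pr x v) σ ∊ V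

      Seen : M → M → M → M → Set
      Seen x b v τ = ∃ᴾ λ σ → σ ⪯ τ × pr σ τ ∊ PR × b ⪯ σ × σ ⋖ 2* b × v ⋖ σ × pr (pr x v) σ ∊ V

      shown-up : ∀ {u σ τ} → σ ≼ᵐ τ → pr u σ ∊ V → pr u τ ∊ V
      shown-up {u} {σ} {τ} l a =
        let e , n = proj₁ (hV u σ) a in proj₂ (hV u τ)
          ( (λ k → e λ b (b⪯σ , m) → k b (⪯-trans b⪯σ (≼⇒⪯ l) , m))
          , given e λ b (b⪯σ , m) → proj₁ (stable ν m b⪯σ l) n)

      seen-set : ∀ x b → ∃ᴾ λ A → A encodes Seen x b × (𝟘 ∊ A → P)
      seen-set x b = pairs (ex< (S #1) (and (mem ⟨ #0 , #2 ⟩ 0F)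
        (and (less (var 4F) (S #0)) (and (less #0 (𝟐 · var 4F))
        (and (less #1 #0) (mem ⟨ ⟨ #3 , #1 ⟩ , #0 ⟩ 1F)))))) (x ∷ b ∷ []) (PR ∷ V ∷ [])

      seen⇒∊ : ∀ {x b v τ} → Seen x b v τ → pr (pr x v) τ ∊ graph ν
      seen⇒∊ e = given e λ σ (_ , p , _ , _ , _ , m) →
        proj₂ (proj₁ (hV _ _) (shown-up (proj₁ (PR-def _ _) p) m))

      seen-stable : ∀ {x b v σ τ} → 2* b ⪯ σ → σ ≼ᵐ τ →
                    (Seen x b v σ → Seen x b v τ) × (Seen x b v τ → Seen x b v σ)
      seen-stable {σ = σ} {τ} 2b⪯σ σ≼τ =
        (λ e k → e λ σ₁ (l , p , rest) →
          k σ₁ (⪯-trans l (≼⇒⪯ σ≼τ) , proj₂ (PR-def σ₁ τ) (≼-trans (proj₁ (PR-def σ₁ σ) p) σ≼τ) , rest)) ,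
        (λ e k → e λ σ₁ (_ , p , b⪯σ₁ , σ₁<2b , rest) →
          let l = ⋖⇒⪯ (⋖-⪯-trans σ₁<2b 2b⪯σ) in
          k σ₁ (l , proj₂ (PR-def σ₁ σ) (≼-⪯ (proj₁ (PR-def σ₁ τ) p) σ≼τ l) , b⪯σ₁ , σ₁<2b , rest))

      -- Otherwise the nodes showing no value form an infinite subtree `q`. By `values` some
      -- condition below `q` forces a value, and its nodes longer than the value and a modulus do
      -- show it.
      eventually-shown : ∀ x → Almost w λ σ → ∃ᴾ λ v → v ⋖ σ × pr (pr x v) σ ∊ V
      eventually-shown x k =
        comprehension (imp (ex< #0 (mem ⟨ ⟨ #2 , #0 ⟩ , #1 ⟩ 0F)) bot) (x ∷ []) (V ∷ []) λ Z hZ →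
        restrict w Z 𝟘
          (λ {σ} {τ} _ l z → proj₂ (hZ σ) λ e → e λ v (v<σ , a) →
            proj₁ (hZ τ) z λ k → k v (⋖-⪯-trans v<σ (≼⇒⪯ l) , shown-up l a))
          (λ al → Almost-map {w} (λ τ _ n e → n (proj₂ (hZ τ) λ g → g e)) al k)
          λ q (q≤w , none) → values x q q≤w λ v e → e λ r (r≤q , a) → total ν (pr x v) λ b m →
          a λ c f → upper b c λ d (b⪯d , c⪯d) → upper d (s̲ v) λ d′ (d⪯d′ , sv⪯d′) →
          unbounded r d′ λ τ (i , d′⪯τ) →
            proj₁ (hZ τ) (none τ (r≤q i) 0⪯) λ k → k v
              ( s⪯⇒⋖ (⪯-trans sv⪯d′ d′⪯τ)
              , proj₂ (hV (pr x v) τ)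
                  ( (λ k → k b (⪯-trans b⪯d (⪯-trans d⪯d′ d′⪯τ) , m))
                  , f τ i (⪯-trans c⪯d (⪯-trans d⪯d′ d′⪯τ))))

      module _ (L : 𝒳) (hL : L encodes Good) where

        First : M → M → Set
        First x b = pr x b ∊ L × ∀ b′ → b′ ⋖ b → pr x b′ ∊ L → P

        first-exists : ∀ x → ∃ᴾ (First x)
        first-exists x k = eventually-shown x λ b f →
          comprehension (mem ⟨ #1 , #0 ⟩ 0F) (x ∷ []) (L ∷ []) λ Y hY →
          least Y (proj₂ (hY (s̲ b)) (proj₂ (hL x (s̲ b)) (0⪯ , λ σ _ b⪯σ i → f σ i (⋖⇒⪯ (s⪯⇒⋖ b⪯σ)))))
            λ c (c∊ , below) → k c (proj₁ (hY c) c∊ , λ b′ l a → below b′ l (proj₂ (hY b′) a))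

        first-unique : ∀ {x b b′} → First x b → First x b′ → b ≐ b′
        first-unique {x} {b} {b′} (a , f) (a′ , f′) =
          compare b b′ (λ b<b′ → absurd (f′ b b<b′ a)) id (λ b′<b → absurd (f b′ b′<b a′))

        module _ (LL : 𝒳) (hLL : LL encodes First) where

          unique : ∀ {x b b′} → pr x b ∊ LL → pr x b′ ∊ LL → b ≐ b′
          unique l l′ = first-unique (proj₁ (hLL _ _) l) (proj₁ (hLL _ _) l′)

          -- `u` is a pair of an argument and a result, and of the value `v` seen at the argument
          -- only `T v` is kept. A node may show several `v`, and no choice is made among them: the
          -- composite is single-valued because the composed functions are.
          Selects : M → M → Set
          Selects u τ = 𝟘 ⋖ u × ∃ᴾ λ b → b ⪯ τ × pr (h̲ u) b ∊ LL ×
            ∃ᴾ λ σ → σ ⪯ τ × pr σ τ ∊ PR × b ⪯ σ × σ ⋖ 2* b ×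
            ∃ᴾ λ v → v ⋖ σ × pr (pr (h̲ u) v) σ ∊ V × t̲ v ≐ t̲ u

          Settled : M → M → Set
          Settled u c = ∃ᴾ λ b → b ⪯ c × pr (h̲ u) b ∊ LL × 2* b ⪯ c

          selects-stable : ∀ {u c σ τ} → Settled u c → c ⪯ σ → σ ≼ᵐ τ →
                           (Selects u σ → Selects u τ) × (Selects u τ → Selects u σ)
          selects-stable {u} {c} {σ} {τ} settled c⪯σ σ≼τ =
            (λ (pos , e) → pos , λ k → e λ b (b⪯σ , l , e) →
              k b (⪯-trans b⪯σ (≼⇒⪯ σ≼τ) , l , λ k → e λ σ₁ (σ₁⪯σ , p , rest) →
                k σ₁ (⪯-trans σ₁⪯σ (≼⇒⪯ σ≼τ) , proj₂ (PR-def σ₁ τ) (≼-trans (proj₁ (PR-def σ₁ σ) p) σ≼τ) , rest))) ,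
            (λ (pos , e) → pos , λ k → e λ b (b⪯τ , l , e) →
              e λ σ₁ (σ₁⪯τ , p , b⪯σ₁ , σ₁<2b , rest) → settled λ b′ (_ , l′ , 2b′⪯c) →
              let σ₁⪯σ = ⋖⇒⪯ (⋖-⪯-trans (⋖-≐ ≐-refl (2*-≐ (unique l l′)) σ₁<2b) (⪯-trans 2b′⪯c c⪯σ)) in
              k b (⪯-trans b⪯σ₁ σ₁⪯σ , l , λ k → k σ₁
                (σ₁⪯σ , proj₂ (PR-def σ₁ σ) (≼-⪯ (proj₁ (PR-def σ₁ τ) p) σ≼τ σ₁⪯σ) , b⪯σ₁ , σ₁<2b , rest)))

          selects⇒seen : ∀ {x b y τ} → pr x b ∊ LL → Selects (pr x y) τ →
                         ∃ᴾ λ v → v ⋖ 2* b × Seen x b v τ × t̲ v ≐ y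
          selects⇒seen l (_ , e) k = e λ b′ (_ , l′ , e) →
            e λ σ (σ⪯τ , p , b′⪯σ , σ<2b′ , e) → e λ v (v<σ , m , t) →
            let b′≐b = unique (∊-≐ (pr-≐ h-pr ≐-refl) l′) l
                σ<2b = ⋖-≐ ≐-refl (2*-≐ b′≐b) σ<2b′
            in k v
              ( ⋖-trans v<σ σ<2b
              , (λ k → k σ (σ⪯τ , p , ⋖-≐ b′≐b ≐-refl b′⪯σ , σ<2b , v<σ , ∊-≐ (pr-≐ (pr-≐ h-pr ≐-refl) ≐-refl) m))
              , ≐-trans t t-pr)

          seen⇒selects : ∀ {x b v τ} → pr x b ∊ LL → Seen x b v τ → Selects (pr x (t̲ v)) τ
          seen⇒selects {x} {b} {v} l e = 0⋖pr , λ k → e λ σ (σ⪯τ , p , b⪯σ , σ<2b , v<σ , m) → k b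
            ( ⪯-trans b⪯σ σ⪯τ , ∊-≐ (pr-≐ (≐-sym h-pr) ≐-refl) l , λ k → k σ
              ( σ⪯τ , p , b⪯σ , σ<2b , λ k → k v
                (v<σ , ∊-≐ (pr-≐ (pr-≐ (≐-sym h-pr) ≐-refl) ≐-refl) m , ≐-sym t-pr)))

          module _ (N : 𝒳) (hN : N encodes Selects) (U : 𝒳) (hU : U encodes Settled) where

            selected : Name
            selected = record
              { graph   = N
              ; modulus = U
              ; stable  = λ {u} {c} {σ} {τ} u∊ c⪯σ σ≼τ →
                  let f , g = selects-stable (proj₁ (hU u c) u∊) c⪯σ σ≼τ in
                  (λ a → proj₂ (hN u τ) (f (proj₁ (hN u σ) a))) , (λ a → proj₂ (hN u σ) (g (proj₁ (hN u τ) a)))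
              ; total   = λ u k → first-exists (h̲ u) λ b l → k (2* b)
                  (proj₂ (hU u (2* b)) λ k → k b (⪯-2* , proj₂ (hLL (h̲ u) b) l , ⪯-refl))
              }

            -- The value seen may vary with the node, but it is below `2* b`, so `pigeonhole` fixes
            -- one on a stronger condition.
            selected-value : ∀ {q} → q ≤ᶜ w → ∀ x y → q ⊩ pr x y ∊ selected →
                             ∃ᴾ λ v → ∃ᴾ λ r → r ≤ᶜ q × r ⊩ pr x v ∊ ν × t̲ v ≐ y
            selected-value {q} q≤w x y a k = first-exists x λ b first →
              let l = proj₂ (hLL x b) first in
              seen-set x b λ A (hA , _) →
              pairs (and (mem ⟨ #0 , #1 ⟩ 0F) (eq (T #0) #2)) (y ∷ []) (A ∷ []) λ C (hC , _) →
              pigeonhole q C (2* b) (2* b)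
                (λ {v} {σ} {τ} _ g s → let f₁ , f₂ = seen-stable g s in
                  (λ c → let a , t = proj₁ (hC v σ) c in proj₂ (hC v τ) (proj₂ (hA v τ) (f₁ (proj₁ (hA v σ) a)) , t)) ,
                  (λ c → let a , t = proj₁ (hC v τ) c in proj₂ (hC v σ) (proj₂ (hA v σ) (f₂ (proj₁ (hA v τ) a)) , t)))
                (Almost-map {q} (λ τ _ a k → selects⇒seen l (proj₁ (hN (pr x y) τ) a) λ v (v<2b , e , t) →
                  k v (v<2b , proj₂ (hC v τ) (proj₂ (hA v τ) e , t))) a)
                λ v e → e λ r (_ , r≤q , c) → k v λ k → k r
                  ( r≤q
                  , Almost-map {r} (λ τ _ c → seen⇒∊ (proj₁ (hA v τ) (proj₁ (proj₁ (hC v τ) c)))) c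
                  , Almost-const {r} (Almost-map {r} (λ τ _ c → proj₂ (proj₁ (hC v τ) c)) c))

            selected-total : ∀ {q} → q ≤ᶜ w → ∀ x →
                             ∃ᴾ λ v → ∃ᴾ λ r → r ≤ᶜ q × r ⊩ pr x v ∊ ν × r ⊩ pr x (t̲ v) ∊ selected
            selected-total {q} q≤w x k = first-exists x λ b first →
              let l = proj₂ (hLL x b) first ; 0<b , good = proj₁ (hL x b) (proj₁ first) in
              seen-set x b λ A (hA , _) →
              pigeonhole q A (2* b) (2* b)
                (λ {v} {σ} {τ} _ g s → let f₁ , f₂ = seen-stable g s in
                  (λ a → proj₂ (hA v τ) (f₁ (proj₁ (hA v σ) a))) , (λ a → proj₂ (hA v σ) (f₂ (proj₁ (hA v τ) a))))
                (Almost-from {q} b λ τ i b⪯τ k → level 0<b b⪯τ λ σ (p , b⪯σ , σ<2b) →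
                  good σ σ<2b b⪯σ (initial w p (q≤w i)) λ v (v<σ , m) → k v (⋖-trans v<σ σ<2b , proj₂ (hA v τ)
                    λ k → k σ (≼⇒⪯ p , proj₂ (PR-def σ τ) p , b⪯σ , σ<2b , v<σ , m)))
                λ v e → e λ r (_ , r≤q , a) → k v λ k → k r
                  ( r≤q
                  , Almost-map {r} (λ τ _ a → seen⇒∊ (proj₁ (hA v τ) a)) a
                  , Almost-map {r} (λ τ _ a → proj₂ (hN _ τ) (seen⇒selects l (proj₁ (hA v τ) a))) a)

            0∉selected : ∀ {q} → q ⊩ 𝟘 ∊ selected → P
            0∉selected {q} a = Almost-⊥ {q} (Almost-map {q} (λ τ _ a → ⋖0 (proj₁ (proj₁ (hN 𝟘 τ) a))) a)

    selection : ∃ᴾ λ f → ∀ q → q ≤ᶜ w →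
      (∀ x y → q ⊩ pr x y ∊ f → ∃ᴾ λ v → ∃ᴾ λ r → r ≤ᶜ q × r ⊩ pr x v ∊ ν × t̲ v ≐ y) ×
      (∀ x → ∃ᴾ λ v → ∃ᴾ λ r → r ≤ᶜ q × r ⊩ pr x v ∊ ν × r ⊩ pr x (t̲ v) ∊ f) ×
      (q ⊩ 𝟘 ∊ f → P)
    selection k =
      pairs (and (ex< (S #1) (mem ⟨ #1 , #0 ⟩ 0F)) (mem ⟨ #0 , #1 ⟩ 1F)) []
        (modulus ν ∷ graph ν ∷ []) λ V (hV , _) →
      pairs (and (less 𝟎 #1) (all< (𝟐 · #1) (imp (less #2 (S #0)) (imp (mem #0 0F)
        (ex< #0 (mem ⟨ ⟨ #2 , #0 ⟩ , #1 ⟩ 1F)))))) [] (tree w ∷ V ∷ []) λ L (hL , _) →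
      pairs (and (mem ⟨ #0 , #1 ⟩ 0F) (all< #1 (imp (mem ⟨ #1 , #0 ⟩ 0F) bot))) [] (L ∷ []) λ LL (hLL , _) →
      pairs (and (less 𝟎 #0) (ex< (S #1) (and (mem ⟨ H #1 , #0 ⟩ 0F) (ex< (S #2)
        (and (mem ⟨ #0 , #3 ⟩ 1F) (and (less #1 (S #0)) (and (less #0 (𝟐 · #1))
          (ex< #0 (and (mem ⟨ ⟨ H #3 , #0 ⟩ , #1 ⟩ 2F) (eq (T #0) (T #3)))))))))))
        [] (LL ∷ PR ∷ V ∷ []) λ N (hN , _) →
      pairs (ex< (S #1) (and (mem ⟨ H #1 , #0 ⟩ 0F) (less (𝟐 · #0) (S #2)))) [] (LL ∷ []) λ U (hU , _) →
      k (selected V hV L hL LL hLL N hN U hU) λ q q≤w →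
        selected-value V hV L hL LL hLL N hN U hU {q} q≤w ,
        selected-total V hV L hL LL hLL N hN U hU {q} q≤w ,
        0∉selected V hV L hL LL hLL N hN U hU {q}

-- Instances of WKL as arithmetical formulas

module Path (E : Exponentiation) where

  open Trees E

  -- The premise is moved inside the set quantifier, so that the existence of a branch becomes the
  -- adjunction of a set satisfying one arithmetical formula.
  pathFormula : Formula 0 2
  pathFormula = InfiniteTree 1F ⇒ InfiniteTree 0F ∧ Branch 0F ∧ 0F ⊆ 1F

  ≼-NSQ : ∀ (s t : Term n) → NoSetQuantifier {m = m} (s ≼ t)
  ≼-NSQ s t = ex (and (or (less _ _) (eq _ _)) (ex (and (or (less _ _) (eq _ _))
                 (ex (and (less _ _) (and graph-NSQ (eq _ _)))))))
    where
    graph-NSQ : ∀ {n m} {s t : Term n} → NoSetQuantifier {m = m} (Exponentiation.exp E s t)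
    graph-NSQ = sub-NSQ _ _ (Δ₀⁰⇒NSQ (Exponentiation.graph-Δ₀ E))

  Tree-NSQ : ∀ (X : Fin m) → NoSetQuantifier {n} (Tree X)
  Tree-NSQ X = and (imp (mem _ _) bot)
    (all (imp (mem _ _) (all (imp (and (≼-NSQ _ _) (less _ _)) (mem _ _)))))

  InfiniteTree-NSQ : ∀ (X : Fin m) → NoSetQuantifier {n} (InfiniteTree X)
  InfiniteTree-NSQ X = and (Tree-NSQ X) (imp (ex (all (imp (mem _ _) (less _ _)))) bot)

  pathFormula-NSQ : NoSetQuantifier pathFormula
  pathFormula-NSQ = imp (InfiniteTree-NSQ 1F) (and (InfiniteTree-NSQ 0F) (and
    (and (Tree-NSQ 0F) (all (all (imp (and (mem _ _) (mem _ _)) (or (≼-NSQ _ _) (≼-NSQ _ _))))))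
    (all (imp (mem _ _) (mem _ _)))))

  sub-InfiniteTree : (σ : Fin n → Term n′) (q : Fin m → Fin m′) → ∀ X →
                     sub σ q (InfiniteTree X) ≡ InfiniteTree (q X)
  sub-InfiniteTree σ q X = cong (matrix (q X)) (sub-fuse (λ { 0F → refl ; 1F → refl }) (λ ()) graph)
    where
    open Exponentiation E using (graph)
    matrix : Fin m → Formula (5 ℕ.+ n) m → Formula n m
    matrix X e = (¬′ (𝟎 ∈ X) ∧ ∀ⁿ (#0 ∈ X ⇒ ∀ⁿ (∃≤ #1 (∃≤ #2 (∃< #1
      (e ∧ var 4F ≈ #3 · #2 + #0))) ∧ #0 < #1 ⇒ #0 ∈ X))) ∧ Unbounded X

  sub-≼ : (i j : Fin n) → sub {m′ = m} (var i ∷ var j ∷ []) [] (#0 ≼ #1) ≡ var i ≼ var j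
  sub-≼ i j = cong (λ e → ∃≤ (var j) (∃≤ (wkᵗ (var j)) (∃< #1
                     (e ∧ wkᵗ (wkᵗ (wkᵗ (var j))) ≈ wkᵗ (wkᵗ (wkᵗ (var i))) · #2 + #0))))
    (sub-fuse (λ { 0F → refl ; 1F → refl }) (λ ()) (Exponentiation.graph E))

-- The axioms and the generic branch in the extension

module Generic {P : Set} (𝔐 : Model P) (E : Exponentiation)
  (PR : Model.𝒳 𝔐) (PR-def : Arithmetic._encodes_ 𝔐 PR (Prefix._≼ᵐ_ 𝔐 E))
  (T₀ : Model.𝒳 𝔐) where

  open Model 𝔐
  open Prefix 𝔐 E
  open Collection 𝔐
  open Forcing 𝔐 E PR PR-def T₀
  open Condition
  open Name
  open Kripke _≤ᶜ_ id (λ f g x → g (f x)) P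
  open Algebra kripke using (_⊑_; 𝟙)
  open Forced
  open Trees E
  open Path E

  -- `ν` relates `x` to the pair of the intermediate and the final value, which is `Δ₀⁰` in `g` and
  -- `h`. Only the projection to the final value is not, and `Selection` performs it.
  composition-forced : ∀ q → ∘-axiom ⊨ᴷ (q , [] , [])
  composition-forced q g h q₁ _ ((g-total , g-single , _) , (h-total , h-single , _)) q₂ q₂≤q₁ absent =
    represented (and (mem ⟨ H #0 , H (T #0) ⟩ 0F) (mem ⟨ H (T #0) , T (T #0) ⟩ 1F)) [] (h ∷ g ∷ []) λ ν hν →
    let
      decompose : ∀ {r x v} → r ⊩ pr x v ∊ ν → r ⊩ pr x (h̲ v) ∊ h × r ⊩ pr (h̲ v) (t̲ v) ∊ g
      decompose {r} {x} {v} a = let b , c = proj₂ (hν (pr x v)) {r} a in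
        ⊩-≐ {r} h (pr-≐ h-pr (h-≐ t-pr)) b , ⊩-≐ {r} g (pr-≐ (h-≐ t-pr) (t-≐ t-pr)) c
    in Selection.selection q₂ ν
      (λ x r r≤q₂ k → h-total x r (q₂≤q₁ ∘ r≤q₂) λ z s s≤r a → g-total z s (q₂≤q₁ ∘ r≤q₂ ∘ s≤r) λ y s′ s′≤s b →
        k (pr z y) λ k → k s′
          ( s≤r ∘ s′≤s
          , proj₁ (hν (pr x (pr z y))) {s′}
              ( ⊩-≐ {s′} h (≐-sym (pr-≐ h-pr (≐-trans (h-≐ t-pr) h-pr))) (Almost-≤ {s′} {s} s′≤s a)
              , ⊩-≐ {s′} g (≐-sym (pr-≐ (≐-trans (h-≐ t-pr) h-pr) (≐-trans (t-≐ t-pr) t-pr))) b)))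
      λ f selected → absent f q₂ id
        ( ( (λ x q₃ q₃≤q₂ none → let _ , some-value , _ = selected q₃ q₃≤q₂ in
              some-value x λ v e → e λ r (r≤q₃ , _ , b) → none (t̲ v) r r≤q₃ b)
          , (λ x y y′ q₃ q₃≤q₂ (a , b) →
              given (proj₁ (selected q₃ q₃≤q₂) x y a) λ v e → given e λ r (r≤q₃ , c , t) →
              given (proj₁ (selected r (q₃≤q₂ ∘ r≤q₃)) x y′ (Almost-≤ {r} {q₃} r≤q₃ b)) λ v′ e′ →
              given e′ λ s (s≤r , c′ , t′) →
              let c₁ , c₂ = decompose {s} (Almost-≤ {s} {r} s≤r c)
                  d₁ , d₂ = decompose {s} c′
                  l = λ {τ} → q₂≤q₁ {τ} ∘ q₃≤q₂ ∘ r≤q₃ ∘ s≤r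
                  z≐z′ = h-single x (h̲ v) (h̲ v′) s l (c₁ , d₁)
              in ≐-trans (≐-sym t) (≐-trans
                   (g-single (h̲ v) (t̲ v) (t̲ v′) s l (c₂ , ⊩-≐ {s} g (pr-≐ (≐-sym z≐z′) ≐-refl) d₂)) t′))
          , (λ q₃ q₃≤q₂ → proj₂ (proj₂ (selected q₃ q₃≤q₂))))
        , λ x y z q₃ q₃≤q₂ (a , b) → ⊩-dense {q₃} f (pr x y) λ r r≤q₃ k →
            let _ , some-value , _ = selected r (q₃≤q₂ ∘ r≤q₃) in
            some-value x λ v e → e λ s (s≤r , c , d) →
            let c₁ , c₂ = decompose {s} c
                l = λ {τ} → q₂≤q₁ {τ} ∘ q₃≤q₂ ∘ r≤q₃ ∘ s≤r
                z≐ = h-single x (h̲ v) z s l (c₁ , Almost-≤ {s} {q₃} (r≤q₃ ∘ s≤r) a)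
                y≐ = g-single (h̲ v) (t̲ v) y s l
                       (c₂ , ⊩-≐ {s} g (pr-≐ (≐-sym z≐) ≐-refl) (Almost-≤ {s} {q₃} (r≤q₃ ∘ s≤r) b))
            in k s s≤r (⊩-≐ {s} f (pr-≐ ≐-refl y≐) d))

  module _ {δ : Fin m → 𝒳} {δ′ : Fin m → Name}
           (same : ∀ X x {q} → (x ∊ δ X → q ⊩ x ∊ δ′ X) × (q ⊩ x ∊ δ′ X → x ∊ δ X)) where

    -- The extension has the same numbers, and canonical names decide membership independently of
    -- the condition.
    absolute : {φ : Formula n m} → NoSetQuantifier φ → ∀ {q ρ} →
               (φ ⊨ (ρ , δ) → φ ⊨ᴷ (q , ρ , δ′)) × (φ ⊨ᴷ (q , ρ , δ′) → φ ⊨ (ρ , δ))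
    absolute (eq s t)   = id , id
    absolute (less s t) = id , id
    absolute (mem t X)  {q} = proj₁ (same X _ {q}) , proj₂ (same X _ {q})
    absolute bot        = id , id
    absolute (and c d)  {q} =
      (λ (a , b) → proj₁ (absolute c {q}) a , proj₁ (absolute d {q}) b) ,
      (λ (a , b) → proj₂ (absolute c {q}) a , proj₂ (absolute d {q}) b)
    absolute (or c d)   {q} =
      (λ k r _ (a , b) → k ( (λ x → a r id (proj₁ (absolute c {r}) x))
                           , (λ x → b r id (proj₁ (absolute d {r}) x)))) ,
      (λ k (a , b) → k q id ( (λ r _ x → a (proj₂ (absolute c {r}) x))
                            , (λ r _ x → b (proj₂ (absolute d {r}) x))))
    absolute (imp c d)  {q} =
      (λ f r _ a → proj₁ (absolute d {r}) (f (proj₂ (absolute c {r}) a))) ,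
      (λ f a → proj₂ (absolute d {q}) (f q id (proj₁ (absolute c {q}) a)))
    absolute (all c)    {q} =
      (λ f x → proj₁ (absolute c {q}) (f x)) , (λ f x → proj₂ (absolute c {q}) (f x))
    absolute (ex c)     {q} =
      (λ k r _ f → k λ x a → f x r id (proj₁ (absolute c {r}) a)) ,
      (λ k f → k q id λ x r _ a → f x (proj₂ (absolute c {r}) a))

  forced-RCA₀⁻ : ∀ {φ} → RCA₀⁻ φ → ∀ {q} → φ ⊨ᴷ (q , [] , [])
  forced-RCA₀⁻ a@(inj₁ (inj₁ b)) {q} = proj₁ (absolute (λ ()) (BASIC⇒NSQ b) {q}) (valid a)
  forced-RCA₀⁻ (inj₁ (inj₂ (inj₁ refl))) {q} ν x r _ = induction-forced ν x r
  forced-RCA₀⁻ (inj₁ (inj₂ (inj₂ (comp {n} {m} {φ} d)))) {q} =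
    K.⟦⟧-closure n m (∃ˢ (∀ⁿ (#0 ∈ 0F ⇔ wkˢ φ)))
      (λ ρ δ {_} {r} _ → comprehension-forced d r ρ δ) {𝟙} {q} id
  forced-RCA₀⁻ (inj₂ refl) {q} = composition-forced q

  -- The generic branch

  generic : ∃ᴾ λ G → graph G encodes _≼ᵐ_
  generic k =
    -- By `≼-⪯` a node with code at least `x` has settled whether `x` is on the branch.
    pairs (less #0 (S #1)) [] [] λ U (hU , _) →
    k (record
        { graph   = PR
        ; modulus = U
        ; stable  = λ {x} {b} {σ} {τ} u b⪯σ σ≼τ →
            (λ a → proj₂ (PR-def x τ) (≼-trans (proj₁ (PR-def x σ) a) σ≼τ)) ,
            (λ a → proj₂ (PR-def x σ) (≼-⪯ (proj₁ (PR-def x τ) a) σ≼τ (⪯-trans (proj₁ (hU x b) u) b⪯σ)))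
        ; total   = λ x k → k x (proj₂ (hU x x) ⪯-refl) })
      PR-def

  ≼-forced : ∀ {i j : Fin n} {q ρ} {δ : Fin m → Name} →
             (ρ i ≼ᵐ ρ j → var i ≼ var j ⊨ᴷ (q , ρ , δ)) × (var i ≼ var j ⊨ᴷ (q , ρ , δ) → ρ i ≼ᵐ ρ j)
  ≼-forced {i = i} {j} {q} {ρ} {δ} =
    (λ l → subst (λ φ → φ ⊨ᴷ (q , ρ , δ)) (sub-≼ i j)
      (proj₂ moved {q} (proj₁ (absolute (λ ()) (≼-NSQ #0 #1) {q}) (proj₂ ≼-pair l)))) ,
    (λ a → proj₁ ≼-pair (proj₂ (absolute (λ ()) (≼-NSQ #0 #1) {q})
      (proj₁ moved {q} (subst (λ φ → φ ⊨ᴷ (q , ρ , δ)) (sym (sub-≼ i j)) a))))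
    where
    ≼-pair = ≼-⊨ {i = 0F} {1F} {ρ i ∷ ρ j ∷ []} {[]}
    moved = K.⟦⟧-sub {σ = var i ∷ var j ∷ []} {ρ} {ρ i ∷ ρ j ∷ []} {[]} {δ} {[]}
              (λ { 0F → ≋-refl ; 1F → ≋-refl }) (λ ()) (#0 ≼ #1)

  module _ (G : Name) (hG : graph G encodes _≼ᵐ_)
           (T̂ : Name) (hT : ∀ x {q} → (x ∊ T₀ → q ⊩ x ∊ T̂) × (q ⊩ x ∊ T̂ → x ∊ T₀)) where

    generic-path : ∀ {q} → InfiniteTree 0F ∧ Branch 0F ∧ 0F ⊆ 1F ⊨ᴷ (q , [] , G ∷ T̂ ∷ [])
    generic-path {q} = (is-tree , is-unbounded) , (is-tree , is-linear) , is-inside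
      where
      is-tree : Tree 0F ⊨ᴷ (q , [] , G ∷ T̂ ∷ [])
      is-tree =
        (λ r _ a → Almost-⊥ {r} (Almost-map {r} (λ τ _ b → 0⋠ (proj₁ (hG 𝟘 τ) b)) a)) ,
        (λ τ r _ a σ s s≤r (l , _) → Almost-map {s}
          (λ υ _ b → proj₂ (hG σ υ) (≼-trans (proj₂ (≼-forced {i = 0F} {1F} {s}) l) (proj₁ (hG τ υ) b)))
          (Almost-≤ {s} {r} s≤r a))
      is-unbounded : Unbounded 0F ⊨ᴷ (q , [] , G ∷ T̂ ∷ [])
      is-unbounded r _ k = k r id λ b s s≤r below →
        -- If `b` bounded the branch, then `pigeonhole` applied to level `s̲ b` would give a
        -- condition forcing one node of that level onto the branch.
        pairs (and (less #2 (S #0)) (mem ⟨ #0 , #1 ⟩ 0F)) (s̲ b ∷ []) (PR ∷ []) λ A (hA , _) →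
        pigeonhole s A (2* s̲ b) (2* s̲ b)
          (λ {v} {σ} {τ} v<2b 2b⪯σ σ≼τ →
            (λ a → let l , p = proj₁ (hA v σ) a in
              proj₂ (hA v τ) (l , proj₂ (PR-def v τ) (≼-trans (proj₁ (PR-def v σ) p) σ≼τ))) ,
            (λ a → let l , p = proj₁ (hA v τ) a in
              proj₂ (hA v σ) (l , proj₂ (PR-def v σ)
                (≼-⪯ (proj₁ (PR-def v τ) p) σ≼τ (⋖⇒⪯ (⋖-⪯-trans v<2b 2b⪯σ))))))
          (Almost-from {s} (s̲ b) λ τ _ b⪯τ k → level 0⪯ b⪯τ λ σ (p , b⪯σ , σ<2b) →
            k σ (σ<2b , proj₂ (hA σ τ) (b⪯σ , proj₂ (PR-def σ τ) p)))
          λ x e → e λ u (_ , u≤s , a) →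
            ⋖-irrefl (⋖-trans
              (below x u u≤s (Almost-map {u} (λ τ _ b → proj₂ (hG x τ) (proj₁ (PR-def x τ) (proj₂ (proj₁ (hA x τ) b)))) a))
              (s⪯⇒⋖ (Almost-const {u} (Almost-map {u} (λ τ _ b → proj₁ (proj₁ (hA x τ) b)) a))))
      is-linear : ∀ⁿ (∀ⁿ (#1 ∈ 0F ∧ #0 ∈ 0F ⇒ #1 ≼ #0 ∨ #0 ≼ #1)) ⊨ᴷ (q , [] , G ∷ T̂ ∷ [])
      is-linear x y r _ (a , b) s s≤r (f , g) =
        Almost-⊥ {s} (Almost-map {s}
          (λ τ _ (c , d) → ≼-linear (proj₁ (hG x τ) c) (proj₁ (hG y τ) d)
            ( (λ l → f s id (proj₁ (≼-forced {i = 1F} {0F} {s}) l))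
            , (λ l → g s id (proj₁ (≼-forced {i = 0F} {1F} {s}) l))))
          (Almost-× {s} (Almost-≤ {s} {r} s≤r a) (Almost-≤ {s} {r} s≤r b)))
      is-inside : 0F ⊆ 1F ⊨ᴷ (q , [] , G ∷ T̂ ∷ [])
      is-inside x r _ a = proj₁ (hT x {r}) (Almost-const {r}
        (Almost-map {r} (λ τ i b → inside r (initial r (proj₁ (hG x τ) b) i)) a))

  -- The derivation is evaluated in the forcing semantics at the condition `T₀`. Absoluteness forces
  -- `Δ`, the generic branch forces the path formula, and forcing `⊥′` means `P`.
  refutation-lifts : ∀ {X} → InfiniteTree 1F ⊨ ([] , X ∷ T₀ ∷ []) →
                     (Δ : List (Formula n m)) → All NoSetQuantifier Δ →
                     ∀ ρ δ → (∀ {ψ} → ψ ∈ˡ Δ → ψ ⊨ (ρ , δ)) → ∀ σ q → δ (q 0F) ≡ T₀ →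
                     RCA₀⁻ ∣ sub σ (lift 1 q) pathFormula List.∷ List.map wkˢ Δ ⊢ ⊥′ → P
  refutation-lifts ((0∉T , closed) , infinite) Δ Δ-NSQ ρ δ true σ q T≡ d =
    choose (λ i → ground (δ i)) λ δ̂ same → generic λ G hG →
    K.sound {Th = RCA₀⁻} (λ a {w} _ → forced-RCA₀⁻ a {w}) d {ρ} {G ∷ δ̂} {whole}
      ( proj₂ (K.⟦⟧-sub {σ = σ} {ρ} {[]} {lift 1 q} {G ∷ δ̂} {G ∷ δ̂ (q 0F) ∷ []}
          (λ ()) (λ { 0F → refl ; 1F → refl }) pathFormula) {whole}
          (λ r _ _ → generic-path G hG (δ̂ (q 0F))
            (subst (λ T → ∀ x {r} → (x ∊ T → r ⊩ x ∊ δ̂ (q 0F)) × (r ⊩ x ∊ δ̂ (q 0F) → x ∊ T)) T≡ (same (q 0F))) {r})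
      , K.⟦⟧*-wkˢ Δ {G} {ρ} {δ̂} {whole} (K.⟦⟧*-intro Δ {𝟙} {ρ} {δ̂}
          (λ i {w} _ → proj₁ (absolute (λ X x {r} → same X x {r}) (All.lookup Δ-NSQ i) {w}) (true i)) {whole} id))
    where
    whole : Condition
    whole = record
      { tree      = T₀
      ; initial   = λ {σ} {τ} l i → cases (⋖-suc (≼⇒⪯ l))
          (λ σ<τ → closed τ i σ (proj₂ (≼-⊨ {i = 0F} {1F}) l , σ<τ))
          (λ e → ∊-≐ (≐-sym e) i)
      ; nonzero   = λ {τ} i → compare 𝟘 τ id (λ e → absurd (0∉T (∊-≐ (≐-sym e) i))) (λ l → absurd (⋖0 l))
      ; unbounded = λ b k → infinite λ absent → absent b λ τ i → compare-⪯ τ b id λ l → absurd (k τ (i , l))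
      ; inside    = id
      }

-- Conservation

module _ (E : Exponentiation) where

  open Trees E
  open Path E

  -- In the model of `Δ` falsity is the very conclusion sought. Hence no case distinction on whether
  -- the tree is infinite is needed: if it is, forcing already yields `P`. So the path formula holds
  -- in the model with an arbitrary set in the role of the branch, and soundness applies to the
  -- given refutation.
  conservative-path : Conservative RCA₀⁻ pathFormula
  conservative-path {m′ = suc m′} σ q _ Δ Δ-NSQ d =
    sound {Th = RCA₀⁻} (λ a _ → ⊨-RCA₀⁻ a) d {ini} {inj₁ 0F ∷ inj₁}
      ( proj₂ (⟦⟧-sub {σ = σ} {δ = inj₁ 0F ∷ inj₁ (q 0F) ∷ []} (λ ()) (λ { 0F → refl ; 1F → refl }) pathFormula)
          (λ i → stab (⟦ InfiniteTree 0F ∧ Branch 0F ∧ 0F ⊆ 1F ⟧ [] (inj₁ 0F ∷ inj₁ (q 0F) ∷ [])) λ _ → lifted i)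
      , ⟦⟧*-wkˢ Δ (⟦⟧*-intro Δ {Algebra.𝟙 (tarski P)} (λ i _ → ⊨-initial i) id))
    where
    open Standard Δ Δ-NSQ
    open Structure structure using (⟦_⟧; sound; ⟦⟧-sub; ⟦⟧*-wkˢ; ⟦⟧*-intro)
    lifted : InfiniteTree 1F ⊨ ([] , inj₁ 0F ∷ inj₁ (q 0F) ∷ []) → P
    lifted i = Prefix.pre-set model E λ PR PR-def →
      Generic.refutation-lifts model E PR PR-def (inj₁ (q 0F)) i Δ Δ-NSQ ini inj₁ ⊨-initial σ q refl d

theorem5p9 : (E : Exponentiation) → ConservativeOver Π¹₁ (WKL₀⁻ E) RCA₀⁻
theorem5p9 E _ (π¹₁ {φ} q) d =
  -- The model is built from `¬′ φ` with its set variable free. `WKL₀⁻ E` is valid there, so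
  -- soundness makes `φ` true of that set, and the resulting falsity is a derivation of `⊥′` from
  -- `¬′ φ` in `RCA₀⁻`.
  ∀ˢI (raa (⊨-initial (here refl) (⟦⟧-cong {ρ = []} {δ = inj₁ 0F ∷ []} (λ ()) (λ { 0F → refl }) φ
    (sound {Th = WKL₀⁻ E} valid d {[]} {[]} id (inj₁ 0F)))))
  where
  open Trees E using (InfiniteTree)
  open Path E
  open Standard (¬′ φ List.∷ List.[]) (imp q bot All.∷ All.[])
  open Structure structure using (sound; ⟦⟧-cong; ⟦⟧-sub)
  valid : ∀ {ψ} → WKL₀⁻ E ψ → (P → P) → ψ ⊨ ([] , [])
  valid (inj₁ a)    _ = ⊨-RCA₀⁻ a
  valid (inj₂ refl) _ X i k =
    let G , h = ⊨-conservative pathFormula-NSQ (conservative-path E) [] (X ∷ [])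
    in k G (h (subst (λ ψ → ψ ⊨ ([] , G ∷ X ∷ [])) (sub-InfiniteTree [] suc 0F)
                (proj₂ (⟦⟧-sub {σ = []} {q = suc} (λ ()) (λ _ → refl) (InfiniteTree 0F)) i)))
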